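{- As $N$ tends to infinity through the superabundant numbers, $$\lim_{N\to\infty}\frac{d^{(1)}(N)}{\log N}=e^{ -\gamma}.$$
   Context: A positive integer $N$ is superabundant if $\sigma(M)/M<\sigma(N)/N$ for all positive integers $M<N$, where $\sigma$ is the sum-of-divisors function. For a (sufficiently large) positive integer $N$, enumerate its divisors as $1=d_1<d_2<\cdots<d_{\tau(N)}=N$. The first cutoff divisor is $$d^{(1)}(N):=\max\left\{d_j:\ \sum_{i=1}^j\frac{N}{d_i}\le N\log\log N\right\}.$$ $\gamma$ is the Euler–Mascheroni constant. -}

module Defs where

open import Data.Nat.Base as ℕ using (ℕ; zero; suc; z≤n; s≤s)
import Data.Nat.Properties as ℕ
open import Data.Nat.Divisibility using (_∣_; _∣?_)
open import Data.Integer.Base as ℤ using (-[1+_])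
import Data.Integer.Properties as ℤ
open import Data.Rational.Base
open import Data.Rational.Properties
import Data.Rational.Unnormalised.Base as ℚᵘ
import Data.Rational.Unnormalised.Properties as ℚᵘ
open import Data.Rational.Solver using (module +-*-Solver)
open import Data.List.Base using (List; applyUpTo; filter; foldr; map)
open import Data.Nat.ListAction using (sum)
open import Data.Product.Base using (∃; _×_; _,_; proj₁; proj₂)
open import Data.Sum.Base using (_⊎_; inj₁; inj₂)
open import Data.Empty using (⊥-elim)
open import Relation.Nullary.Decidable.Core using (yes; no)
open import Relation.Binary.PropositionalEquality
  using (_≡_; refl; sym; trans; cong; cong₂; subst; subst₂)

open +-*-Solver using (solve; _:=_; _:+_; _:*_; _:-_; :-_; con)

fromℕ : ℕ → ℚ
fromℕ n = ℤ.+ n / 1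

-- The total reciprocal, with the junk value recip 0 = 0.
recip : ℚ → ℚ
recip q with q ≟ 0ℚ
... | yes _   = 0ℚ
... | no  q≢0 = (1/ q) {{≢-nonZero q≢0}}

*-mono-nn : ∀ {p q r s} → 0ℚ ≤ p → p ≤ q → 0ℚ ≤ r → r ≤ s → p * r ≤ q * s
*-mono-nn {p} {q} {r} {s} 0≤p p≤q 0≤r r≤s = ≤-trans
  (*-monoʳ-≤-nonNeg r {{nonNegative 0≤r}} p≤q)
  (*-monoˡ-≤-nonNeg q {{nonNegative (≤-trans 0≤p p≤q)}} r≤s)

*-monoʳ : ∀ {p q r} → 0ℚ ≤ r → p ≤ q → p * r ≤ q * r
*-monoʳ {r = r} 0≤r = *-monoʳ-≤-nonNeg r {{nonNegative 0≤r}}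

*-monoˡ : ∀ {p q r} → 0ℚ ≤ r → p ≤ q → r * p ≤ r * q
*-monoˡ {r = r} 0≤r = *-monoˡ-≤-nonNeg r {{nonNegative 0≤r}}

*-nonneg : ∀ {p q} → 0ℚ ≤ p → 0ℚ ≤ q → 0ℚ ≤ p * q
*-nonneg {p} {q} 0≤p 0≤q = subst (_≤ p * q) (*-zeroˡ q) (*-monoʳ 0≤q 0≤p)

*-positive : ∀ {p q} → 0ℚ < p → 0ℚ < q → 0ℚ < p * q
*-positive {p} {q} 0<p 0<q =
  subst (_< p * q) (*-zeroˡ q) (*-monoˡ-<-pos q {{positive 0<q}} 0<p)

+-nonneg : ∀ {p q} → 0ℚ ≤ p → 0ℚ ≤ q → 0ℚ ≤ p + q
+-nonneg {p} {q} 0≤p 0≤q = subst (_≤ p + q) (+-identityˡ 0ℚ) (+-mono-≤ 0≤p 0≤q)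

p≤p+q : ∀ {p q} → 0ℚ ≤ q → p ≤ p + q
p≤p+q {p} {q} 0≤q = subst (_≤ p + q) (+-identityʳ p) (+-monoʳ-≤ p 0≤q)

q≤p+q : ∀ {p q} → 0ℚ ≤ p → q ≤ p + q
q≤p+q {p} {q} 0≤p = subst (_≤ p + q) (+-identityˡ q) (+-monoˡ-≤ q 0≤p)

p-q≤r⇒p≤q+r : ∀ {p q r} → p - q ≤ r → p ≤ q + r
p-q≤r⇒p≤q+r {p} {q} {r} h = subst (_≤ q + r)
  (solve 2 (λ p q → q :+ (p :- q) := p) refl p q) (+-monoʳ-≤ q h)

p≤q+r⇒p-q≤r : ∀ {p q r} → p ≤ q + r → p - q ≤ r
p≤q+r⇒p-q≤r {p} {q} {r} h = subst (p - q ≤_)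
  (solve 2 (λ q r → q :+ r :- q := r) refl q r) (+-monoˡ-≤ (- q) h)

p≤q⇒0≤q-p : ∀ {p q} → p ≤ q → 0ℚ ≤ q - p
p≤q⇒0≤q-p {p} {q} h = subst (_≤ q - p) (+-inverseʳ p) (+-monoˡ-≤ (- p) h)

p<q⇒0<q-p : ∀ {p q} → p < q → 0ℚ < q - p
p<q⇒0<q-p {p} {q} h = subst (_< q - p) (+-inverseʳ p) (+-monoˡ-< (- p) h)

0<1 : 0ℚ < 1ℚ
0<1 = positive⁻¹ 1ℚ

p≤∣p∣ : ∀ p → p ≤ ∣ p ∣
p≤∣p∣ p with ≤-total 0ℚ p
... | inj₁ 0≤p = ≤-reflexive (sym (0≤p⇒∣p∣≡p 0≤p))
... | inj₂ p≤0 = ≤-trans p≤0 (0≤∣p∣ p)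

∣p∣≤ : ∀ {p b} → p ≤ b → - p ≤ b → ∣ p ∣ ≤ b
∣p∣≤ {p} {b} h₁ h₂ with ∣p∣≡p∨∣p∣≡-p p
... | inj₁ e = subst (_≤ b) (sym e) h₁
... | inj₂ e = subst (_≤ b) (sym e) h₂

∣p-q∣≡∣q-p∣ : ∀ p q → ∣ p - q ∣ ≡ ∣ q - p ∣
∣p-q∣≡∣q-p∣ p q = trans (sym (∣-p∣≡∣p∣ (p - q)))
  (cong ∣_∣ (solve 2 (λ p q → :- (p :- q) := q :- p) refl p q))

∣p-r∣≤ : ∀ p q r → ∣ p - r ∣ ≤ ∣ p - q ∣ + ∣ q - r ∣
∣p-r∣≤ p q r = subst (λ t → ∣ t ∣ ≤ ∣ p - q ∣ + ∣ q - r ∣)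
  (solve 3 (λ p q r → (p :- q) :+ (q :- r) := p :- r) refl p q r)
  (∣p+q∣≤∣p∣+∣q∣ (p - q) (q - r))

recip-inverseʳ : ∀ {q} → 0ℚ < q → q * recip q ≡ 1ℚ
recip-inverseʳ {q} 0<q with q ≟ 0ℚ
... | yes refl = ⊥-elim (<-irrefl refl 0<q)
... | no  q≢0 = *-inverseʳ q {{≢-nonZero q≢0}}

recip-positive : ∀ {q} → 0ℚ < q → 0ℚ < recip q
recip-positive {q} 0<q = *-cancelˡ-<-nonNeg q {{nonNegative (<⇒≤ 0<q)}}
  (subst₂ _<_ (sym (*-zeroʳ q)) (sym (recip-inverseʳ 0<q)) 0<1)

recip-nonneg : ∀ {q} → 0ℚ < q → 0ℚ ≤ recip q
recip-nonneg 0<q = <⇒≤ (recip-positive 0<q)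

recip-unique : ∀ {q r} → 0ℚ < q → q * r ≡ 1ℚ → r ≡ recip q
recip-unique {q} {r} 0<q e = trans (sym (*-identityʳ r)) (trans (cong (r *_) (sym (recip-inverseʳ 0<q)))
  (trans (solve 3 (λ q r s → r :* (q :* s) := (q :* r) :* s) refl q r (recip q))
  (trans (cong (_* recip q) e) (*-identityˡ (recip q)))))

recip-* : ∀ {p q} → 0ℚ < p → 0ℚ < q → recip (p * q) ≡ recip p * recip q
recip-* {p} {q} 0<p 0<q = sym (recip-unique (*-positive 0<p 0<q)
  (trans (solve 4 (λ p q r s → p :* q :* (r :* s) := (p :* r) :* (q :* s)) refl p q (recip p) (recip q))
  (trans (cong₂ _*_ (recip-inverseʳ 0<p) (recip-inverseʳ 0<q)) (*-identityˡ 1ℚ))))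

recip-anti : ∀ {p q} → 0ℚ < p → p ≤ q → recip q ≤ recip p
recip-anti {p} {q} 0<p p≤q = subst₂ _≤_ eq₁ eq₂
  (*-monoʳ {r = recip p * recip q} (*-nonneg (recip-nonneg 0<p) (recip-nonneg 0<q)) p≤q)
  where
  0<q = <-≤-trans 0<p p≤q
  eq₁ : p * (recip p * recip q) ≡ recip q
  eq₁ = trans (sym (*-assoc p (recip p) (recip q)))
    (trans (cong (_* recip q) (recip-inverseʳ 0<p)) (*-identityˡ (recip q)))
  eq₂ : q * (recip p * recip q) ≡ recip p
  eq₂ = trans (solve 3 (λ q a b → q :* (a :* b) := (q :* b) :* a) refl q (recip p) (recip q))
    (trans (cong (_* recip p) (recip-inverseʳ 0<q)) (*-identityˡ (recip p)))

recip-diff : ∀ {p q} → 0ℚ < p → 0ℚ < q → recip p - recip q ≡ (q - p) * (recip p * recip q)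
recip-diff {p} {q} 0<p 0<q = sym (trans
  (solve 4 (λ p q a b → (q :- p) :* (a :* b) := (q :* b) :* a :- (p :* a) :* b) refl p q (recip p) (recip q))
  (cong₂ _-_
    (trans (cong (_* recip p) (recip-inverseʳ 0<q)) (*-identityˡ (recip p)))
    (trans (cong (_* recip q) (recip-inverseʳ 0<p)) (*-identityˡ (recip q)))))

fromℕ-+ : ∀ m n → fromℕ (m ℕ.+ n) ≡ fromℕ m + fromℕ n
fromℕ-+ m n = toℚᵘ-injective (ℚᵘ.≃-trans (toℚᵘ-fromℚᵘ (ℚᵘ.mkℚᵘ (ℤ.+ (m ℕ.+ n)) 0))
  (ℚᵘ.≃-trans eq (ℚᵘ.≃-sym (ℚᵘ.≃-trans (toℚᵘ-homo-+ (fromℕ m) (fromℕ n))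
    (ℚᵘ.+-cong (toℚᵘ-fromℚᵘ (ℚᵘ.mkℚᵘ (ℤ.+ m) 0)) (toℚᵘ-fromℚᵘ (ℚᵘ.mkℚᵘ (ℤ.+ n) 0)))))))
  where
  eq : ℚᵘ.mkℚᵘ (ℤ.+ (m ℕ.+ n)) 0 ℚᵘ.≃ ℚᵘ.mkℚᵘ (ℤ.+ m) 0 ℚᵘ.+ ℚᵘ.mkℚᵘ (ℤ.+ n) 0
  eq = ℚᵘ.*≡* (cong (ℤ._* ℤ.+ 1) (trans (ℤ.pos-+ m n)
    (sym (cong₂ ℤ._+_ (ℤ.*-identityʳ (ℤ.+ m)) (ℤ.*-identityʳ (ℤ.+ n))))))

fromℕ-suc : ∀ n → fromℕ (suc n) ≡ 1ℚ + fromℕ n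
fromℕ-suc = fromℕ-+ 1

fromℕ-* : ∀ m n → fromℕ (m ℕ.* n) ≡ fromℕ m * fromℕ n
fromℕ-* zero    n = sym (*-zeroˡ (fromℕ n))
fromℕ-* (suc m) n = trans (fromℕ-+ n (m ℕ.* n)) (trans (cong (fromℕ n +_) (fromℕ-* m n))
  (trans (solve 2 (λ x y → y :+ x :* y := (con 1ℚ :+ x) :* y) refl (fromℕ m) (fromℕ n))
    (cong (_* fromℕ n) (sym (fromℕ-suc m)))))

fromℕ-nonneg : ∀ n → 0ℚ ≤ fromℕ n
fromℕ-nonneg zero    = ≤-refl
fromℕ-nonneg (suc n) = subst (0ℚ ≤_) (sym (fromℕ-suc n)) (+-nonneg (<⇒≤ 0<1) (fromℕ-nonneg n))

fromℕ-mono : ∀ {m n} → m ℕ.≤ n → fromℕ m ≤ fromℕ n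
fromℕ-mono {m} {n} m≤n = subst (fromℕ m ≤_)
  (trans (sym (fromℕ-+ m (n ℕ.∸ m))) (cong fromℕ (ℕ.m+[n∸m]≡n m≤n))) (p≤p+q (fromℕ-nonneg (n ℕ.∸ m)))

fromℕ-suc>0 : ∀ n → 0ℚ < fromℕ (suc n)
fromℕ-suc>0 n = <-≤-trans 0<1 (subst (1ℚ ≤_) (sym (fromℕ-suc n)) (p≤p+q (fromℕ-nonneg n)))

-- 1/1+ n = 1/(n+1)
1/1+ : ℕ → ℚ
1/1+ n = recip (fromℕ (suc n))

1/1+-anti : ∀ {m n} → m ℕ.≤ n → 1/1+ n ≤ 1/1+ m
1/1+-anti {m} m≤n = recip-anti (fromℕ-suc>0 m) (fromℕ-mono (s≤s m≤n))

1/1+>0 : ∀ n → 0ℚ < 1/1+ n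
1/1+>0 n = recip-positive (fromℕ-suc>0 n)

archimedean : ∀ q → ∃ λ n → q ≤ fromℕ n
archimedean q@(mkℚ (ℤ.+ n) d c) = n , toℚᵘ-cancel-≤
  (ℚᵘ.≤-respʳ-≃ (ℚᵘ.≃-sym (toℚᵘ-fromℚᵘ (ℚᵘ.mkℚᵘ (ℤ.+ n) 0)))
    (ℚᵘ.*≤* (ℤ.*-monoˡ-≤-nonNeg (ℤ.+ n) (ℤ.+≤+ (s≤s (z≤n {d}))))))
archimedean q@(mkℚ -[1+ n ] d c) = 0 , <⇒≤ (negative⁻¹ q)

1/1+-small : ∀ {ε} → 0ℚ < ε → ∃ λ n → 1/1+ n ≤ ε
1/1+-small {ε} 0<ε with archimedean (recip ε)
... | n , h = n , subst (1/1+ n ≤_) (sym (recip-unique (recip-positive 0<ε)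
  (trans (*-comm (recip ε) ε) (recip-inverseʳ 0<ε))))
  (recip-anti (recip-positive 0<ε) (≤-trans h (fromℕ-mono (ℕ.n≤1+n n))))

-- ∑ n f = f 0 + … + f (n - 1)
∑ : ℕ → (ℕ → ℚ) → ℚ
∑ zero    f = 0ℚ
∑ (suc n) f = ∑ n f + f n

∑-cong : ∀ n {f g : ℕ → ℚ} → (∀ k → k ℕ.< n → f k ≡ g k) → ∑ n f ≡ ∑ n g
∑-cong zero    h = refl
∑-cong (suc n) h = cong₂ _+_ (∑-cong n λ k k<n → h k (ℕ.m<n⇒m<1+n k<n)) (h n (ℕ.n<1+n n))

∑-mono : ∀ n {f g : ℕ → ℚ} → (∀ k → k ℕ.< n → f k ≤ g k) → ∑ n f ≤ ∑ n g
∑-mono zero    h = ≤-refl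
∑-mono (suc n) h = +-mono-≤ (∑-mono n λ k k<n → h k (ℕ.m<n⇒m<1+n k<n)) (h n (ℕ.n<1+n n))

∑-const : ∀ n c → ∑ n (λ _ → c) ≡ fromℕ n * c
∑-const zero    c = sym (*-zeroˡ c)
∑-const (suc n) c = trans (cong (_+ c) (∑-const n c)) (trans
  (solve 2 (λ x c → x :* c :+ c := (con 1ℚ :+ x) :* c) refl (fromℕ n) c)
  (cong (_* c) (sym (fromℕ-suc n))))

∑-*ʳ : ∀ n f c → ∑ n f * c ≡ ∑ n (λ k → f k * c)
∑-*ʳ zero    f c = *-zeroˡ c
∑-*ʳ (suc n) f c = trans (*-distribʳ-+ c (∑ n f) (f n)) (cong (_+ f n * c) (∑-*ʳ n f c))

∑-diff : ∀ n f g → ∣ ∑ n f - ∑ n g ∣ ≤ ∑ n (λ k → ∣ f k - g k ∣)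
∑-diff zero    f g = ≤-refl
∑-diff (suc n) f g = subst (λ t → ∣ t ∣ ≤ ∑ n (λ k → ∣ f k - g k ∣) + ∣ f n - g n ∣)
  (solve 4 (λ a b c d → (a :- b) :+ (c :- d) := (a :+ c) :- (b :+ d)) refl (∑ n f) (∑ n g) (f n) (g n))
  (≤-trans (∣p+q∣≤∣p∣+∣q∣ (∑ n f - ∑ n g) (f n - g n)) (+-monoˡ-≤ ∣ f n - g n ∣ (∑-diff n f g)))

∑-+ : ∀ m n f → ∑ (m ℕ.+ n) f ≡ ∑ m f + ∑ n (λ k → f (m ℕ.+ k))
∑-+ m zero    f = trans (cong (λ t → ∑ t f) (ℕ.+-identityʳ m)) (sym (+-identityʳ (∑ m f)))
∑-+ m (suc n) f = trans (cong (λ t → ∑ t f) (ℕ.+-suc m n))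
  (trans (cong (_+ f (m ℕ.+ n)) (∑-+ m n f)) (+-assoc (∑ m f) (∑ n (λ k → f (m ℕ.+ k))) (f (m ℕ.+ n))))

∑-blocks : ∀ n m f → ∑ (n ℕ.* m) f ≡ ∑ n (λ k → ∑ m (λ i → f (k ℕ.* m ℕ.+ i)))
∑-blocks zero    m f = refl
∑-blocks (suc n) m f = trans (cong (λ t → ∑ t f) (ℕ.+-comm m (n ℕ.* m)))
  (trans (∑-+ (n ℕ.* m) m f) (cong (_+ ∑ m (λ i → f (n ℕ.* m ℕ.+ i))) (∑-blocks n m f)))

Cauchy : (ℕ → ℚ) → Set
Cauchy s = ∀ ε → 0ℚ < ε → ∃ λ K → ∀ m n → K ℕ.≤ m → K ℕ.≤ n → ∣ s m - s n ∣ ≤ ε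

record ℝ : Set where
  constructor mkℝ
  field
    approx : ℕ → ℚ
    cauchy : Cauchy approx

open ℝ public

-- The equality of the reals so represented is mutual _≤ᴿ_, not _≡_.
infix 4 _<ᴿ_ _≤ᴿ_

_<ᴿ_ : ℝ → ℝ → Set
x <ᴿ y = ∃ λ ε → 0ℚ < ε × ∃ λ K → ∀ n → K ℕ.≤ n → approx x n + ε ≤ approx y n

_≤ᴿ_ : ℝ → ℝ → Set
x ≤ᴿ y = ∀ ε → 0ℚ < ε → ∃ λ K → ∀ n → K ℕ.≤ n → approx x n ≤ approx y n + ε

cauchy-up-to : ∀ C s →
  (∀ ε → 0ℚ < ε → ∃ λ K → ∀ m n → K ℕ.≤ m → K ℕ.≤ n → ∣ s m - s n ∣ ≤ C * ε) → Cauchy s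
cauchy-up-to C s h ε 0<ε =
  let K , H = h (ε * recip C′) (*-positive 0<ε (recip-positive 0<C′)) in
  K , λ m n K≤m K≤n → ≤-trans (H m n K≤m K≤n) (≤-trans
    (*-monoʳ (<⇒≤ (*-positive 0<ε (recip-positive 0<C′))) C≤C′) (≤-reflexive eq))
  where
  C′ = 1ℚ + ∣ C ∣
  0<C′ : 0ℚ < C′
  0<C′ = <-≤-trans 0<1 (p≤p+q (0≤∣p∣ C))
  C≤C′ : C ≤ C′
  C≤C′ = ≤-trans (p≤∣p∣ C) (q≤p+q (<⇒≤ 0<1))
  eq : C′ * (ε * recip C′) ≡ ε
  eq = trans (solve 3 (λ c e r → c :* (e :* r) := e :* (c :* r)) refl C′ ε (recip C′))
    (trans (cong (ε *_) (recip-inverseʳ 0<C′)) (*-identityʳ ε))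

bounded : ∀ x → ∃ λ B → 0ℚ ≤ B × ∃ λ K → ∀ n → K ℕ.≤ n → ∣ approx x n ∣ ≤ B
bounded x = let K , H = cauchy x 1ℚ 0<1 in 1ℚ + ∣ approx x K ∣ , +-nonneg (<⇒≤ 0<1) (0≤∣p∣ (approx x K)) , K , λ n K≤n →
  subst (_≤ 1ℚ + ∣ approx x K ∣) (cong ∣_∣ (solve 2 (λ a b → (a :- b) :+ b := a) refl (approx x n) (approx x K)))
    (≤-trans (∣p+q∣≤∣p∣+∣q∣ (approx x n - approx x K) (approx x K))
      (+-monoˡ-≤ ∣ approx x K ∣ (H n K K≤n ℕ.≤-refl)))

cauchy-apply : ∀ (F : ℕ → ℚ → ℚ) (D : ℚ → Set) (x : ℝ) (K₀ : ℕ) (L C : ℚ) → 0ℚ ≤ L → 0ℚ ≤ C →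
  (∀ n → K₀ ℕ.≤ n → D (approx x n)) →
  (∀ n → K₀ ℕ.≤ n → ∀ {p q} → D p → D q → ∣ F n p - F n q ∣ ≤ L * ∣ p - q ∣) →
  (∀ J m n → K₀ ℕ.≤ J → J ℕ.≤ m → J ℕ.≤ n → ∀ {q} → D q → ∣ F m q - F n q ∣ ≤ C * 1/1+ J) →
  Cauchy (λ n → F n (approx x n))
cauchy-apply F D x K₀ L C 0≤L 0≤C inD lip unif = cauchy-up-to (L + C) (λ n → F n (approx x n)) main
  where
  a = approx x
  main : ∀ ε → 0ℚ < ε → ∃ λ K → ∀ m n → K ℕ.≤ m → K ℕ.≤ n → ∣ F m (a m) - F n (a n) ∣ ≤ (L + C) * ε
  main ε 0<ε = J′ , bound
    where
    K = proj₁ (cauchy x ε 0<ε)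
    H = proj₂ (cauchy x ε 0<ε)
    J = proj₁ (1/1+-small 0<ε)
    J-small = proj₂ (1/1+-small 0<ε)
    J′ = K₀ ℕ.⊔ (K ℕ.⊔ J)
    K₀≤J′ = ℕ.m≤m⊔n K₀ (K ℕ.⊔ J)
    K≤J′ = ℕ.≤-trans (ℕ.m≤m⊔n K J) (ℕ.m≤n⊔m K₀ (K ℕ.⊔ J))
    J≤J′ = ℕ.≤-trans (ℕ.m≤n⊔m K J) (ℕ.m≤n⊔m K₀ (K ℕ.⊔ J))
    bound : ∀ m n → J′ ℕ.≤ m → J′ ℕ.≤ n → ∣ F m (a m) - F n (a n) ∣ ≤ (L + C) * ε
    bound m n J′≤m J′≤n = ≤-trans (∣p-r∣≤ (F m (a m)) (F m (a n)) (F n (a n)))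
      (≤-trans (+-mono-≤
        (≤-trans (lip m (ℕ.≤-trans K₀≤J′ J′≤m) (inD m (ℕ.≤-trans K₀≤J′ J′≤m)) (inD n (ℕ.≤-trans K₀≤J′ J′≤n)))
          (*-monoˡ 0≤L (H m n (ℕ.≤-trans K≤J′ J′≤m) (ℕ.≤-trans K≤J′ J′≤n))))
        (≤-trans (unif J′ m n K₀≤J′ J′≤m J′≤n (inD n (ℕ.≤-trans K₀≤J′ J′≤n)))
          (*-monoˡ 0≤C (≤-trans (1/1+-anti J≤J′) J-small))))
        (≤-reflexive (sym (*-distribʳ-+ ε L C))))

fromℚ : ℚ → ℝ
approx (fromℚ q) _ = q
cauchy (fromℚ q) ε 0<ε = 0 , λ _ _ _ _ → subst (λ t → ∣ t ∣ ≤ ε) (sym (+-inverseʳ q)) (<⇒≤ 0<ε)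

fromℕᴿ : ℕ → ℝ
fromℕᴿ n = fromℚ (fromℕ n)

infix  8 -ᴿ_
infixl 7 _*ᴿ_
infixl 6 _+ᴿ_ _-ᴿ_

_+ᴿ_ : ℝ → ℝ → ℝ
approx (x +ᴿ y) n = approx x n + approx y n
cauchy (x +ᴿ y) = cauchy-up-to (1ℚ + 1ℚ) (λ n → approx x n + approx y n) main
  where
  a = approx x
  b = approx y
  main : ∀ ε → 0ℚ < ε → ∃ λ K → ∀ m n → K ℕ.≤ m → K ℕ.≤ n → ∣ (a m + b m) - (a n + b n) ∣ ≤ (1ℚ + 1ℚ) * ε
  main ε 0<ε = let K , H = cauchy x ε 0<ε ; J , G = cauchy y ε 0<ε in K ℕ.⊔ J , λ m n h₁ h₂ → subst₂ _≤_
    (cong ∣_∣ (solve 4 (λ a b c d → (a :- b) :+ (c :- d) := (a :+ c) :- (b :+ d)) refl (a m) (a n) (b m) (b n)))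
    (solve 1 (λ e → e :+ e := (con 1ℚ :+ con 1ℚ) :* e) refl ε)
    (≤-trans (∣p+q∣≤∣p∣+∣q∣ (a m - a n) (b m - b n))
      (+-mono-≤ (H m n (ℕ.m⊔n≤o⇒m≤o K J h₁) (ℕ.m⊔n≤o⇒m≤o K J h₂))
                (G m n (ℕ.m⊔n≤o⇒n≤o K J h₁) (ℕ.m⊔n≤o⇒n≤o K J h₂))))

-ᴿ_ : ℝ → ℝ
approx (-ᴿ x) n = - approx x n
cauchy (-ᴿ x) ε 0<ε = let K , H = cauchy x ε 0<ε in K , λ m n h₁ h₂ → subst (_≤ ε)
  (trans (sym (∣-p∣≡∣p∣ (approx x m - approx x n)))
    (cong ∣_∣ (solve 2 (λ a b → :- (a :- b) := :- a :- :- b) refl (approx x m) (approx x n))))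
  (H m n h₁ h₂)

_-ᴿ_ : ℝ → ℝ → ℝ
x -ᴿ y = x +ᴿ -ᴿ y

∣_∣ᴿ : ℝ → ℝ
approx ∣ x ∣ᴿ n = ∣ approx x n ∣
cauchy ∣ x ∣ᴿ ε 0<ε = let K , H = cauchy x ε 0<ε in K , λ m n h₁ h₂ → ∣p∣≤ (half m n (H m n h₁ h₂))
    (subst (_≤ ε) (solve 2 (λ a b → b :- a := :- (a :- b)) refl ∣ a m ∣ ∣ a n ∣) (half n m (H n m h₂ h₁)))
  where
  a = approx x
  half : ∀ m n → ∣ a m - a n ∣ ≤ ε → ∣ a m ∣ - ∣ a n ∣ ≤ ε
  half m n h = p≤q+r⇒p-q≤r (≤-trans
    (subst (λ t → ∣ t ∣ ≤ ∣ a n ∣ + ∣ a m - a n ∣) (solve 2 (λ a b → b :+ (a :- b) := a) refl (a m) (a n))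
      (∣p+q∣≤∣p∣+∣q∣ (a n) (a m - a n)))
    (+-monoʳ-≤ ∣ a n ∣ h))

_*ᴿ_ : ℝ → ℝ → ℝ
approx (x *ᴿ y) n = approx x n * approx y n
cauchy (x *ᴿ y) = cauchy-up-to (B + C) (λ n → approx x n * approx y n) main
  where
  B = proj₁ (bounded x)
  C = proj₁ (bounded y)
  K₁ = proj₁ (proj₂ (proj₂ (bounded x)))
  K₂ = proj₁ (proj₂ (proj₂ (bounded y)))
  H₁ = proj₂ (proj₂ (proj₂ (bounded x)))
  H₂ = proj₂ (proj₂ (proj₂ (bounded y)))
  a = approx x
  b = approx y
  main : ∀ ε → 0ℚ < ε → ∃ λ K → ∀ m n → K ℕ.≤ m → K ℕ.≤ n → ∣ a m * b m - a n * b n ∣ ≤ (B + C) * ε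
  main ε 0<ε = (K₁ ℕ.⊔ K₂) ℕ.⊔ (K₃ ℕ.⊔ K₄) , bound
    where
    K₃ = proj₁ (cauchy x ε 0<ε)
    K₄ = proj₁ (cauchy y ε 0<ε)
    H₃ = proj₂ (cauchy x ε 0<ε)
    H₄ = proj₂ (cauchy y ε 0<ε)
    bound : ∀ m n → (K₁ ℕ.⊔ K₂) ℕ.⊔ (K₃ ℕ.⊔ K₄) ℕ.≤ m → (K₁ ℕ.⊔ K₂) ℕ.⊔ (K₃ ℕ.⊔ K₄) ℕ.≤ n →
      ∣ a m * b m - a n * b n ∣ ≤ (B + C) * ε
    bound m n h h′ = subst₂ _≤_
      (cong ∣_∣ (solve 4 (λ a b c d → a :* (c :- d) :+ (a :- b) :* d := a :* c :- b :* d) refl (a m) (a n) (b m) (b n)))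
      (solve 3 (λ B C e → B :* e :+ e :* C := (B :+ C) :* e) refl B C ε)
      (≤-trans (∣p+q∣≤∣p∣+∣q∣ (a m * (b m - b n)) ((a m - a n) * b n))
        (+-mono-≤
          (subst (_≤ B * ε) (sym (∣p*q∣≡∣p∣*∣q∣ (a m) (b m - b n)))
            (*-mono-nn (0≤∣p∣ (a m)) (H₁ m (ℕ.m⊔n≤o⇒m≤o K₁ K₂ l)) (0≤∣p∣ (b m - b n))
              (H₄ m n (ℕ.m⊔n≤o⇒n≤o K₃ K₄ r) (ℕ.m⊔n≤o⇒n≤o K₃ K₄ r′))))
          (subst (_≤ ε * C) (sym (∣p*q∣≡∣p∣*∣q∣ (a m - a n) (b n)))
            (*-mono-nn (0≤∣p∣ (a m - a n)) (H₃ m n (ℕ.m⊔n≤o⇒m≤o K₃ K₄ r) (ℕ.m⊔n≤o⇒m≤o K₃ K₄ r′))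
              (0≤∣p∣ (b n)) (H₂ n (ℕ.m⊔n≤o⇒n≤o K₁ K₂ l′))))))
      where
      l  = ℕ.m⊔n≤o⇒m≤o (K₁ ℕ.⊔ K₂) (K₃ ℕ.⊔ K₄) h
      r  = ℕ.m⊔n≤o⇒n≤o (K₁ ℕ.⊔ K₂) (K₃ ℕ.⊔ K₄) h
      l′ = ℕ.m⊔n≤o⇒m≤o (K₁ ℕ.⊔ K₂) (K₃ ℕ.⊔ K₄) h′
      r′ = ℕ.m⊔n≤o⇒n≤o (K₁ ℕ.⊔ K₂) (K₃ ℕ.⊔ K₄) h′

0ᴿ : ℝ
0ᴿ = fromℚ 0ℚ

recipᴿ : (x : ℝ) → 0ᴿ <ᴿ x → ℝ
approx (recipᴿ x _) n = recip (approx x n)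
cauchy (recipᴿ x (δ , 0<δ , K , H)) =
  cauchy-apply (λ _ → recip) (δ ≤_) x K (recip δ * recip δ) 0ℚ
    (*-nonneg (recip-nonneg 0<δ) (recip-nonneg 0<δ)) ≤-refl
    (λ n K≤n → subst (_≤ approx x n) (+-identityˡ δ) (H n K≤n))
    (λ _ _ → lip)
    (λ J m n _ _ _ {q} _ → ≤-reflexive (trans (cong ∣_∣ (+-inverseʳ (recip q))) (sym (*-zeroˡ (1/1+ J)))))
  where
  lip : ∀ {p q} → δ ≤ p → δ ≤ q → ∣ recip p - recip q ∣ ≤ recip δ * recip δ * ∣ p - q ∣
  lip {p} {q} δ≤p δ≤q = subst₂ _≤_
    (sym (trans (cong ∣_∣ (recip-diff 0<p 0<q)) (trans (∣p*q∣≡∣p∣*∣q∣ (q - p) (recip p * recip q))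
      (cong₂ _*_ (∣p-q∣≡∣q-p∣ q p) (0≤p⇒∣p∣≡p (*-nonneg (recip-nonneg 0<p) (recip-nonneg 0<q)))))))
    (*-comm ∣ p - q ∣ (recip δ * recip δ))
    (*-monoˡ (0≤∣p∣ (p - q)) (*-mono-nn (recip-nonneg 0<p) (recip-anti 0<δ δ≤p) (recip-nonneg 0<q) (recip-anti 0<δ δ≤q)))
    where
    0<p = <-≤-trans 0<δ δ≤p
    0<q = <-≤-trans 0<δ δ≤q

-- The limit of a Cauchy sequence of reals: its k-th approximation is an
-- approximation of s k that is within 1/(k+1).
lim : (s : ℕ → ℝ) →
  (∀ ε → 0ℚ < ε → ∃ λ K → ∀ m n → K ℕ.≤ m → K ℕ.≤ n → ∣ s m -ᴿ s n ∣ᴿ ≤ᴿ fromℚ ε) → ℝ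
lim s c = mkℝ (λ k → approx (s k) (index k)) (cauchy-up-to (fromℕ 4) (λ k → approx (s k) (index k)) main)
  where
  index : ℕ → ℕ
  index k = proj₁ (cauchy (s k) (1/1+ k) (1/1+>0 k))
  main : ∀ ε → 0ℚ < ε → ∃ λ K → ∀ m n → K ℕ.≤ m → K ℕ.≤ n →
    ∣ approx (s m) (index m) - approx (s n) (index n) ∣ ≤ fromℕ 4 * ε
  main ε 0<ε = K ℕ.⊔ J , bound
    where
    K = proj₁ (c ε 0<ε)
    H = proj₂ (c ε 0<ε)
    J = proj₁ (1/1+-small 0<ε)
    J-small = proj₂ (1/1+-small 0<ε)
    bound : ∀ m n → K ℕ.⊔ J ℕ.≤ m → K ℕ.⊔ J ℕ.≤ n →
      ∣ approx (s m) (index m) - approx (s n) (index n) ∣ ≤ fromℕ 4 * ε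
    bound m n h h′ = ≤-trans (∣p-r∣≤ am (approx (s m) i) an) (≤-trans
      (+-mono-≤
        (≤-trans (proj₂ (cauchy (s m) (1/1+ m) (1/1+>0 m)) (index m) i ℕ.≤-refl im≤i)
          (≤-trans (1/1+-anti (ℕ.m⊔n≤o⇒n≤o K J h)) J-small))
        (≤-trans (∣p-r∣≤ (approx (s m) i) (approx (s n) i) an)
          (+-mono-≤ (G i I≤i)
            (≤-trans (proj₂ (cauchy (s n) (1/1+ n) (1/1+>0 n)) i (index n) in≤i ℕ.≤-refl)
              (≤-trans (1/1+-anti (ℕ.m⊔n≤o⇒n≤o K J h′)) J-small)))))
      (≤-reflexive (solve 1 (λ e → e :+ (e :+ e :+ e) := con (fromℕ 4) :* e) refl ε)))
      where
      near = H m n (ℕ.m⊔n≤o⇒m≤o K J h) (ℕ.m⊔n≤o⇒m≤o K J h′) ε 0<ε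
      I = proj₁ near
      G = proj₂ near
      am = approx (s m) (index m)
      an = approx (s n) (index n)
      i = I ℕ.⊔ (index m ℕ.⊔ index n)
      I≤i = ℕ.m≤m⊔n I (index m ℕ.⊔ index n)
      im≤i = ℕ.≤-trans (ℕ.m≤m⊔n (index m) (index n)) (ℕ.m≤n⊔m I (index m ℕ.⊔ index n))
      in≤i = ℕ.≤-trans (ℕ.m≤n⊔m (index m) (index n)) (ℕ.m≤n⊔m I (index m ℕ.⊔ index n))

-- logSum n q is the left Riemann sum, with n equal pieces, of log q = ∫₁^q dt/t:
--   Σ_{k<n} (q-1)/n · 1/(1 + k(q-1)/n) = Σ_{k<n} (q-1)/(n + k(q-1)).
denom : ℕ → ℚ → ℕ → ℚ
denom n q k = fromℕ n + fromℕ k * (q - 1ℚ)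

logTerm : ℕ → ℚ → ℕ → ℚ
logTerm n q k = (q - 1ℚ) * recip (denom n q k)

logSum : ℕ → ℚ → ℚ
logSum n q = ∑ n (logTerm n q)

frac-diff : ∀ u v {A B} → 0ℚ < A → 0ℚ < B →
  u * recip A - v * recip B ≡ (u * B - v * A) * (recip A * recip B)
frac-diff u v {A} {B} 0<A 0<B = sym (trans
  (solve 6 (λ u v A B a b → (u :* B :- v :* A) :* (a :* b) := u :* a :* (B :* b) :- v :* b :* (A :* a))
    refl u v A B (recip A) (recip B))
  (cong₂ _-_
    (trans (cong (u * recip A *_) (recip-inverseʳ 0<B)) (*-identityʳ (u * recip A)))
    (trans (cong (v * recip B *_) (recip-inverseʳ 0<A)) (*-identityʳ (v * recip B)))))

∣*∣≤ : ∀ x {a b c} → 0ℚ ≤ a → a ≤ c → 0ℚ ≤ b → b ≤ c → ∣ x * (a * b) ∣ ≤ ∣ x ∣ * (c * c)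
∣*∣≤ x {a} {b} {c} 0≤a a≤c 0≤b b≤c = subst (_≤ ∣ x ∣ * (c * c))
  (sym (trans (∣p*q∣≡∣p∣*∣q∣ x (a * b)) (cong (∣ x ∣ *_) (0≤p⇒∣p∣≡p (*-nonneg 0≤a 0≤b)))))
  (*-monoˡ (0≤∣p∣ x) (*-mono-nn 0≤a a≤c 0≤b b≤c))

module Estimates {δ : ℚ} (0<δ : 0ℚ < δ) (δ≤1 : δ ≤ 1ℚ) where

  denom≥ : ∀ {n k q} → k ℕ.≤ n → δ ≤ q → fromℕ n * δ ≤ denom n q k
  denom≥ {n} {k} {q} k≤n δ≤q = subst₂ _≤_
    (trans (sym (*-distribʳ-+ δ a (fromℕ k))) (cong (_* δ) eq))
    (trans (solve 3 (λ a k q → a :* con 1ℚ :+ k :* q := (a :+ k) :+ k :* (q :- con 1ℚ)) refl a (fromℕ k) q)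
      (cong (_+ fromℕ k * (q - 1ℚ)) eq))
    (+-mono-≤ (*-monoˡ (fromℕ-nonneg (n ℕ.∸ k)) δ≤1) (*-monoˡ (fromℕ-nonneg k) δ≤q))
    where
    a = fromℕ (n ℕ.∸ k)
    eq : a + fromℕ k ≡ fromℕ n
    eq = trans (sym (fromℕ-+ (n ℕ.∸ k) k)) (cong fromℕ (ℕ.m∸n+n≡m k≤n))

  0<nδ : ∀ n → 0ℚ < fromℕ (suc n) * δ
  0<nδ n = *-positive (fromℕ-suc>0 n) 0<δ

  denom>0 : ∀ {n k q} → k ℕ.≤ suc n → δ ≤ q → 0ℚ < denom (suc n) q k
  denom>0 {n} k≤n δ≤q = <-≤-trans (0<nδ n) (denom≥ k≤n δ≤q)

  lipschitz : ∀ n {p q} → δ ≤ p → δ ≤ q →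
    ∣ logSum (suc n) p - logSum (suc n) q ∣ ≤ recip δ * recip δ * ∣ p - q ∣
  lipschitz n {p} {q} δ≤p δ≤q =
    ≤-trans (∑-diff N (logTerm N p) (logTerm N q))
    (≤-trans (∑-mono N term)
    (≤-reflexive (trans (∑-const N (∣ fromℕ N * (p - q) ∣ * (E * E))) eq)))
    where
    N = suc n
    E = recip (fromℕ N * δ)
    term : ∀ k → k ℕ.< N → ∣ logTerm N p k - logTerm N q k ∣ ≤ ∣ fromℕ N * (p - q) ∣ * (E * E)
    term k k<N = subst (λ t → ∣ t ∣ ≤ ∣ fromℕ N * (p - q) ∣ * (E * E))
      (sym (trans (frac-diff (p - 1ℚ) (q - 1ℚ) (denom>0 k≤N δ≤p) (denom>0 k≤N δ≤q))
        (cong (_* (recip (denom N p k) * recip (denom N q k)))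
          (solve 4 (λ p q n k → (p :- con 1ℚ) :* (n :+ k :* (q :- con 1ℚ)) :- (q :- con 1ℚ) :* (n :+ k :* (p :- con 1ℚ))
              := n :* (p :- q)) refl p q (fromℕ N) (fromℕ k)))))
      (∣*∣≤ (fromℕ N * (p - q))
        (recip-nonneg (denom>0 k≤N δ≤p)) (recip-anti (0<nδ n) (denom≥ k≤N δ≤p))
        (recip-nonneg (denom>0 k≤N δ≤q)) (recip-anti (0<nδ n) (denom≥ k≤N δ≤q)))
      where k≤N = ℕ.<⇒≤ k<N
    eq : fromℕ N * (∣ fromℕ N * (p - q) ∣ * (E * E)) ≡ recip δ * recip δ * ∣ p - q ∣
    eq = trans (cong₂ (λ s e → fromℕ N * (s * (e * e)))
        (trans (∣p*q∣≡∣p∣*∣q∣ (fromℕ N) (p - q)) (cong (_* ∣ p - q ∣) (0≤p⇒∣p∣≡p (fromℕ-nonneg N))))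
        (recip-* (fromℕ-suc>0 n) 0<δ))
      (trans (solve 4 (λ N r d x → N :* (N :* x :* ((r :* d) :* (r :* d))) := (N :* r) :* (N :* r) :* (d :* d :* x))
        refl (fromℕ N) (recip (fromℕ N)) (recip δ) ∣ p - q ∣)
      (trans (cong (λ t → t * t * (recip δ * recip δ * ∣ p - q ∣)) (recip-inverseʳ (fromℕ-suc>0 n)))
        (solve 1 (λ x → con 1ℚ :* con 1ℚ :* x := x) refl (recip δ * recip δ * ∣ p - q ∣))))

  mesh : ℚ → ℚ
  mesh q = ∣ q - 1ℚ ∣ * ∣ q - 1ℚ ∣ * (recip δ * recip δ)

  refine : ∀ n m {q} → δ ≤ q →
    ∣ logSum (suc n) q - logSum (suc n ℕ.* suc m) q ∣ ≤ mesh q * 1/1+ n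
  refine n m {q} δ≤q =
    subst₂ (λ a b → ∣ a - b ∣ ≤ mesh q * 1/1+ n) (sym (∑-cong N split)) (sym (∑-blocks N M (logTerm NM q)))
      (≤-trans (∑-diff N (λ k → ∑ M (λ i → coarse k)) (λ k → ∑ M (fine k)))
      (≤-trans (∑-mono N block)
      (≤-reflexive (trans (∑-const N (fromℕ M * c)) eq))))
    where
    N = suc n
    M = suc m
    NM = N ℕ.* M
    u = q - 1ℚ
    rN = recip (fromℕ N)
    rM = recip (fromℕ M)
    E = rN * rM * recip δ
    c = ∣ u ∣ * ∣ u ∣ * fromℕ M * (E * E)
    coarse : ℕ → ℚ
    coarse k = u * recip (fromℕ M * denom N q k)
    fine : ℕ → ℕ → ℚ
    fine k i = logTerm NM q (k ℕ.* M ℕ.+ i)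
    0<NM : 0ℚ < fromℕ N * fromℕ M
    0<NM = *-positive (fromℕ-suc>0 n) (fromℕ-suc>0 m)
    E≡ : recip (fromℕ N * fromℕ M * δ) ≡ E
    E≡ = trans (recip-* 0<NM 0<δ) (cong (_* recip δ) (recip-* (fromℕ-suc>0 n) (fromℕ-suc>0 m)))
    A≥ : ∀ {k} → k ℕ.≤ N → fromℕ N * fromℕ M * δ ≤ fromℕ M * denom N q k
    A≥ {k} k≤N = subst (_≤ fromℕ M * denom N q k)
      (solve 3 (λ N M d → M :* (N :* d) := N :* M :* d) refl (fromℕ N) (fromℕ M) δ)
      (*-monoˡ (fromℕ-nonneg M) (denom≥ k≤N δ≤q))
    B≥ : ∀ {j} → j ℕ.≤ NM → fromℕ N * fromℕ M * δ ≤ denom NM q j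
    B≥ {j} j≤NM = subst (λ t → t * δ ≤ denom NM q j) (fromℕ-* N M) (denom≥ j≤NM δ≤q)
    split : ∀ k → k ℕ.< N → logTerm N q k ≡ ∑ M (λ i → coarse k)
    split k k<N = sym (trans (∑-const M (coarse k))
      (trans (cong (λ t → fromℕ M * (u * t)) (recip-* (fromℕ-suc>0 m) (denom>0 (ℕ.<⇒≤ k<N) δ≤q)))
      (trans (solve 4 (λ M u r d → M :* (u :* (r :* d)) := (M :* r) :* (u :* d)) refl (fromℕ M) u rM (recip (denom N q k)))
      (trans (cong (_* logTerm N q k) (recip-inverseʳ (fromℕ-suc>0 m))) (*-identityˡ (logTerm N q k))))))
    term : ∀ k i → k ℕ.< N → i ℕ.< M → ∣ coarse k - fine k i ∣ ≤ c
    term k i k<N i<M = subst (λ t → ∣ t ∣ ≤ c) (sym diff) (≤-trans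
      (∣*∣≤ (u * (fromℕ i * u))
        (recip-nonneg 0<A) (subst (recip A ≤_) E≡ (recip-anti 0<low (A≥ k≤N)))
        (recip-nonneg 0<B) (subst (recip B ≤_) E≡ (recip-anti 0<low (B≥ j≤NM))))
      (*-monoʳ (subst (λ t → 0ℚ ≤ t * t) E≡ (*-nonneg (recip-nonneg 0<low) (recip-nonneg 0<low))) num))
      where
      j = k ℕ.* M ℕ.+ i
      A = fromℕ M * denom N q k
      B = denom NM q j
      k≤N = ℕ.<⇒≤ k<N
      j≤NM : j ℕ.≤ NM
      j≤NM = ℕ.≤-trans (ℕ.+-monoʳ-≤ (k ℕ.* M) (ℕ.<⇒≤ i<M))
        (ℕ.≤-trans (ℕ.≤-reflexive (ℕ.+-comm (k ℕ.* M) M)) (ℕ.*-monoˡ-≤ M k<N))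
      0<low : 0ℚ < fromℕ N * fromℕ M * δ
      0<low = *-positive 0<NM 0<δ
      0<A = <-≤-trans 0<low (A≥ k≤N)
      0<B = <-≤-trans 0<low (B≥ j≤NM)
      B≡ : B ≡ fromℕ N * fromℕ M + (fromℕ k * fromℕ M + fromℕ i) * u
      B≡ = cong₂ (λ s t → s + t * u) (fromℕ-* N M)
        (trans (fromℕ-+ (k ℕ.* M) i) (cong (_+ fromℕ i) (fromℕ-* k M)))
      diff : coarse k - fine k i ≡ u * (fromℕ i * u) * (recip A * recip B)
      diff = trans (frac-diff u u 0<A 0<B) (cong (_* (recip A * recip B))
        (trans (cong (λ t → u * t - u * A) B≡)
        (solve 5 (λ u N M k i → u :* (N :* M :+ (k :* M :+ i) :* u) :- u :* (M :* (N :+ k :* u)) := u :* (i :* u))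
          refl u (fromℕ N) (fromℕ M) (fromℕ k) (fromℕ i))))
      num : ∣ u * (fromℕ i * u) ∣ ≤ ∣ u ∣ * ∣ u ∣ * fromℕ M
      num = subst₂ _≤_
        (sym (trans (∣p*q∣≡∣p∣*∣q∣ u (fromℕ i * u)) (cong (∣ u ∣ *_)
          (trans (∣p*q∣≡∣p∣*∣q∣ (fromℕ i) u) (cong (_* ∣ u ∣) (0≤p⇒∣p∣≡p (fromℕ-nonneg i)))))))
        (solve 2 (λ x M → x :* (M :* x) := x :* x :* M) refl ∣ u ∣ (fromℕ M))
        (*-monoˡ (0≤∣p∣ u) (*-monoʳ (0≤∣p∣ u) (fromℕ-mono (ℕ.<⇒≤ i<M))))
    block : ∀ k → k ℕ.< N → ∣ ∑ M (λ i → coarse k) - ∑ M (fine k) ∣ ≤ fromℕ M * c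
    block k k<N = ≤-trans (∑-diff M (λ i → coarse k) (fine k))
      (≤-trans (∑-mono M (λ i i<M → term k i k<N i<M)) (≤-reflexive (∑-const M c)))
    eq : fromℕ N * (fromℕ M * c) ≡ mesh q * 1/1+ n
    eq = trans
      (solve 6 (λ N M x n m d → N :* (M :* (x :* x :* M :* ((n :* m :* d) :* (n :* m :* d))))
          := ((N :* n) :* (M :* m) :* (M :* m)) :* (x :* x :* (d :* d) :* n))
        refl (fromℕ N) (fromℕ M) ∣ u ∣ rN rM (recip δ))
      (trans (cong₂ (λ s t → s * t * t * (mesh q * rN)) (recip-inverseʳ (fromℕ-suc>0 n)) (recip-inverseʳ (fromℕ-suc>0 m)))
        (solve 1 (λ x → con 1ℚ :* con 1ℚ :* con 1ℚ :* x := x) refl (mesh q * rN)))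

  mesh≥0 : ∀ q → 0ℚ ≤ mesh q
  mesh≥0 q = *-nonneg (*-nonneg (0≤∣p∣ (q - 1ℚ)) (0≤∣p∣ (q - 1ℚ))) (*-nonneg (recip-nonneg 0<δ) (recip-nonneg 0<δ))

  mesh-bound : ∀ {q B} → ∣ q ∣ ≤ B → mesh q ≤ (B + 1ℚ) * (B + 1ℚ) * (recip δ * recip δ)
  mesh-bound {q} {B} q≤B = *-monoʳ (*-nonneg (recip-nonneg 0<δ) (recip-nonneg 0<δ))
    (*-mono-nn (0≤∣p∣ (q - 1ℚ)) h (0≤∣p∣ (q - 1ℚ)) h)
    where
    h : ∣ q - 1ℚ ∣ ≤ B + 1ℚ
    h = ≤-trans (∣p-q∣≤∣p∣+∣q∣ q 1ℚ) (+-monoˡ-≤ 1ℚ q≤B)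

  uniform : ∀ m n {q} → δ ≤ q → ∣ logSum (suc m) q - logSum (suc n) q ∣ ≤ mesh q * 1/1+ m + mesh q * 1/1+ n
  uniform m n {q} δ≤q = ≤-trans (∣p-r∣≤ (logSum (suc m) q) (logSum (suc m ℕ.* suc n) q) (logSum (suc n) q))
    (+-mono-≤ (refine m n δ≤q)
      (subst (_≤ mesh q * 1/1+ n) (∣p-q∣≡∣q-p∣ (logSum (suc n) q) (logSum (suc m ℕ.* suc n) q))
        (subst (λ t → ∣ logSum (suc n) q - logSum t q ∣ ≤ mesh q * 1/1+ n) (ℕ.*-comm (suc n) (suc m)) (refine n m δ≤q))))

-- The proof that x is positive enters only the Cauchy modulus, not the approximations.
log : (x : ℝ) → 0ᴿ <ᴿ x → ℝ
approx (log x _) n = logSum (suc n) (approx x n)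
cauchy (log x (ε , 0<ε , K , H)) =
  cauchy-apply (λ n → logSum (suc n)) (λ q → δ ≤ q × ∣ q ∣ ≤ B) x (K ℕ.⊔ K′) (recip δ * recip δ) (C + C)
    (*-nonneg (recip-nonneg 0<δ) (recip-nonneg 0<δ)) (+-nonneg 0≤C 0≤C)
    (λ n h → ≤-trans (p⊓q≤p ε 1ℚ) (subst (_≤ approx x n) (+-identityˡ ε) (H n (ℕ.m⊔n≤o⇒m≤o K K′ h)))
           , H′ n (ℕ.m⊔n≤o⇒n≤o K K′ h))
    (λ n _ (δ≤p , _) (δ≤q , _) → lipschitz n δ≤p δ≤q)
    unif
  where
  δ = ε ⊓ 1ℚ
  0<δ : 0ℚ < δ
  0<δ = positive-⊓ (⊓-sel ε 1ℚ)
    where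
    positive-⊓ : δ ≡ ε ⊎ δ ≡ 1ℚ → 0ℚ < δ
    positive-⊓ (inj₁ e) = subst (0ℚ <_) (sym e) 0<ε
    positive-⊓ (inj₂ e) = subst (0ℚ <_) (sym e) 0<1
  open Estimates 0<δ (p⊓q≤q ε 1ℚ)
  B = proj₁ (bounded x)
  K′ = proj₁ (proj₂ (proj₂ (bounded x)))
  H′ = proj₂ (proj₂ (proj₂ (bounded x)))
  C = (B + 1ℚ) * (B + 1ℚ) * (recip δ * recip δ)
  0≤C : 0ℚ ≤ C
  0≤C = *-nonneg (*-nonneg 0≤B+1 0≤B+1) (*-nonneg (recip-nonneg 0<δ) (recip-nonneg 0<δ))
    where
    0≤B+1 : 0ℚ ≤ B + 1ℚ
    0≤B+1 = +-nonneg (proj₁ (proj₂ (bounded x))) (<⇒≤ 0<1)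
  unif : ∀ J m n → K ℕ.⊔ K′ ℕ.≤ J → J ℕ.≤ m → J ℕ.≤ n → ∀ {q} → δ ≤ q × ∣ q ∣ ≤ B →
    ∣ logSum (suc m) q - logSum (suc n) q ∣ ≤ (C + C) * 1/1+ J
  unif J m n _ J≤m J≤n {q} (δ≤q , q≤B) = ≤-trans (uniform m n δ≤q)
    (≤-trans (+-mono-≤ (step J≤m) (step J≤n)) (≤-reflexive (sym (*-distribʳ-+ (1/1+ J) C C))))
    where
    step : ∀ {k} → J ℕ.≤ k → mesh q * 1/1+ k ≤ C * 1/1+ J
    step {k} J≤k = *-mono-nn (mesh≥0 q) (mesh-bound q≤B) (<⇒≤ (1/1+>0 k)) (1/1+-anti J≤k)

fromℕ-suc>0ᴿ : ∀ n → 0ᴿ <ᴿ fromℕᴿ (suc n)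
fromℕ-suc>0ᴿ n = 1ℚ , 0<1 , 0 , λ _ _ → subst₂ _≤_ (sym (+-identityˡ 1ℚ)) (sym (fromℕ-suc n)) (p≤p+q (fromℕ-nonneg n))

-- logℕ 0 is a junk value.
logℕ : ℕ → ℝ
logℕ zero    = 0ᴿ
logℕ (suc n) = log (fromℕᴿ (suc n)) (fromℕ-suc>0ᴿ n)

logSum-positive : ∀ n {q} → 1ℚ < q → (q - 1ℚ) * recip q ≤ logSum (suc n) q
logSum-positive n {q} 1<q = subst (_≤ logSum N q) (trans (∑-const N (u * recip (fromℕ N * q))) eq) (∑-mono N term)
  where
  N = suc n
  u = q - 1ℚ
  0<q = <-trans 0<1 1<q
  0<u : 0ℚ < u
  0<u = p<q⇒0<q-p 1<q
  term : ∀ k → k ℕ.< N → u * recip (fromℕ N * q) ≤ logTerm N q k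
  term k k<N = *-monoˡ (<⇒≤ 0<u) (recip-anti (<-≤-trans (fromℕ-suc>0 n) (p≤p+q (*-nonneg (fromℕ-nonneg k) (<⇒≤ 0<u))))
    (subst (denom N q k ≤_) (solve 2 (λ N q → N :+ N :* (q :- con 1ℚ) := N :* q) refl (fromℕ N) q)
      (+-monoʳ-≤ (fromℕ N) (*-monoʳ (<⇒≤ 0<u) (fromℕ-mono (ℕ.<⇒≤ k<N))))))
  eq : fromℕ N * (u * recip (fromℕ N * q)) ≡ u * recip q
  eq = trans (cong (λ t → fromℕ N * (u * t)) (recip-* (fromℕ-suc>0 n) 0<q))
    (trans (solve 4 (λ N u r s → N :* (u :* (r :* s)) := (N :* r) :* (u :* s)) refl (fromℕ N) u (recip (fromℕ N)) (recip q))
    (trans (cong (_* (u * recip q)) (recip-inverseʳ (fromℕ-suc>0 n))) (*-identityˡ (u * recip q))))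

logℕ>0 : ∀ N → .{{ℕ.NonTrivial N}} → 0ᴿ <ᴿ logℕ N
logℕ>0 (suc (suc n)) = (q - 1ℚ) * recip q
  , *-positive (p<q⇒0<q-p 1<q) (recip-positive (fromℕ-suc>0 (suc n))) , 0
  , λ k _ → subst (_≤ logSum (suc k) q) (sym (+-identityˡ ((q - 1ℚ) * recip q))) (logSum-positive k 1<q)
  where
  q = fromℕ (suc (suc n))
  1<q : 1ℚ < q
  1<q = subst₂ _<_ (+-identityʳ 1ℚ) (sym (fromℕ-suc (suc n))) (+-monoʳ-< 1ℚ (fromℕ-suc>0 n))

-- expTerm q k = q^k / k!
expTerm : ℚ → ℕ → ℚ
expTerm q zero    = 1ℚ
expTerm q (suc k) = expTerm q k * q * 1/1+ k

expSum : ℕ → ℚ → ℚ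
expSum n q = ∑ (suc n) (expTerm q)

module ExpEstimates {B : ℚ} (0≤B : 0ℚ ≤ B) where

  T : ℕ → ℚ
  T = expTerm B

  0≤1/1+ : ∀ k → 0ℚ ≤ 1/1+ k
  0≤1/1+ k = <⇒≤ (1/1+>0 k)

  T≥0 : ∀ k → 0ℚ ≤ T k
  T≥0 zero    = <⇒≤ 0<1
  T≥0 (suc k) = *-nonneg (*-nonneg (T≥0 k) 0≤B) (0≤1/1+ k)

  ∣***∣ : ∀ x y k → ∣ x * y * 1/1+ k ∣ ≡ ∣ x ∣ * ∣ y ∣ * 1/1+ k
  ∣***∣ x y k = trans (∣p*q∣≡∣p∣*∣q∣ (x * y) (1/1+ k))
    (cong₂ _*_ (∣p*q∣≡∣p∣*∣q∣ x y) (0≤p⇒∣p∣≡p (0≤1/1+ k)))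

  term≤ : ∀ {q} → ∣ q ∣ ≤ B → ∀ k → ∣ expTerm q k ∣ ≤ T k
  term≤ q≤B zero    = ≤-refl
  term≤ {q} q≤B (suc k) = subst (_≤ T (suc k)) (sym (∣***∣ (expTerm q k) q k))
    (*-monoʳ (0≤1/1+ k) (*-mono-nn (0≤∣p∣ (expTerm q k)) (term≤ q≤B k) (0≤∣p∣ q) q≤B))

  -- Bound for the derivative of expTerm.
  T′ : ℕ → ℚ
  T′ zero    = 0ℚ
  T′ (suc k) = T k

  k*T : ∀ k → fromℕ k * T k ≡ T′ k * B
  k*T zero    = trans (*-zeroˡ (T 0)) (sym (*-zeroˡ B))
  k*T (suc k) = trans
    (solve 4 (λ n t b r → n :* (t :* b :* r) := (n :* r) :* (t :* b)) refl (fromℕ (suc k)) (T k) B (1/1+ k))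
    (trans (cong (_* (T k * B)) (recip-inverseʳ (fromℕ-suc>0 k))) (*-identityˡ (T k * B)))

  term-lipschitz : ∀ {p q} → ∣ p ∣ ≤ B → ∣ q ∣ ≤ B → ∀ k → ∣ expTerm p k - expTerm q k ∣ ≤ T′ k * ∣ p - q ∣
  term-lipschitz {p} {q} p≤B q≤B zero = ≤-reflexive (sym (*-zeroˡ ∣ p - q ∣))
  term-lipschitz {p} {q} p≤B q≤B (suc k) = subst₂ _≤_
    (trans (sym (∣p*r∣ (a * p + b * (p - q))))
      (cong ∣_∣ (solve 5 (λ x y p q r → ((x :- y) :* p :+ y :* (p :- q)) :* r := x :* p :* r :- y :* q :* r)
        refl (expTerm p k) b p q (1/1+ k))))
    eq
    (*-monoʳ (0≤1/1+ k) (≤-trans (∣p+q∣≤∣p∣+∣q∣ (a * p) (b * (p - q))) (+-mono-≤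
      (subst (_≤ T′ k * x * B) (sym (∣p*q∣≡∣p∣*∣q∣ a p))
        (*-mono-nn (0≤∣p∣ a) (term-lipschitz p≤B q≤B k) (0≤∣p∣ p) p≤B))
      (subst (_≤ T k * x) (sym (∣p*q∣≡∣p∣*∣q∣ b (p - q))) (*-monoʳ (0≤∣p∣ (p - q)) (term≤ q≤B k))))))
    where
    a = expTerm p k - expTerm q k
    b = expTerm q k
    x = ∣ p - q ∣
    ∣p*r∣ : ∀ y → ∣ y * 1/1+ k ∣ ≡ ∣ y ∣ * 1/1+ k
    ∣p*r∣ y = trans (∣p*q∣≡∣p∣*∣q∣ y (1/1+ k)) (cong (∣ y ∣ *_) (0≤p⇒∣p∣≡p (0≤1/1+ k)))
    eq : (T′ k * x * B + T k * x) * 1/1+ k ≡ T k * x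
    eq = trans (solve 5 (λ s x B t r → (s :* x :* B :+ t :* x) :* r := (s :* B :+ t) :* (x :* r)) refl (T′ k) x B (T k) (1/1+ k))
      (trans (cong (λ s → (s + T k) * (x * 1/1+ k)) (sym (k*T k)))
      (trans (solve 4 (λ n t x r → (n :* t :+ t) :* (x :* r) := (con 1ℚ :+ n) :* r :* (t :* x)) refl (fromℕ k) (T k) x (1/1+ k))
      (trans (cong (λ s → s * 1/1+ k * (T k * x)) (sym (fromℕ-suc k)))
      (trans (cong (_* (T k * x)) (recip-inverseʳ (fromℕ-suc>0 k))) (*-identityˡ (T k * x))))))

  ∑T′ : ∀ n → ∑ (suc n) T′ ≡ ∑ n T
  ∑T′ zero    = refl
  ∑T′ (suc n) = cong (_+ T n) (∑T′ n)

  a : ℕ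
  a = proj₁ (archimedean (B + B))

  halves : ∀ {k} → a ℕ.≤ k → T (suc k) + T (suc k) ≤ T k
  halves {k} a≤k = subst₂ _≤_
    (solve 3 (λ t B r → t :* ((B :+ B) :* r) := t :* B :* r :+ t :* B :* r) refl (T k) B (1/1+ k))
    (trans (cong (T k *_) (recip-inverseʳ (fromℕ-suc>0 k))) (*-identityʳ (T k)))
    (*-monoˡ (T≥0 k) (*-monoʳ (0≤1/1+ k)
      (≤-trans (proj₂ (archimedean (B + B))) (fromℕ-mono (ℕ.m≤n⇒m≤1+n a≤k)))))

  tail : ∀ {m} → a ℕ.≤ m → ∀ n → ∑ n (λ i → T (m ℕ.+ i)) + (T (m ℕ.+ n) + T (m ℕ.+ n)) ≤ T m + T m
  tail {m} a≤m zero = ≤-reflexive (trans (+-identityˡ (T (m ℕ.+ 0) + T (m ℕ.+ 0)))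
    (cong (λ t → T t + T t) (ℕ.+-identityʳ m)))
  tail {m} a≤m (suc n) = ≤-trans
    (≤-trans (+-monoʳ-≤ (s + t) (subst (λ k → T k + T k ≤ t) (sym (ℕ.+-suc m n)) (halves (ℕ.≤-trans a≤m (ℕ.m≤m+n m n)))))
      (≤-reflexive (+-assoc s t t)))
    (tail a≤m n)
    where
    s = ∑ n (λ i → T (m ℕ.+ i))
    t = T (m ℕ.+ n)

  tail≤ : ∀ {m} → a ℕ.≤ m → ∀ n → ∑ n (λ i → T (m ℕ.+ i)) ≤ T m + T m
  tail≤ {m} a≤m n = ≤-trans (p≤p+q (+-nonneg (T≥0 (m ℕ.+ n)) (T≥0 (m ℕ.+ n)))) (tail a≤m n)

  L : ℚ
  L = ∑ a T + (T a + T a)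

  ∑T≤L : ∀ {n} → a ℕ.≤ n → ∑ n T ≤ L
  ∑T≤L {n} a≤n = subst (_≤ L) (trans (sym (∑-+ a (n ℕ.∸ a) T)) (cong (λ k → ∑ k T) (ℕ.m+[n∸m]≡n a≤n)))
    (+-monoʳ-≤ (∑ a T) (tail≤ ℕ.≤-refl (n ℕ.∸ a)))

  0≤∑T : ∀ n → 0ℚ ≤ ∑ n T
  0≤∑T zero    = ≤-refl
  0≤∑T (suc n) = +-nonneg (0≤∑T n) (T≥0 n)

  0≤L : 0ℚ ≤ L
  0≤L = +-nonneg (0≤∑T a) (+-nonneg (T≥0 a) (T≥0 a))

  lipschitz : ∀ n → a ℕ.≤ n → ∀ {p q} → ∣ p ∣ ≤ B → ∣ q ∣ ≤ B → ∣ expSum n p - expSum n q ∣ ≤ L * ∣ p - q ∣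
  lipschitz n a≤n {p} {q} p≤B q≤B = ≤-trans (∑-diff (suc n) (expTerm p) (expTerm q))
    (≤-trans (∑-mono (suc n) (λ k _ → term-lipschitz p≤B q≤B k))
    (≤-trans (≤-reflexive (trans (sym (∑-*ʳ (suc n) T′ ∣ p - q ∣)) (cong (_* ∣ p - q ∣) (∑T′ n))))
      (*-monoʳ (0≤∣p∣ (p - q)) (∑T≤L a≤n))))

  T≤Ta : ∀ j → T (a ℕ.+ j) ≤ T a
  T≤Ta zero    = ≤-reflexive (cong T (ℕ.+-identityʳ a))
  T≤Ta (suc j) = ≤-trans (subst (λ k → T k ≤ T (a ℕ.+ j)) (sym (ℕ.+-suc a j))
    (≤-trans (p≤p+q (T≥0 (suc (a ℕ.+ j)))) (halves (ℕ.m≤m+n a j)))) (T≤Ta j)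

  C : ℚ
  C = T a * B + T a * B

  0≤C : 0ℚ ≤ C
  0≤C = +-nonneg (*-nonneg (T≥0 a) 0≤B) (*-nonneg (T≥0 a) 0≤B)

  uniform-≤ : ∀ {m n} → a ℕ.≤ m → m ℕ.≤ n → ∀ {q} → ∣ q ∣ ≤ B → ∣ expSum n q - expSum m q ∣ ≤ C * 1/1+ m
  uniform-≤ {m} {n} a≤m m≤n {q} q≤B = subst (λ t → ∣ t ∣ ≤ C * 1/1+ m) (sym eq)
    (≤-trans ∑-abs (≤-trans (∑-mono d (λ i _ → term≤ q≤B (suc m ℕ.+ i)))
    (≤-trans (tail≤ (ℕ.m≤n⇒m≤1+n a≤m) d)
    (≤-trans (+-mono-≤ Tm Tm) (≤-reflexive (sym (*-distribʳ-+ (1/1+ m) (T a * B) (T a * B))))))))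
    where
    d = n ℕ.∸ m
    rest : ℕ → ℚ
    rest i = expTerm q (suc m ℕ.+ i)
    eq : expSum n q - expSum m q ≡ ∑ d rest
    eq = trans (cong (_- expSum m q) (trans (cong (λ k → ∑ (suc k) (expTerm q)) (sym (ℕ.m+[n∸m]≡n m≤n)))
        (∑-+ (suc m) d (expTerm q))))
      (solve 2 (λ x y → x :+ y :- x := y) refl (expSum m q) (∑ d rest))
    ∑-abs : ∣ ∑ d rest ∣ ≤ ∑ d (λ i → ∣ rest i ∣)
    ∑-abs = go d
      where
      go : ∀ d → ∣ ∑ d rest ∣ ≤ ∑ d (λ i → ∣ rest i ∣)
      go zero    = ≤-refl
      go (suc d) = ≤-trans (∣p+q∣≤∣p∣+∣q∣ (∑ d rest) (rest d)) (+-monoˡ-≤ ∣ rest d ∣ (go d))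
    Tm : T (suc m) ≤ T a * B * 1/1+ m
    Tm = *-monoʳ (0≤1/1+ m) (*-monoʳ 0≤B (subst (λ k → T k ≤ T a) (ℕ.m+[n∸m]≡n a≤m) (T≤Ta (m ℕ.∸ a))))

  uniform : ∀ J m n → a ℕ.≤ J → J ℕ.≤ m → J ℕ.≤ n → ∀ {q} → ∣ q ∣ ≤ B → ∣ expSum m q - expSum n q ∣ ≤ C * 1/1+ J
  uniform J m n a≤J J≤m J≤n {q} q≤B = go (ℕ.≤-total m n)
    where
    go : m ℕ.≤ n ⊎ n ℕ.≤ m → ∣ expSum m q - expSum n q ∣ ≤ C * 1/1+ J
    go (inj₁ m≤n) = subst (_≤ C * 1/1+ J) (∣p-q∣≡∣q-p∣ (expSum n q) (expSum m q))
      (≤-trans (uniform-≤ (ℕ.≤-trans a≤J J≤m) m≤n q≤B) (*-monoˡ 0≤C (1/1+-anti J≤m)))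
    go (inj₂ n≤m) = ≤-trans (uniform-≤ (ℕ.≤-trans a≤J J≤n) n≤m q≤B) (*-monoˡ 0≤C (1/1+-anti J≤n))

exp : ℝ → ℝ
approx (exp x) n = expSum n (approx x n)
cauchy (exp x) = cauchy-apply expSum (λ q → ∣ q ∣ ≤ B) x (a ℕ.⊔ K) L C 0≤L 0≤C
  (λ n h → H n (ℕ.m⊔n≤o⇒n≤o a K h))
  (λ n h → lipschitz n (ℕ.m⊔n≤o⇒m≤o a K h))
  (λ J m n h → uniform J m n (ℕ.m⊔n≤o⇒m≤o a K h))
  where
  B = proj₁ (bounded x)
  K = proj₁ (proj₂ (proj₂ (bounded x)))
  H = proj₂ (proj₂ (proj₂ (bounded x)))
  open ExpEstimates (proj₁ (proj₂ (bounded x)))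

-- harmonic n = 1 + 1/2 + … + 1/n
harmonic : ℕ → ℚ
harmonic n = ∑ n 1/1+

vanishing : ∀ {C ε} → 0ℚ ≤ C → 0ℚ < ε → ∃ λ J → ∀ j → J ℕ.≤ j → C * 1/1+ j ≤ ε
vanishing {C} {ε} 0≤C 0<ε = J , λ j J≤j → ≤-trans
    (*-mono-nn 0≤C (q≤p+q (<⇒≤ 0<1)) (<⇒≤ (1/1+>0 j)) (≤-trans (1/1+-anti J≤j) (proj₂ small)))
    (≤-reflexive (trans (solve 3 (λ c e r → c :* (e :* r) := e :* (c :* r)) refl C′ ε (recip C′))
      (trans (cong (ε *_) (recip-inverseʳ 0<C′)) (*-identityʳ ε))))
  where
  C′ = 1ℚ + C
  0<C′ : 0ℚ < C′
  0<C′ = <-≤-trans 0<1 (p≤p+q 0≤C)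
  small = 1/1+-small (*-positive 0<ε (recip-positive 0<C′))
  J = proj₁ small

module Gamma (p : ℕ) where

  open Estimates 0<1 ≤-refl

  P = suc p

  -- The Riemann sum of ∫₁ⁿ⁺¹ dt/t with mesh 1/P.
  A : ℕ → ℚ
  A n = ∑ (P ℕ.* n) (λ i → 1/1+ (p ℕ.+ i))

  logSum≡A : ∀ n → logSum (P ℕ.* suc n) (fromℕ (suc (suc n))) ≡ A (suc n)
  logSum≡A n = ∑-cong (P ℕ.* m) λ i _ →
    trans (cong₂ (λ u t → u * recip (t + fromℕ i * u)) u≡m (fromℕ-* P m))
    (trans (cong (λ t → fromℕ m * recip t)
      (trans (solve 3 (λ P m i → P :* m :+ i :* m := m :* (P :+ i)) refl (fromℕ P) (fromℕ m) (fromℕ i))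
        (cong (fromℕ m *_) (sym (fromℕ-+ P i)))))
    (trans (cong (fromℕ m *_) (recip-* (fromℕ-suc>0 n) (fromℕ-suc>0 (p ℕ.+ i))))
    (trans (sym (*-assoc (fromℕ m) (recip (fromℕ m)) (1/1+ (p ℕ.+ i))))
    (trans (cong (_* 1/1+ (p ℕ.+ i)) (recip-inverseʳ (fromℕ-suc>0 n))) (*-identityˡ (1/1+ (p ℕ.+ i)))))))
    where
    m = suc n
    u≡m : fromℕ (suc m) - 1ℚ ≡ fromℕ m
    u≡m = trans (cong (_- 1ℚ) (fromℕ-suc m)) (solve 1 (λ m → con 1ℚ :+ m :- con 1ℚ := m) refl (fromℕ m))

  logSum≈A : ∀ n → ∣ logSum P (fromℕ (suc (suc n))) - A (suc n) ∣ ≤ mesh (fromℕ (suc (suc n))) * 1/1+ p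
  logSum≈A n = subst (λ t → ∣ logSum P q - t ∣ ≤ mesh q * 1/1+ p) (logSum≡A n)
    (refine p n (fromℕ-mono {1} {suc (suc n)} (s≤s z≤n)))
    where q = fromℕ (suc (suc n))

  Δ : ℕ → ℚ
  Δ n = ∑ P (λ i → 1/1+ (p ℕ.+ (P ℕ.* n ℕ.+ i)))

  A-suc : ∀ n → A (suc n) ≡ A n + Δ n
  A-suc n = trans (cong (λ k → ∑ k (λ i → 1/1+ (p ℕ.+ i))) (trans (ℕ.*-suc P n) (ℕ.+-comm P (P ℕ.* n))))
    (∑-+ (P ℕ.* n) P (λ i → 1/1+ (p ℕ.+ i)))

  cancel : ∀ n → ∑ P (λ _ → recip (fromℕ (P ℕ.* suc n))) ≡ 1/1+ n
  cancel n = trans (∑-const P (recip (fromℕ (P ℕ.* suc n))))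
    (trans (cong (λ t → fromℕ P * recip t) (fromℕ-* P (suc n)))
    (trans (cong (fromℕ P *_) (recip-* (fromℕ-suc>0 p) (fromℕ-suc>0 n)))
    (trans (sym (*-assoc (fromℕ P) (1/1+ p) (1/1+ n)))
    (trans (cong (_* 1/1+ n) (recip-inverseʳ (fromℕ-suc>0 p))) (*-identityˡ (1/1+ n))))))

  P*[1+n]≤ : ∀ n i → P ℕ.* suc n ℕ.≤ P ℕ.+ (P ℕ.* n ℕ.+ i)
  P*[1+n]≤ n i = ℕ.≤-trans (ℕ.≤-reflexive (ℕ.*-suc P n)) (ℕ.+-monoʳ-≤ P (ℕ.m≤m+n (P ℕ.* n) i))

  ≤P*[2+n] : ∀ n i → i ℕ.≤ P → P ℕ.+ (P ℕ.* n ℕ.+ i) ℕ.≤ P ℕ.* suc (suc n)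
  ≤P*[2+n] n i i≤P = ℕ.≤-trans (ℕ.+-monoʳ-≤ P (ℕ.≤-trans (ℕ.+-monoʳ-≤ (P ℕ.* n) i≤P)
    (ℕ.≤-reflexive (trans (ℕ.+-comm (P ℕ.* n) P) (sym (ℕ.*-suc P n))))))
    (ℕ.≤-reflexive (sym (ℕ.*-suc P (suc n))))

  Δ≤ : ∀ n → Δ n ≤ 1/1+ n
  Δ≤ n = subst (Δ n ≤_) (cancel n)
    (∑-mono P λ i _ → recip-anti (fromℕ-suc>0 (n ℕ.+ p ℕ.* suc n)) (fromℕ-mono (P*[1+n]≤ n i)))

  Δ≥ : ∀ n → 1/1+ (suc n) ≤ Δ n
  Δ≥ n = subst (_≤ Δ n) (cancel (suc n))
    (∑-mono P λ i i<P → recip-anti (fromℕ-suc>0 (p ℕ.+ (P ℕ.* n ℕ.+ i))) (fromℕ-mono (≤P*[2+n] n i (ℕ.<⇒≤ i<P))))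

  h : ℕ → ℚ
  h n = harmonic (suc n) - A n

  h-suc : ∀ n → h (suc n) + (Δ n - 1/1+ (suc n)) ≡ h n
  h-suc n = trans (cong (λ t → harmonic (suc n) + 1/1+ (suc n) - t + (Δ n - 1/1+ (suc n))) (A-suc n))
    (solve 4 (λ H r A D → H :+ r :- (A :+ D) :+ (D :- r) := H :- A) refl (harmonic (suc n)) (1/1+ (suc n)) (A n) (Δ n))

  h-anti : ∀ d n → h (d ℕ.+ n) ≤ h n
  h-anti zero    n = ≤-refl
  h-anti (suc d) n = ≤-trans (subst (h (suc (d ℕ.+ n)) ≤_) (h-suc (d ℕ.+ n)) (p≤p+q (p≤q⇒0≤q-p (Δ≥ (d ℕ.+ n))))) (h-anti d n)

  h-drop : ∀ d n → h n + 1/1+ (d ℕ.+ n) ≤ h (d ℕ.+ n) + 1/1+ n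
  h-drop zero    n = ≤-refl
  h-drop (suc d) n = subst₂ _≤_
    (solve 3 (λ x r s → x :+ r :+ (s :- r) := x :+ s) refl (h n) (1/1+ k) (1/1+ (suc k)))
    (solve 4 (λ y s D t → y :+ (D :- s) :+ t :+ (s :- D) := y :+ t) refl (h (suc k)) (1/1+ (suc k)) (Δ k) (1/1+ n))
    (+-mono-≤ (subst (λ t → h n + 1/1+ k ≤ t + 1/1+ n) (sym (h-suc k)) (h-drop d n))
      (+-monoʳ-≤ (1/1+ (suc k)) (neg-antimono-≤ (Δ≤ k))))
    where k = d ℕ.+ n

  h-near-≤ : ∀ {m n} → n ℕ.≤ m → ∣ h m - h n ∣ ≤ 1/1+ n
  h-near-≤ {m} {n} n≤m = ∣p∣≤
    (p≤q+r⇒p-q≤r (≤-trans (subst (λ k → h k ≤ h n) e (h-anti (m ℕ.∸ n) n)) (p≤p+q (<⇒≤ (1/1+>0 n)))))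
    (subst (_≤ 1/1+ n) (solve 2 (λ x y → y :- x := :- (x :- y)) refl (h m) (h n))
      (p≤q+r⇒p-q≤r {h n} {h m} (≤-trans (p≤p+q (<⇒≤ (1/1+>0 m)))
        (subst (λ k → h n + 1/1+ k ≤ h k + 1/1+ n) e (h-drop (m ℕ.∸ n) n)))))
    where
    e = ℕ.m∸n+n≡m n≤m

  h-near : ∀ K {m n} → K ℕ.≤ m → K ℕ.≤ n → ∣ h m - h n ∣ ≤ 1/1+ K
  h-near K {m} {n} K≤m K≤n = go (ℕ.≤-total n m)
    where
    go : n ℕ.≤ m ⊎ m ℕ.≤ n → ∣ h m - h n ∣ ≤ 1/1+ K
    go (inj₁ n≤m) = ≤-trans (h-near-≤ n≤m) (1/1+-anti K≤n)
    go (inj₂ m≤n) = subst (_≤ 1/1+ K) (∣p-q∣≡∣q-p∣ (h n) (h m)) (≤-trans (h-near-≤ m≤n) (1/1+-anti K≤m))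

  near : ∀ K m n → suc K ℕ.≤ m → suc K ℕ.≤ n →
    ∣ (harmonic (suc m) - logSum P (fromℕ (suc m))) - (harmonic (suc n) - logSum P (fromℕ (suc n))) ∣
      ≤ 1/1+ K + (mesh (fromℕ (suc m)) + mesh (fromℕ (suc n))) * 1/1+ p
  near K m@(suc m′) n@(suc n′) K≤m K≤n = subst₂ _≤_
    (cong ∣_∣ (solve 6 (λ H H′ A A′ l l′ → ((H :- A) :- (H′ :- A′)) :+ ((l′ :- A′) :- (l :- A)) := (H :- l) :- (H′ :- l′))
      refl (harmonic (suc m)) (harmonic (suc n)) (A m) (A n) l l′))
    (solve 4 (λ k a b r → k :+ (b :* r :+ a :* r) := k :+ (a :+ b) :* r) refl (1/1+ K) (mesh (fromℕ (suc m))) (mesh (fromℕ (suc n))) (1/1+ p))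
    (≤-trans (∣p+q∣≤∣p∣+∣q∣ (h m - h n) ((l′ - A n) - (l - A m)))
      (+-mono-≤ (h-near K (ℕ.<⇒≤ K≤m) (ℕ.<⇒≤ K≤n))
        (≤-trans (∣p-q∣≤∣p∣+∣q∣ (l′ - A n) (l - A m)) (+-mono-≤ (logSum≈A n′) (logSum≈A m′)))))
    where
    l = logSum P (fromℕ (suc m))
    l′ = logSum P (fromℕ (suc n))

-- The Euler–Mascheroni constant, as the limit of 1 + 1/2 + … + 1/n - log n.
γ : ℝ
γ = lim s s-cauchy
  where
  s : ℕ → ℝ
  s n = fromℚ (harmonic (suc n)) -ᴿ logℕ (suc n)
  s-cauchy : ∀ ε → 0ℚ < ε → ∃ λ K → ∀ m n → K ℕ.≤ m → K ℕ.≤ n → ∣ s m -ᴿ s n ∣ᴿ ≤ᴿ fromℚ ε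
  s-cauchy ε 0<ε = suc K , λ m n h h′ ε′ 0<ε′ →
    let J , H = vanishing (+-nonneg (mesh≥0 (fromℕ (suc m))) (mesh≥0 (fromℕ (suc n)))) 0<ε′ in
    J , λ j J≤j → ≤-trans (Gamma.near j K m n h h′) (+-mono-≤ (proj₂ (1/1+-small 0<ε)) (H j J≤j))
    where
    K = proj₁ (1/1+-small 0<ε)
    open Estimates 0<1 ≤-refl

loglogℕ : ∀ N → .{{ℕ.NonTrivial N}} → ℝ
loglogℕ N = log (logℕ N) (logℕ>0 N)

-- In increasing order, each once.
divisors : ℕ → List ℕ
divisors n = filter (_∣? n) (applyUpTo suc n)

σ : ℕ → ℕ
σ n = sum (divisors n)

abundancy : ℕ → ℚ
abundancy n = fromℕ (σ n) * recip (fromℕ n)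

Superabundant : ℕ → Set
Superabundant N = 0 ℕ.< N × (∀ M → 0 ℕ.< M → M ℕ.< N → abundancy M < abundancy N)

sumℚ : List ℚ → ℚ
sumℚ = foldr _+_ 0ℚ

-- Σ N/e over the divisors e ≤ d of N.  For d = d_j, the j-th divisor of N in
-- increasing order, these e are d_1, …, d_j.
cofactorSum : ℕ → ℕ → ℚ
cofactorSum N d = sumℚ (map (λ e → fromℕ N * recip (fromℕ e)) (filter (ℕ._≤? d) (divisors N)))

Admissible : ∀ N → .{{ℕ.NonTrivial N}} → ℕ → Set
Admissible N d = d ∣ N × fromℚ (cofactorSum N d) ≤ᴿ fromℕᴿ N *ᴿ loglogℕ N

-- d is d⁽¹⁾(N).  A relation rather than a function: _≤ᴿ_ is not decidable, so the
-- maximum cannot be computed, but it is unique, and it exists classically as soon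
-- as log log N ≥ 1, which makes the divisor 1 admissible.
IsFirstCutoff : ∀ N → .{{ℕ.NonTrivial N}} → ℕ → Set
IsFirstCutoff N d = Admissible N d × (∀ e → Admissible N e → e ℕ.≤ d)

module Submission where

-- Let N be superabundant, x = log N and H_n = 1 + 1/2 + … + 1/n.  Comparing N with N q^k / p, where p is
-- its largest prime factor, shows that every prime power q^j ≤ 31p/32, hence every integer y ≤ 31p/32,
-- divides N.  Let p′ be a prime just above p.  Comparing N with N p′ / q^k and N p′ / (q₁ q₂) shows that
-- prime powers dividing N are at most p′² and that all but O(√p′) primes occur to the first power, so
-- N ≤ e^{o(p)} ∏_{q ≤ p} q ≤ 4^p e^{o(p)}.  Since e^{H_y} ≥ (31/20)(y + 1) and (31/20)(31/32) > log 4,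
-- H_y > log log N for y close to 31p/32: the cutoff happens while all integers still divide N, and
-- therefore H_d ≤ log log N ≤ H_{d+1}.  As H_n - log n decreases and H_n - log (n + 1) increases to γ,
-- this gives d ≤ x e^{-γ} ≤ d + 2.
--
-- The exponential enters only through its Taylor sums F_m: Bernoulli's inequality gives
-- (1 + h) F_m(a) ≤ F_{m+1}(a + h) and (1 - h) F_m(a + h) ≤ F_m(a), and multiplying these along a
-- partition compares exp with the Riemann sums defining log and with the harmonic numbers.

-- The prime factors of `N` serve only to place the cutoff inside the range of integers that all
-- divide `N`; the sharp constant then comes from harmonic sums. For that any bound log N ≤ c p with
-- c < (31/20)(31/32) ≈ 1.502 will do. Since log 4 ≈ 1.386, there is room for three roundings: a
-- factor 51/50 per unit of p for the error term, the rational 29/20 in (21/20)^29 ≥ 4 · 51/50, and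
-- 49/50 for the tolerance in exp and log.
--
-- The prime p′ enters only through √p′ and log p′, so it may be as large as O(p log p), which the
-- growth of lcm(1, ..., n) yields.
--
-- Reals are Cauchy sequences with undecidable order, so estimates are proved for rational
-- approximations at large indices. Each upward step raises the degree of a Taylor sum; at a
-- nonnegative argument the F_m increase with m and converge uniformly on bounded sets, so the
-- degree may be lowered again at the end for an arbitrarily small error. The estimates speak of
-- F_k(g) with g ≈ γ, the theorem of F_k(-g); the relation F_k(g) F_k(-g) → 1 has to be proved for
-- the Taylor sums themselves.

module NumberTheory where

  open import Data.Nat
  open import Data.Nat.Properties
  open import Data.Nat.Divisibility
  open import Data.Nat.DivMod
  open import Data.Nat.Primality
  open import Data.Nat.Induction using (<-rec)
  open import Data.Nat.Tactic.RingSolver using (solve-∀)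
  open import Data.Nat.ListAction using (sum)
  open import Defs using (σ)
  open import Data.List.Base using (filter; applyUpTo)
  open import Data.Product using (∃; ∃₂; _×_; _,_; proj₁; proj₂)
  open import Data.Sum using (_⊎_; inj₁; inj₂)
  open import Data.Empty using (⊥; ⊥-elim)
  open import Relation.Nullary using (¬_; yes; no; Dec)
  open import Relation.Nullary.Decidable using (from-yes)
  open import Relation.Binary.PropositionalEquality
  open import Function using (id; _∘_)

  -- Prime factors and prime-power components

  prime>1 : ∀ {p} → Prime p → 1 < p
  prime>1 {p} pr = nonTrivial⇒n>1 p {{prime⇒nonTrivial pr}}

  prime>0 : ∀ {p} → Prime p → 0 < p
  prime>0 pr = <-trans z<s (prime>1 pr)

  prime∤1 : ∀ {p} → Prime p → ¬ p ∣ 1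
  prime∤1 pr p∣1 = <-irrefl (sym (∣1⇒≡1 p∣1)) (prime>1 pr)

  prime∣prime : ∀ {p q} → Prime p → Prime q → p ∣ q → p ≡ q
  prime∣prime pp pq p∣q with prime⇒irreducible pq p∣q
  ... | inj₁ refl = ⊥-elim (prime∤1 pp ∣-refl)
  ... | inj₂ p≡q  = p≡q

  prime∣^ : ∀ {p q} → Prime p → Prime q → ∀ a → p ∣ q ^ a → p ≡ q
  prime∣^ pp pq zero    p∣1 = ⊥-elim (prime∤1 pp p∣1)
  prime∣^ {q = q} pp pq (suc a) h with euclidsLemma q (q ^ a) pp h
  ... | inj₁ p∣q  = prime∣prime pp pq p∣q
  ... | inj₂ p∣qᵃ = prime∣^ pp pq a p∣qᵃ

  ^-pos : ∀ {q} → 0 < q → ∀ a → 0 < q ^ a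
  ^-pos {q} 0<q a = m^n>0 q {{>-nonZero 0<q}} a

  *-pos : ∀ {m n} → 0 < m → 0 < n → 0 < m * n
  *-pos {suc m} {suc n} _ _ = z<s

  *-posʳ : ∀ m {n} → 0 < m * n → 0 < n
  *-posʳ m {zero}  h = ⊥-elim (<-irrefl refl (subst (0 <_) (*-zeroʳ m) h))
  *-posʳ m {suc n} h = z<s

  ∣⇒≤′ : ∀ {m n} → 0 < n → m ∣ n → m ≤ n
  ∣⇒≤′ 0<n = ∣⇒≤ {{>-nonZero 0<n}}

  m<m*q : ∀ {m q} → 0 < m → 1 < q → m < m * q
  m<m*q {m} {q} 0<m 1<q = m<m*n m q {{>-nonZero 0<m}} 1<q

  n<q^n : ∀ {q} → 1 < q → ∀ n → n < q ^ n
  n<q^n 1<q zero = z<s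
  n<q^n {q} 1<q (suc n) = <-≤-trans (s≤s (n<q^n 1<q n))
    (subst (suc (q ^ n) ≤_) (*-comm (q ^ n) q) (m<m*q (^-pos (<-trans z<s 1<q) n) 1<q))

  ∃prime∣ : ∀ n → 1 < n → ∃ λ q → Prime q × q ∣ n
  ∃prime∣ = <-rec _ go
    where
    go : ∀ n → (∀ {m} → m < n → 1 < m → ∃ λ q → Prime q × q ∣ m) → 1 < n → ∃ λ q → Prime q × q ∣ n
    go n rec 1<n with prime? n
    ... | yes pr = n , pr , ∣-refl
    ... | no ¬pr with ¬prime⇒composite {{n>1⇒nonTrivial 1<n}} ¬pr
    ...   | composite {d} d<n d∣n with rec d<n (nonTrivial⇒n>1 d)
    ...     | q , pq , q∣d = q , pq , ∣-trans q∣d d∣n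

  strip : ∀ {q} → Prime q → ∀ n → 0 < n → ∃₂ λ a r → n ≡ q ^ a * r × ¬ q ∣ r
  strip {q} pq = <-rec _ go
    where
    go : ∀ n → (∀ {m} → m < n → 0 < m → ∃₂ λ a r → m ≡ q ^ a * r × ¬ q ∣ r) →
      0 < n → ∃₂ λ a r → n ≡ q ^ a * r × ¬ q ∣ r
    go n rec 0<n with q ∣? n
    ... | no q∤n = 0 , n , sym (*-identityˡ n) , q∤n
    ... | yes (divides zero refl) = ⊥-elim (<-irrefl refl 0<n)
    ... | yes (divides c@(suc _) refl) with rec (m<m*q {c} z<s (prime>1 pq)) z<s
    ...   | a , r , eq , q∤r = suc a , r , trans (cong (_* q) eq) (lem q (q ^ a) r) , q∤r
      where
      lem : ∀ q x r → x * r * q ≡ q * x * r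
      lem = solve-∀

  ^∣*⇒^∣ : ∀ {q} → Prime q → ∀ {x} → ¬ q ∣ x → ∀ a y → q ^ a ∣ x * y → q ^ a ∣ y
  ^∣*⇒^∣ pq q∤x zero y h = 1∣ y
  ^∣*⇒^∣ {q} pq {x} q∤x (suc a) y h with euclidsLemma x y pq (∣-trans (m∣m*n (q ^ a)) h)
  ... | inj₁ q∣x = ⊥-elim (q∤x q∣x)
  ... | inj₂ (divides c refl) = subst (q * q ^ a ∣_) (*-comm q c) (*-monoʳ-∣ q (^∣*⇒^∣ pq q∤x a c
      (*-cancelˡ-∣ q {{>-nonZero (prime>0 pq)}} (subst (q * q ^ a ∣_) (lem x c q) h))))
    where
    lem : ∀ x c q → x * (c * q) ≡ q * (x * c)
    lem = solve-∀

  PrimesBelow : ℕ → ℕ → Set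
  PrimesBelow y n = ∀ {q} → Prime q → q ∣ n → q ≤ y

  primesBelow-pred : ∀ {y n} → PrimesBelow (suc y) n → (Prime (suc y) → ¬ suc y ∣ n) → PrimesBelow y n
  primesBelow-pred h ¬h {q} pq q∣n with m≤n⇒m<n∨m≡n (h pq q∣n)
  ... | inj₁ q<1+y = s≤s⁻¹ q<1+y
  ... | inj₂ refl  = ⊥-elim (¬h pq q∣n)

  primesBelow-0 : ∀ {n} → 0 < n → PrimesBelow 0 n → n ≡ 1
  primesBelow-0 {suc zero} _ h = refl
  primesBelow-0 {suc (suc n)} _ h with ∃prime∣ (suc (suc n)) (s≤s z<s)
  ... | q , pq , q∣n = ⊥-elim (<-irrefl refl (<-≤-trans (prime>0 pq) (h pq q∣n)))

  primesBelow-strip : ∀ {y m} a r → PrimesBelow (suc y) m → m ≡ suc y ^ a * r → ¬ suc y ∣ r → PrimesBelow y r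
  primesBelow-strip {y} a r h refl ∤r =
    primesBelow-pred (λ pq q∣r → h pq (∣n⇒∣m*n (suc y ^ a) q∣r)) (λ _ → ∤r)

  -- Induction on the bound for the primes: after the power of `suc y` is stripped from m, the rest
  -- r divides n = c r by induction, and the stripped power, being prime to r, must divide c.
  primePowers∣⇒∣ : ∀ y m n → 0 < m → PrimesBelow y m →
    (∀ {q} a → Prime q → q ^ a ∣ m → q ^ a ∣ n) → m ∣ n
  primePowers∣⇒∣ zero m n 0<m below h = subst (_∣ n) (sym (primesBelow-0 0<m below)) (1∣ n)
  primePowers∣⇒∣ (suc y) m n 0<m below h with prime? (suc y)
  ... | no ¬pr = primePowers∣⇒∣ y m n 0<m (primesBelow-pred below λ pr → ⊥-elim (¬pr pr)) h
  ... | yes pr with strip pr m 0<m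
  ...   | a , r , refl , ∤r with primePowers∣⇒∣ y r n (*-posʳ (suc y ^ a) 0<m) (primesBelow-strip a r below refl ∤r)
                              (λ b pq d → h b pq (∣n⇒∣m*n (suc y ^ a) d))
  ...     | divides c refl = *-monoˡ-∣ r (^∣*⇒^∣ pr ∤r a c
              (subst (suc y ^ a ∣_) (*-comm c r) (h a pr (m∣m*n r))))

  -- Products over the primes up to a bound

  primeOr1 : (ℕ → ℕ) → ℕ → ℕ
  primeOr1 w q with prime? q
  ... | yes _ = w q
  ... | no  _ = 1

  ΠP : (ℕ → ℕ) → ℕ → ℕ
  ΠP w zero    = 1
  ΠP w (suc y) = primeOr1 w (suc y) * ΠP w y

  primeOr1-prime : ∀ w {q} → Prime q → primeOr1 w q ≡ w q
  primeOr1-prime w {q} pq with prime? q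
  ... | yes _  = refl
  ... | no ¬pq = ⊥-elim (¬pq pq)

  primeOr1-¬prime : ∀ w {q} → ¬ Prime q → primeOr1 w q ≡ 1
  primeOr1-¬prime w {q} ¬pq with prime? q
  ... | yes pq = ⊥-elim (¬pq pq)
  ... | no _   = refl

  -- The weights bound the prime-power components of `n` one by one. A constant weight gives the
  -- crude bound for a superabundant number, a weight close to q the fine one.
  ≤ΠP : ∀ w y n → 0 < n → PrimesBelow y n → (∀ {q} a → Prime q → q ^ a ∣ n → q ^ a ≤ w q) → n ≤ ΠP w y
  ≤ΠP w zero n 0<n below h = ≤-reflexive (primesBelow-0 0<n below)
  ≤ΠP w (suc y) n 0<n below h with prime? (suc y)
  ... | no ¬pr = ≤-trans (≤ΠP w y n 0<n (primesBelow-pred below λ pr → ⊥-elim (¬pr pr)) h) (m≤m+n _ 0)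
  ... | yes pr with strip pr n 0<n
  ...   | a , r , refl , ∤r = *-mono-≤ (h a pr (m∣m*n r))
            (≤ΠP w y r (*-posʳ (suc y ^ a) 0<n) (primesBelow-strip a r below refl ∤r)
              (λ b pq d → h b pq (∣n⇒∣m*n (suc y ^ a) d)))

  ΠP-mono : ∀ {w w′} → (∀ {q} → Prime q → w q ≤ w′ q) → ∀ y → ΠP w y ≤ ΠP w′ y
  ΠP-mono h zero    = ≤-refl
  ΠP-mono h (suc y) with prime? (suc y)
  ... | yes pr = *-mono-≤ (h pr) (ΠP-mono h y)
  ... | no  _  = *-monoʳ-≤ 1 (ΠP-mono h y)

  ΠP-* : ∀ u v y → ΠP (λ q → u q * v q) y ≡ ΠP u y * ΠP v y
  ΠP-* u v zero    = refl
  ΠP-* u v (suc y) with prime? (suc y)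
  ... | yes _ = trans (cong (u (suc y) * v (suc y) *_) (ΠP-* u v y)) (lem (u (suc y)) (v (suc y)) (ΠP u y) (ΠP v y))
    where
    lem : ∀ a b c d → a * b * (c * d) ≡ a * c * (b * d)
    lem = solve-∀
  ... | no  _ = trans (cong (1 *_) (ΠP-* u v y)) (lem (ΠP u y) (ΠP v y))
    where
    lem : ∀ c d → 1 * (c * d) ≡ 1 * c * (1 * d)
    lem = solve-∀

  ΠP≤^ : ∀ w {c} → 0 < c → (∀ {q} → Prime q → w q ≤ c) → ∀ y → ΠP w y ≤ c ^ y
  ΠP≤^ w 0<c h zero    = ≤-refl
  ΠP≤^ w 0<c h (suc y) with prime? (suc y)
  ... | yes pr = *-mono-≤ (h pr) (ΠP≤^ w 0<c h y)
  ... | no  _  = *-mono-≤ 0<c (ΠP≤^ w 0<c h y)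

  ΠP>0 : ∀ w → (∀ {q} → Prime q → 0 < w q) → ∀ y → 0 < ΠP w y
  ΠP>0 w h zero    = z<s
  ΠP>0 w h (suc y) with prime? (suc y)
  ... | yes pr = *-pos (h pr) (ΠP>0 w h y)
  ... | no  _  = *-pos {1} z<s (ΠP>0 w h y)

  ∣ΠP : ∀ w {q} → Prime q → ∀ y → q ≤ y → w q ∣ ΠP w y
  ∣ΠP w pq zero    q≤0 = ⊥-elim (<-irrefl refl (<-≤-trans (prime>0 pq) q≤0))
  ∣ΠP w pq (suc y) q≤1+y with m≤n⇒m<n∨m≡n q≤1+y
  ... | inj₁ q<1+y = ∣n⇒∣m*n (primeOr1 w (suc y)) (∣ΠP w pq y (s≤s⁻¹ q<1+y))
  ... | inj₂ refl  = subst (λ t → w (suc y) ∣ t * ΠP w y) (sym (primeOr1-prime w pq)) (m∣m*n (ΠP w y))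

  -- A stretch without primes contributes nothing, hence the exponent p in place of y. This is what
  -- sets a long prime gap against the growth of lcm(1, ..., n).
  ΠP-gap : ∀ w {c p} → 0 < c → (∀ {q} → Prime q → w q ≤ c) → ∀ y → (∀ {q} → Prime q → q ≤ y → q ≤ p) → ΠP w y ≤ c ^ p
  ΠP-gap w {c} {p} 0<c h zero gap = ^-pos 0<c p
  ΠP-gap w {c} {p} 0<c h (suc y) gap with suc y ≤? p
  ... | yes y<p = ≤-trans (ΠP≤^ w 0<c h (suc y)) (^-monoʳ-≤ c {{>-nonZero 0<c}} y<p)
  ... | no  y≮p = subst (_≤ c ^ p)
        (trans (sym (*-identityˡ (ΠP w y))) (cong (_* ΠP w y) (sym (primeOr1-¬prime w λ pr → y≮p (gap pr ≤-refl)))))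
        (ΠP-gap w 0<c h y (λ pq q≤y → gap pq (m≤n⇒m≤1+n q≤y)))

  -- The least common multiple of 1, ..., n

  logFloor : ℕ → ℕ → ℕ
  logFloor q zero    = 0
  logFloor q (suc n) with q ^ suc (logFloor q n) ≤? suc n
  ... | yes _ = suc (logFloor q n)
  ... | no  _ = logFloor q n

  <^logFloor : ∀ {q} → 1 < q → ∀ n → n < q ^ suc (logFloor q n)
  <^logFloor {q} 1<q zero = ^-pos (<-trans z<s 1<q) 1
  <^logFloor {q} 1<q (suc n) with q ^ suc (logFloor q n) ≤? suc n
  ... | yes _ = <-≤-trans (s≤s (<^logFloor 1<q n))
        (subst (suc (q ^ suc (logFloor q n)) ≤_) (*-comm _ q) (m<m*q (^-pos (<-trans z<s 1<q) (suc (logFloor q n))) 1<q))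
  ... | no  h = ≰⇒> h

  ^logFloor≤ : ∀ {q} → 1 < q → ∀ n → 0 < n → q ^ logFloor q n ≤ n
  ^logFloor≤ {q} 1<q (suc n) _ with q ^ suc (logFloor q n) ≤? suc n
  ... | yes h = h
  ^logFloor≤ {q} 1<q (suc zero) _    | no _ = ≤-refl
  ^logFloor≤ {q} 1<q (suc (suc n)) _ | no _ = m≤n⇒m≤1+n (^logFloor≤ 1<q (suc n) z<s)

  ^≤⇒≤logFloor : ∀ {q} → 1 < q → ∀ a n → q ^ a ≤ n → a ≤ logFloor q n
  ^≤⇒≤logFloor {q} 1<q a n h with a ≤? logFloor q n
  ... | yes r = r
  ... | no ¬r = ⊥-elim (<-irrefl refl (<-≤-trans (<^logFloor 1<q n)
        (≤-trans (^-monoʳ-≤ q {{>-nonZero (<-trans z<s 1<q)}} (≰⇒> ¬r)) h)))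

  -- This is lcm(1, ..., n): each prime q ≤ n enters with its largest power not exceeding n.
  commonMultiple : ℕ → ℕ
  commonMultiple n = ΠP (λ q → q ^ logFloor q n) n

  ^-∣-mono : ∀ q {a b} → a ≤ b → q ^ a ∣ q ^ b
  ^-∣-mono q {a} {b} a≤b = subst (λ t → q ^ a ∣ q ^ t) (m+[n∸m]≡n a≤b)
    (subst (q ^ a ∣_) (sym (^-distribˡ-+-* q a (b ∸ a))) (m∣m*n (q ^ (b ∸ a))))

  ∣commonMultiple : ∀ {m n} → 0 < m → m ≤ n → m ∣ commonMultiple n
  ∣commonMultiple {m} {n} 0<m m≤n = primePowers∣⇒∣ m m (commonMultiple n) 0<m (λ _ → ∣⇒≤′ 0<m) go
    where
    go : ∀ {q} a → Prime q → q ^ a ∣ m → q ^ a ∣ commonMultiple n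
    go zero pq _ = 1∣ _
    go {q} (suc a) pq h = ∣-trans
      (^-∣-mono q (^≤⇒≤logFloor (prime>1 pq) (suc a) n (≤-trans (∣⇒≤′ 0<m h) m≤n)))
      (∣ΠP (λ q → q ^ logFloor q n) pq n (≤-trans (∣⇒≤′ 0<m (∣-trans (m∣m*n (q ^ a)) h)) m≤n))

  -- Binomial coefficients and Leibniz's harmonic triangle

  -- binom i j = (i + j)! / (i! j!)
  binom : ℕ → ℕ → ℕ
  binom zero    j       = 1
  binom (suc i) zero    = 1
  binom (suc i) (suc j) = binom i (suc j) + binom (suc i) j

  binom-0 : ∀ i → binom i 0 ≡ 1
  binom-0 zero    = refl
  binom-0 (suc i) = refl

  binom-sym : ∀ i j → binom i j ≡ binom j i
  binom-sym zero    j       = sym (binom-0 j)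
  binom-sym (suc i) zero    = refl
  binom-sym (suc i) (suc j) = trans (+-comm (binom i (suc j)) (binom (suc i) j))
    (cong₂ _+_ (binom-sym (suc i) j) (binom-sym i (suc j)))

  binom-! : ∀ i j → binom i j * (i ! * j !) ≡ (i + j) !
  binom-! zero    j       = trans (*-identityˡ _) (*-identityˡ (j !))
  binom-! (suc i) zero    = trans (lem (suc i !)) (cong _! (sym (+-identityʳ (suc i))))
    where
    lem : ∀ x → 1 * (x * 1) ≡ x
    lem = solve-∀
  binom-! (suc i) (suc j) = begin
    (x + y) * (suc i * i ! * (suc j * j !))
      ≡⟨ lem x y (i !) (j !) i j ⟩
    suc i * (x * (i ! * (suc j * j !))) + suc j * (y * (suc i * i ! * j !))
      ≡⟨ cong₂ (λ s t → suc i * s + suc j * t) (trans (binom-! i (suc j)) (cong _! (+-suc i j))) (binom-! (suc i) j) ⟩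
    suc i * suc (i + j) ! + suc j * suc (i + j) !
      ≡⟨ lem′ (suc (i + j) !) i j ⟩
    suc (suc (i + j)) * suc (i + j) !
      ≡⟨ cong _! (cong suc (sym (+-suc i j))) ⟩
    suc (i + suc j) ! ∎
    where
    open ≡-Reasoning
    x = binom i (suc j)
    y = binom (suc i) j
    lem : ∀ x y a b i j → (x + y) * ((1 + i) * a * ((1 + j) * b)) ≡
      (1 + i) * (x * (a * ((1 + j) * b))) + (1 + j) * (y * ((1 + i) * a * b))
    lem = solve-∀
    lem′ : ∀ f i j → (1 + i) * f + (1 + j) * f ≡ (2 + (i + j)) * f
    lem′ = solve-∀

  binom>0 : ∀ i j → 0 < binom i j
  binom>0 zero    j       = z<s
  binom>0 (suc i) zero    = z<s
  binom>0 (suc i) (suc j) = <-≤-trans (binom>0 i (suc j)) (m≤m+n _ _)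

  -- Entries of row n are at most 2^(n-1) in every row but row 0. The two forms are proved together
  -- because Pascal's rule yields one neighbour of each form.
  binom≤2^ : ∀ i j → binom i (suc j) ≤ 2 ^ (i + j)
  binom≤2^′ : ∀ i j → binom (suc i) j ≤ 2 ^ (i + j)
  binom≤2^ zero    j = ^-pos z<s j
  binom≤2^ (suc i) j = +-mono-≤ (binom≤2^ i j) (≤-trans (binom≤2^′ i j) (m≤m+n _ 0))
  binom≤2^′ i zero    = ^-pos z<s (i + 0)
  binom≤2^′ i (suc j) = subst (binom (suc i) (suc j) ≤_) (cong (2 ^_) (sym (+-suc i j)))
    (+-mono-≤ (binom≤2^ i j) (≤-trans (binom≤2^′ i j) (m≤m+n _ 0)))

  4^ : ∀ m → 4 ^ m ≡ 2 ^ (m + m)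
  4^ m = trans (^-*-assoc 2 2 m) (cong (2 ^_) (cong (m +_) (+-identityʳ m)))

  -- By Pascal's rule and symmetry, twice this coefficient is the central one of row 2m + 2, which
  -- is at most 2^(2m+1).
  binom-central≤4^ : ∀ m → binom m (suc m) ≤ 4 ^ m
  binom-central≤4^ m = *-cancelˡ-≤ 2 (subst₂ _≤_
    (trans (cong (binom m (suc m) +_) (binom-sym (suc m) m)) (cong (binom m (suc m) +_) (sym (+-identityʳ _))))
    (cong (2 *_) (sym (4^ m)))
    (binom≤2^ (suc m) m))

  -- leibniz i j is the reciprocal of an entry of Leibniz's harmonic triangle.
  leibniz : ℕ → ℕ → ℕ
  leibniz i j = suc i * binom (suc i) j

  leibniz-! : ∀ i j → leibniz i j * (i ! * j !) ≡ suc (i + j) !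
  leibniz-! i j = trans (lem (binom (suc i) j) (i !) (j !) i) (binom-! (suc i) j)
    where
    lem : ∀ b x y i → (1 + i) * b * (x * y) ≡ b * ((1 + i) * x * y)
    lem = solve-∀

  leibniz-right : ∀ i j → suc j * leibniz i (suc j) ≡ (2 + (i + j)) * leibniz i j
  leibniz-right i j = *-cancelʳ-≡ _ _ (i ! * j !) {{>-nonZero (*-pos (1≤n! i) (1≤n! j))}} (begin
    suc j * leibniz i (suc j) * (i ! * j !)   ≡⟨ lem (leibniz i (suc j)) (i !) (j !) j ⟩
    leibniz i (suc j) * (i ! * suc j !)       ≡⟨ leibniz-! i (suc j) ⟩
    suc (i + suc j) !                         ≡⟨ cong (_!) (cong suc (+-suc i j)) ⟩
    (2 + (i + j)) * suc (i + j) !             ≡⟨ cong ((2 + (i + j)) *_) (sym (leibniz-! i j)) ⟩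
    (2 + (i + j)) * (leibniz i j * (i ! * j !)) ≡⟨ sym (*-assoc (2 + (i + j)) (leibniz i j) (i ! * j !)) ⟩
    (2 + (i + j)) * leibniz i j * (i ! * j !) ∎)
    where
    open ≡-Reasoning
    lem : ∀ l x y j → (1 + j) * l * (x * y) ≡ l * (x * ((1 + j) * y))
    lem = solve-∀

  leibniz-down : ∀ i j → suc i * leibniz (suc i) j ≡ (2 + (i + j)) * leibniz i j
  leibniz-down i j = *-cancelʳ-≡ _ _ (i ! * j !) {{>-nonZero (*-pos (1≤n! i) (1≤n! j))}} (begin
    suc i * leibniz (suc i) j * (i ! * j !)   ≡⟨ lem (leibniz (suc i) j) (i !) (j !) i ⟩
    leibniz (suc i) j * (suc i ! * j !)       ≡⟨ leibniz-! (suc i) j ⟩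
    (2 + (i + j)) * suc (i + j) !             ≡⟨ cong ((2 + (i + j)) *_) (sym (leibniz-! i j)) ⟩
    (2 + (i + j)) * (leibniz i j * (i ! * j !)) ≡⟨ sym (*-assoc (2 + (i + j)) (leibniz i j) (i ! * j !)) ⟩
    (2 + (i + j)) * leibniz i j * (i ! * j !) ∎)
    where
    open ≡-Reasoning
    lem : ∀ l x y j → (1 + j) * l * (x * y) ≡ l * ((1 + j) * x * y)
    lem = solve-∀

  binom-1 : ∀ j → binom 1 j ≡ suc j
  binom-1 zero    = refl
  binom-1 (suc j) = cong suc (binom-1 j)

  -- By 1/leibniz (i+1) j = 1/leibniz i j - 1/leibniz i (j+1), every entry up to row n is
  -- an integral combination of 1, 1/2, …, 1/n.
  leibniz∣ : ∀ i j {l} → (∀ m → 0 < m → m ≤ suc (i + j) → m ∣ l) → leibniz i j ∣ l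
  leibniz∣ zero j {l} h = subst (_∣ l) (trans (sym (binom-1 j)) (sym (*-identityˡ (binom 1 j)))) (h (suc j) z<s ≤-refl)
  leibniz∣ (suc i) j {l} h with leibniz∣ i j (λ m 0<m m≤ → h m 0<m (m≤n⇒m≤1+n m≤))
                              | leibniz∣ i (suc j) (λ m 0<m m≤ → h m 0<m (≤-trans m≤ (≤-reflexive (cong suc (+-suc i j)))))
  ... | divides x l≡xD | divides y l≡yE = divides w (*-cancelˡ-≡ l (w * F) (suc i) (begin
      suc i * l           ≡⟨ cong (suc i *_) l≡xD ⟩
      suc i * (x * D)     ≡⟨ sym (*-assoc (suc i) x D) ⟩
      suc i * x * D       ≡⟨ cong (_* D) (sym nw) ⟩
      n * w * D           ≡⟨ lem₁ n w D ⟩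
      w * (n * D)         ≡⟨ cong (w *_) (sym (leibniz-down i j)) ⟩
      w * (suc i * F)     ≡⟨ lem₂ w (suc i) F ⟩
      suc i * (w * F)     ∎))
    where
    open ≡-Reasoning
    n = 2 + (i + j)
    D = leibniz i j
    E = leibniz i (suc j)
    F = leibniz (suc i) j
    -- The quotient l / F is l / D - l / E; truncated subtraction does no harm by `y≤x`.
    w = x ∸ y
    lem₁ : ∀ n w d → n * w * d ≡ w * (n * d)
    lem₁ = solve-∀
    lem₂ : ∀ w s f → w * (s * f) ≡ s * (w * f)
    lem₂ = solve-∀
    E>0 : 0 < E
    E>0 = *-pos {suc i} z<s (binom>0 (suc i) (suc j))
    ny : n * y ≡ suc j * x
    ny = *-cancelʳ-≡ (n * y) (suc j * x) E {{>-nonZero E>0}} (begin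
      n * y * E       ≡⟨ *-assoc n y E ⟩
      n * (y * E)     ≡⟨ cong (n *_) (trans (sym l≡yE) l≡xD) ⟩
      n * (x * D)     ≡⟨ lem₂ n x D ⟩
      x * (n * D)     ≡⟨ cong (x *_) (sym (leibniz-right i j)) ⟩
      x * (suc j * E) ≡⟨ sym (*-assoc x (suc j) E) ⟩
      x * suc j * E   ≡⟨ cong (_* E) (*-comm x (suc j)) ⟩
      suc j * x * E   ∎)
    y≤x : y ≤ x
    y≤x = *-cancelˡ-≤ n (≤-trans (≤-reflexive ny) (*-monoˡ-≤ x (s≤s (≤-trans (m≤n+m j i) (n≤1+n (i + j))))))
    nw : n * w ≡ suc i * x
    nw = +-cancelʳ-≡ (n * y) (n * w) (suc i * x) (begin
      n * w + n * y             ≡⟨ sym (*-distribˡ-+ n w y) ⟩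
      n * (w + y)               ≡⟨ cong (n *_) (m∸n+n≡m y≤x) ⟩
      n * x                     ≡⟨ lem₃ i j x ⟩
      suc i * x + suc j * x     ≡⟨ cong (suc i * x +_) (sym ny) ⟩
      suc i * x + n * y         ∎)
      where
      lem₃ : ∀ i j x → (2 + (i + j)) * x ≡ (1 + i) * x + (1 + j) * x
      lem₃ = solve-∀

  binom-mono : ∀ i j → binom (suc i) j ≤ binom (suc (suc i)) j
  binom-mono i zero    = ≤-refl
  binom-mono i (suc j) = m≤m+n (binom (suc i) (suc j)) (binom (suc (suc i)) j)

  2^≤leibniz : ∀ i → 2 ^ i ≤ leibniz i i
  2^≤leibniz i = ≤-trans (go i) (m≤m+n _ _)
    where
    go : ∀ i → 2 ^ i ≤ binom (suc i) i
    go zero    = ≤-refl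
    go (suc i) = +-mono-≤ (≤-trans (go i) (m≤n+m _ (binom i (suc i))))
      (≤-trans (≤-reflexive (+-identityʳ (2 ^ i))) (≤-trans (go i) (binom-mono i i)))

  -- A prime soon after a given number

  searchPrime : ∀ p n → (∃ λ q → Prime q × p < q × q ≤ n) ⊎ (∀ {q} → Prime q → q ≤ n → q ≤ p)
  searchPrime p zero = inj₂ λ _ q≤0 → ≤-trans q≤0 z≤n
  searchPrime p (suc n) with searchPrime p n
  ... | inj₁ (q , pq , p<q , q≤n) = inj₁ (q , pq , p<q , m≤n⇒m≤1+n q≤n)
  ... | inj₂ none with prime? (suc n) | suc n ≤? p
  ...   | yes pr | no  ≰p = inj₁ (suc n , pr , ≰⇒> ≰p , ≤-refl)
  ...   | yes pr | yes ≤p = inj₂ λ _ q≤ → ≤-trans q≤ ≤p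
  ...   | no ¬pr | _ = inj₂ go
    where
    go : ∀ {q} → Prime q → q ≤ suc n → q ≤ p
    go pq q≤1+n with m≤n⇒m<n∨m≡n q≤1+n
    ... | inj₁ q<1+n = none pq (s≤s⁻¹ q<1+n)
    ... | inj₂ refl  = ⊥-elim (¬pr pq)

  4vp+3≤2^2v : ∀ v p → 0 < v → 4 * v ≤ 2 ^ v → p < 2 ^ v → 4 * v * p + 3 ≤ 2 ^ (v + v)
  4vp+3≤2^2v v p 0<v 4v≤ p< = begin
    4 * v * p + 3     ≤⟨ +-monoʳ-≤ (4 * v * p) (≤-trans (n≤1+n 3) (*-monoʳ-≤ 4 0<v)) ⟩
    4 * v * p + 4 * v ≡⟨ lem (4 * v) p ⟩
    4 * v * suc p     ≤⟨ *-mono-≤ 4v≤ p< ⟩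
    2 ^ v * 2 ^ v     ≡⟨ sym (^-distribˡ-+-* 2 v v) ⟩
    2 ^ (v + v)       ∎
    where
    open ≤-Reasoning
    lem : ∀ x p → x * p + x ≡ x * (1 + p)
    lem = solve-∀

  -- Put n = 4vp + 3 = 2i + 1 with i = 2vp + 1. Without a prime in (p, n], lcm(1, ..., n) would be
  -- at most n^p ≤ 2^(2vp), yet it is a positive multiple of `leibniz i i`, which is at least 2^i.
  nextPrime : ∀ v p → 0 < v → 4 * v ≤ 2 ^ v → p < 2 ^ v → ∃ λ q → Prime q × p < q × q ≤ 4 * v * p + 3
  nextPrime v p 0<v 4v≤ p< with searchPrime p (4 * v * p + 3)
  ... | inj₁ found = found
  ... | inj₂ none  = ⊥-elim (<-irrefl refl (begin-strict
      2 ^ (2 * v * p)        <⟨ ^-monoʳ-< 2 ≤-refl {2 * v * p} ≤-refl ⟩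
      2 ^ i                  ≤⟨ 2^≤leibniz i ⟩
      leibniz i i            ≤⟨ ∣⇒≤′ (ΠP>0 _ (λ {q} pq → ^-pos (prime>0 pq) (logFloor q n)) n)
                                  (leibniz∣ i i λ m 0<m m≤ → ∣commonMultiple 0<m (≤-trans m≤ (≤-reflexive (lem v p)))) ⟩
      commonMultiple n       ≤⟨ ΠP-gap (λ q → q ^ logFloor q n) {n} 0<n (λ pq → ^logFloor≤ (prime>1 pq) n 0<n) n none ⟩
      n ^ p                  ≤⟨ ^-monoˡ-≤ p (4vp+3≤2^2v v p 0<v 4v≤ p<) ⟩
      (2 ^ (v + v)) ^ p      ≡⟨ ^-*-assoc 2 (v + v) p ⟩
      2 ^ ((v + v) * p)      ≡⟨ cong (λ t → 2 ^ (t * p)) (cong (v +_) (sym (+-identityʳ v))) ⟩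
      2 ^ (2 * v * p)        ∎))
    where
    open ≤-Reasoning
    n = 4 * v * p + 3
    i = suc (2 * v * p)
    0<n : 0 < n
    0<n = <-≤-trans z<s (m≤n+m 3 (4 * v * p))
    lem : ∀ v p → 1 + ((1 + 2 * v * p) + (1 + 2 * v * p)) ≡ 4 * v * p + 3
    lem = solve-∀

  -- The primorial bound

  prime∣!⇒≤ : ∀ {q} → Prime q → ∀ n → q ∣ n ! → q ≤ n
  prime∣!⇒≤ pq zero h = ⊥-elim (prime∤1 pq h)
  prime∣!⇒≤ pq (suc n) h with euclidsLemma (suc n) (n !) pq h
  ... | inj₁ q∣1+n = ∣⇒≤ q∣1+n
  ... | inj₂ q∣n!  = m≤n⇒m≤1+n (prime∣!⇒≤ pq n q∣n!)

  ΠP-prime∣⇒≤ : ∀ {q} → Prime q → ∀ y → q ∣ ΠP id y → q ≤ y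
  ΠP-prime∣⇒≤ pq zero h = ⊥-elim (prime∤1 pq h)
  ΠP-prime∣⇒≤ pq (suc y) h with prime? (suc y)
  ... | no _ = m≤n⇒m≤1+n (ΠP-prime∣⇒≤ pq y (subst (_ ∣_) (*-identityˡ (ΠP id y)) h))
  ... | yes pr with euclidsLemma (suc y) (ΠP id y) pq h
  ...   | inj₁ q∣1+y = ∣⇒≤ q∣1+y
  ...   | inj₂ q∣    = m≤n⇒m≤1+n (ΠP-prime∣⇒≤ pq y q∣)

  -- A new prime q cannot divide the product s of smaller primes already found in x = c s, so it
  -- divides c, and q s divides x.
  ΠP-split∣ : ∀ a k x → (∀ {q} → Prime q → a < q → q ≤ a + k → q ∣ x) → ∃ λ s → s ∣ x × ΠP id (a + k) ≡ s * ΠP id a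
  ΠP-split∣ a zero x h = 1 , 1∣ x , trans (cong (ΠP id) (+-identityʳ a)) (sym (*-identityˡ (ΠP id a)))
  ΠP-split∣ a (suc k) x h with ΠP-split∣ a k x (λ pq a<q q≤ → h pq a<q (≤-trans q≤ (+-monoʳ-≤ a (n≤1+n k)))) | prime? (suc (a + k))
  ... | s , s∣x , eq | no ¬pr = s , s∣x , trans (cong (ΠP id) (+-suc a k))
        (trans (trans (cong (_* ΠP id (a + k)) (primeOr1-¬prime id ¬pr)) (*-identityˡ (ΠP id (a + k)))) eq)
  ... | s , divides c refl , eq | yes pr = q * s
        , subst (q * s ∣_) (*-comm s c) (subst (_∣ s * c) (*-comm s q) (*-monoʳ-∣ s q∣c))
        , trans (cong (ΠP id) (+-suc a k)) (trans (cong₂ _*_ (primeOr1-prime id pr) eq) (sym (*-assoc q s (ΠP id a))))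
    where
    q = suc (a + k)
    q∣c : q ∣ c
    q∣c with euclidsLemma c s pr (h pr (s≤s (m≤m+n a k)) (≤-reflexive (sym (+-suc a k))))
    ... | inj₁ r   = r
    ... | inj₂ q∣s = ⊥-elim (<-irrefl refl (ΠP-prime∣⇒≤ pr (a + k)
          (subst (q ∣_) (sym eq) (∣m⇒∣m*n (ΠP id a) q∣s))))

  -- Such a prime divides (2m + 1)! but neither m! nor (m + 1)!.
  prime∣binom-central : ∀ m {q} → Prime q → suc m < q → q ≤ suc m + m → q ∣ binom m (suc m)
  prime∣binom-central m {q} pq m<q q≤ with euclidsLemma (binom m (suc m)) (m ! * suc m !) pq
      (subst (q ∣_) (sym (binom-! m (suc m))) (∣-trans q∣ (m≤n⇒m!∣n! (≤-trans q≤ (≤-reflexive (sym (+-suc m m)))))))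
    where
    q∣ : q ∣ q !
    q∣ = go q (prime>0 pq)
      where
      go : ∀ q → 0 < q → q ∣ q !
      go (suc q) _ = m∣m*n (q !)
  ... | inj₁ r = r
  ... | inj₂ r with euclidsLemma (m !) (suc m !) pq r
  ...   | inj₁ q∣m! = ⊥-elim (<-irrefl refl (<-≤-trans m<q (m≤n⇒m≤1+n (prime∣!⇒≤ pq m q∣m!))))
  ...   | inj₂ q∣!  = ⊥-elim (<-irrefl refl (<-≤-trans m<q (prime∣!⇒≤ pq (suc m) q∣!)))

  halve : ∀ n → ∃ λ m → n ≡ m + m ⊎ n ≡ suc m + m
  halve zero = 0 , inj₁ refl
  halve (suc n) with halve n
  ... | m , inj₁ e = m , inj₂ (cong suc e)
  ... | m , inj₂ e = suc m , inj₁ (trans (cong suc e) (cong suc (sym (+-suc m m))))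

  ¬prime-double : ∀ m → 1 < m → ¬ Prime (m + m)
  ¬prime-double m 1<m pr with prime⇒irreducible pr {m} (divides 2 (cong (m +_) (sym (+-identityʳ m))))
  ... | inj₁ refl = <-irrefl refl 1<m
  ... | inj₂ e    = <-irrefl e (m<m+n m (<-trans z<s 1<m))

  -- Erdős' induction: for n = 2m + 1 the primes in (m + 1, 2m + 1] contribute at most the
  -- coefficient `binom m (suc m)` ≤ 4^m, and an even n > 2 is not prime.
  primorial≤4^ : ∀ n → ΠP id n ≤ 4 ^ n
  primorial≤4^ = <-rec _ go
    where
    go : ∀ n → (∀ {m} → m < n → ΠP id m ≤ 4 ^ m) → ΠP id n ≤ 4 ^ n
    go n rec with halve n
    ... | zero , inj₁ refl = ≤-refl
    ... | suc zero , inj₁ refl = from-yes (ΠP id 2 ≤? 4 ^ 2)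
    ... | m@(suc (suc k)) , inj₁ refl = ≤-trans
          (≤-reflexive (trans (cong (_* ΠP id n′) (primeOr1-¬prime id (¬prime-double m (s≤s z<s)))) (*-identityˡ (ΠP id n′))))
          (≤-trans (rec ≤-refl) (m≤m+n (4 ^ n′) (3 * 4 ^ n′)))
      where n′ = suc k + m
    ... | zero , inj₂ refl = from-yes (ΠP id 1 ≤? 4 ^ 1)
    ... | m@(suc k) , inj₂ refl with ΠP-split∣ (suc m) m (binom m (suc m)) (λ pq → prime∣binom-central m pq)
    ...   | s , s∣ , eq = begin
        ΠP id (suc m + m)   ≡⟨ eq ⟩
        s * ΠP id (suc m)   ≤⟨ *-mono-≤ (≤-trans (∣⇒≤′ (binom>0 m (suc m)) s∣) (binom-central≤4^ m)) (rec (m<m+n (suc m) z<s)) ⟩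
        4 ^ m * 4 ^ suc m   ≡⟨ trans (*-comm (4 ^ m) (4 ^ suc m)) (sym (^-distribˡ-+-* 4 (suc m) m)) ⟩
        4 ^ (suc m + m)     ∎
      where open ≤-Reasoning

  -- The sum of divisors

  sumTo : ℕ → (ℕ → ℕ) → ℕ
  sumTo zero    f = 0
  sumTo (suc n) f = f 0 + sumTo n (f ∘ suc)

  sumTo-cong : ∀ n {f g : ℕ → ℕ} → (∀ i → i < n → f i ≡ g i) → sumTo n f ≡ sumTo n g
  sumTo-cong zero    h = refl
  sumTo-cong (suc n) h = cong₂ _+_ (h 0 z<s) (sumTo-cong n λ i i<n → h (suc i) (s≤s i<n))

  sumTo-0 : ∀ n {f : ℕ → ℕ} → (∀ i → i < n → f i ≡ 0) → sumTo n f ≡ 0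
  sumTo-0 zero    h = refl
  sumTo-0 (suc n) h = cong₂ _+_ (h 0 z<s) (sumTo-0 n λ i i<n → h (suc i) (s≤s i<n))

  sumTo-+ : ∀ m n f → sumTo (m + n) f ≡ sumTo m f + sumTo n (λ i → f (m + i))
  sumTo-+ zero    n f = refl
  sumTo-+ (suc m) n f = trans (cong (f 0 +_) (sumTo-+ m n (f ∘ suc))) (sym (+-assoc (f 0) _ _))

  sumTo-zip : ∀ n f g → sumTo n (λ i → f i + g i) ≡ sumTo n f + sumTo n g
  sumTo-zip zero    f g = refl
  sumTo-zip (suc n) f g = trans (cong (f 0 + g 0 +_) (sumTo-zip n (f ∘ suc) (g ∘ suc)))
    (lem (f 0) (g 0) (sumTo n (f ∘ suc)) (sumTo n (g ∘ suc)))
    where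
    lem : ∀ a b c d → a + b + (c + d) ≡ a + c + (b + d)
    lem = solve-∀

  sumTo-*ˡ : ∀ n c f → sumTo n (λ i → c * f i) ≡ c * sumTo n f
  sumTo-*ˡ zero    c f = sym (*-zeroʳ c)
  sumTo-*ˡ (suc n) c f = trans (cong (c * f 0 +_) (sumTo-*ˡ n c (f ∘ suc))) (sym (*-distribˡ-+ c (f 0) _))

  -- The index i stands for the number i + 1, so the multiples of `suc q` sit at the indices k * suc
  -- q + q.
  sumTo-multiples : ∀ q n f → (∀ i → ¬ suc q ∣ suc i → f i ≡ 0) →
    sumTo (n * suc q) f ≡ sumTo n (λ k → f (k * suc q + q))
  sumTo-multiples q zero    f h = refl
  sumTo-multiples q (suc n) f h = trans (sumTo-+ (suc q) (n * suc q) f) (cong₂ _+_ first rest)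
    where
    first : sumTo (suc q) f ≡ f q
    first = begin
      sumTo (suc q) f                            ≡⟨ cong (λ t → sumTo t f) (+-comm 1 q) ⟩
      sumTo (q + 1) f                            ≡⟨ sumTo-+ q 1 f ⟩
      sumTo q f + (f (q + 0) + 0)                ≡⟨ cong₂ _+_
                                                      (sumTo-0 q λ i i<q → h i λ d → <⇒≱ (s≤s i<q) (∣⇒≤ d))
                                                      (trans (+-identityʳ _) (cong f (+-identityʳ q))) ⟩
      f q                                        ∎
      where open ≡-Reasoning
    rest : sumTo (n * suc q) (λ i → f (suc q + i)) ≡ sumTo n (λ k → f (suc (q + k * suc q) + q))
    rest = trans (sumTo-multiples q n (λ i → f (suc q + i)) λ i q∤i → h (suc q + i) λ d →
        q∤i (∣m+n∣m⇒∣n (subst (suc q ∣_) (sym (+-suc (suc q) i)) d) ∣-refl))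
      (sumTo-cong n λ k _ → cong f (sym (+-assoc (suc q) (k * suc q) q)))

  select : ∀ {P : Set} → Dec P → ℕ → ℕ
  select (yes _) n = n
  select (no  _) n = 0

  select-yes : ∀ {P : Set} (d : Dec P) {n} → P → select d n ≡ n
  select-yes (yes _) p = refl
  select-yes (no ¬p) p = ⊥-elim (¬p p)

  select-no : ∀ {P : Set} (d : Dec P) {n} → ¬ P → select d n ≡ 0
  select-no (yes p) ¬p = ⊥-elim (¬p p)
  select-no (no _)  ¬p = refl

  sum-filter : ∀ {P : ℕ → Set} (P? : ∀ d → Dec (P d)) n f →
    sum (filter P? (applyUpTo f n)) ≡ sumTo n (λ i → select (P? (f i)) (f i))
  sum-filter P? zero    f = refl
  sum-filter P? (suc n) f with P? (f 0)
  ... | yes _ = cong (f 0 +_) (sum-filter P? n (f ∘ suc))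
  ... | no  _ = sum-filter P? n (f ∘ suc)

  divTerm : ℕ → ℕ → ℕ
  divTerm n i = select (suc i ∣? n) (suc i)

  σ≡sumTo : ∀ n → σ n ≡ sumTo n (divTerm n)
  σ≡sumTo n = sum-filter (_∣? n) n suc

  cancel-prime∣ : ∀ {q} → Prime q → ∀ {d} → ¬ q ∣ d → ∀ a r → d ∣ q ^ a * r → d ∣ r
  cancel-prime∣ pq q∤d zero r h = subst (_ ∣_) (*-identityˡ r) h
  cancel-prime∣ {q} pq {d} q∤d (suc a) r (divides c eq) with euclidsLemma c d pq (divides (q ^ a * r) (trans (sym eq) (lem q (q ^ a) r)))
    where
    lem : ∀ q x r → q * x * r ≡ x * r * q
    lem = solve-∀
  ... | inj₂ q∣d = ⊥-elim (q∤d q∣d)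
  ... | inj₁ (divides c′ refl) = cancel-prime∣ pq q∤d a r (divides c′ (*-cancelˡ-≡ _ _ q {{>-nonZero (prime>0 pq)}}
        (trans (sym (*-assoc q (q ^ a) r)) (trans eq (lem c′ q d)))))
    where
    lem : ∀ c q d → c * q * d ≡ q * (c * d)
    lem = solve-∀

  -- The divisors of q^(a+1) r that are prime to q are those of r; the others are q times the
  -- divisors of q^a r.
  σ-prime* : ∀ {q} → Prime q → ∀ a {r} → 0 < r → ¬ q ∣ r → σ (q ^ suc a * r) ≡ σ r + q * σ (q ^ a * r)
  σ-prime* {zero}  pq = ⊥-elim (<-irrefl refl (prime>0 pq))
  σ-prime* {suc p} pq a {r} 0<r q∤r = begin
    σ (q ^ suc a * r)            ≡⟨ trans (cong σ T≡) (σ≡sumTo T) ⟩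
    sumTo T (divTerm T)          ≡⟨ sumTo-cong T (λ i _ → split i) ⟩
    sumTo T (λ i → off i + on i) ≡⟨ sumTo-zip T off on ⟩
    sumTo T off + sumTo T on     ≡⟨ cong₂ _+_ off-sum on-sum ⟩
    σ r + q * σ M                ∎
    where
    open ≡-Reasoning
    q = suc p
    M = q ^ a * r
    T = M * q
    T≡ : q ^ suc a * r ≡ T
    T≡ = lem q (q ^ a) r
      where
      lem : ∀ q x r → q * x * r ≡ x * r * q
      lem = solve-∀
    on off : ℕ → ℕ
    on i with q ∣? suc i
    ... | yes _ = divTerm T i
    ... | no  _ = 0
    off i with q ∣? suc i
    ... | yes _ = 0
    ... | no  _ = divTerm T i
    split : ∀ i → divTerm T i ≡ off i + on i
    split i with q ∣? suc i
    ... | yes _ = refl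
    ... | no  _ = sym (+-identityʳ _)
    on-0 : ∀ i → ¬ q ∣ suc i → on i ≡ 0
    on-0 i q∤i with q ∣? suc i
    ... | yes h = ⊥-elim (q∤i h)
    ... | no  _ = refl
    on-multiple : ∀ k → on (k * q + p) ≡ q * divTerm M k
    on-multiple k with q ∣? suc (k * q + p)
    ... | no q∤i = ⊥-elim (q∤i (divides (suc k) (cong suc (+-comm (k * q) p))))
    ... | yes _ with suc k ∣? M
    ...   | yes h = trans (select-yes (suc (k * q + p) ∣? T) (subst (_∣ T) (sym e) (*-monoˡ-∣ q h))) (trans e (*-comm (suc k) q))
      where
      e : suc (k * q + p) ≡ suc k * q
      e = cong suc (+-comm (k * q) p)
    ...   | no q∤i = trans (select-no (suc (k * q + p) ∣? T)
              (λ h → q∤i (*-cancelʳ-∣ q (subst (_∣ T) (cong suc (+-comm (k * q) p)) h)))) (sym (*-zeroʳ q))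
    on-sum : sumTo T on ≡ q * σ M
    on-sum = begin
      sumTo T on                           ≡⟨ sumTo-multiples p M on on-0 ⟩
      sumTo M (λ k → on (k * q + p))       ≡⟨ sumTo-cong M (λ k _ → on-multiple k) ⟩
      sumTo M (λ k → q * divTerm M k)      ≡⟨ sumTo-*ˡ M q (divTerm M) ⟩
      q * sumTo M (divTerm M)              ≡⟨ cong (q *_) (sym (σ≡sumTo M)) ⟩
      q * σ M                              ∎
    off-small : ∀ i → off i ≡ divTerm r i
    off-small i with q ∣? suc i | suc i ∣? r
    ... | yes q∣ | yes ∣r = ⊥-elim (q∤r (∣-trans q∣ ∣r))
    ... | yes q∣ | no  _  = refl
    ... | no  q∤i  | yes ∣r = select-yes (suc i ∣? T) (subst (suc i ∣_) T≡ (∣n⇒∣m*n (q ^ suc a) ∣r))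
    ... | no  q∤i  | no  ∤r = select-no (suc i ∣? T) (λ h → ∤r (cancel-prime∣ pq q∤i (suc a) r (subst (suc i ∣_) (sym T≡) h)))
    r≤T : r ≤ T
    r≤T = ∣⇒≤′ (subst (0 <_) T≡ (*-pos (^-pos (prime>0 pq) (suc a)) 0<r)) (subst (r ∣_) T≡ (n∣m*n (q ^ suc a)))
    off-sum : sumTo T off ≡ σ r
    off-sum = begin
      sumTo T off                                      ≡⟨ cong (λ t → sumTo t off) (sym (m+[n∸m]≡n r≤T)) ⟩
      sumTo (r + (T ∸ r)) off                          ≡⟨ sumTo-+ r (T ∸ r) off ⟩
      sumTo r off + sumTo (T ∸ r) (λ i → off (r + i))  ≡⟨ cong₂ _+_ (sumTo-cong r λ i _ → off-small i)
          (sumTo-0 (T ∸ r) λ i _ → trans (off-small (r + i))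
            (select-no (suc (r + i) ∣? r) λ h → <⇒≱ (s≤s (m≤m+n r i)) (∣⇒≤′ 0<r h))) ⟩
      sumTo r (divTerm r) + 0                          ≡⟨ trans (+-identityʳ _) (sym (σ≡sumTo r)) ⟩
      σ r                                              ∎

  -- The geometric sum 1 + q + ... + q^a, which is σ(q^a) for a prime q.
  geo : ℕ → ℕ → ℕ
  geo q zero    = 1
  geo q (suc a) = 1 + q * geo q a

  geo>0 : ∀ q a → 0 < geo q a
  geo>0 q zero    = z<s
  geo>0 q (suc a) = z<s

  σ-^* : ∀ {q} → Prime q → ∀ a {r} → 0 < r → ¬ q ∣ r → σ (q ^ a * r) ≡ geo q a * σ r
  σ-^* pq zero    {r} 0<r q∤r = trans (cong σ (*-identityˡ r)) (sym (*-identityˡ (σ r)))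
  σ-^* {q} pq (suc a) {r} 0<r q∤r = trans (σ-prime* pq a 0<r q∤r)
    (trans (cong (λ t → σ r + q * t) (σ-^* pq a 0<r q∤r)) (lem q (geo q a) (σ r)))
    where
    lem : ∀ q g s → s + q * (g * s) ≡ (1 + q * g) * s
    lem = solve-∀

  geo-telescope : ∀ q a → q * geo (suc q) a + 1 ≡ suc q ^ suc a
  geo-telescope q zero    = lem q
    where
    lem : ∀ q → q * 1 + 1 ≡ (1 + q) * 1
    lem = solve-∀
  geo-telescope q (suc a) = trans (lem q (geo (suc q) a)) (cong (suc q *_) (geo-telescope q a))
    where
    lem : ∀ q g → q * (1 + (1 + q) * g) + 1 ≡ (1 + q) * (q * g + 1)
    lem = solve-∀

  geo-+ : ∀ q a k → geo q (a + suc k) ≡ q ^ suc k * geo q a + geo q k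
  geo-+ q a zero = trans (cong (geo q) (+-comm a 1)) (lem q (geo q a))
    where
    lem : ∀ q g → 1 + q * g ≡ q * 1 * g + 1
    lem = solve-∀
  geo-+ q a (suc k) = trans (cong (geo q) (+-suc a (suc k))) (trans (cong (λ t → 1 + q * t) (geo-+ q a k))
    (lem q (q ^ suc k) (geo q a) (geo q k)))
    where
    lem : ∀ q x g h → 1 + q * (x * g + h) ≡ q * x * g + (1 + q * h)
    lem = solve-∀

  ^∣^*⇒≤ : ∀ {q} → Prime q → ∀ b a {r} → ¬ q ∣ r → q ^ b ∣ q ^ a * r → b ≤ a
  ^∣^*⇒≤ pq zero a q∤r h = z≤n
  ^∣^*⇒≤ {q} pq (suc b) zero {r} q∤r h = ⊥-elim (q∤r (∣-trans (m∣m*n (q ^ b)) (subst (q ^ suc b ∣_) (*-identityˡ r) h)))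
  ^∣^*⇒≤ {q} pq (suc b) (suc a) {r} q∤r h = s≤s (^∣^*⇒≤ pq b a q∤r
    (*-cancelˡ-∣ q {{>-nonZero (prime>0 pq)}} (subst (q * q ^ b ∣_) (*-assoc q (q ^ a) r) h)))

  -- Exponents in a superabundant number

  SuperabundantN : ℕ → Set
  SuperabundantN N = ∀ M → 0 < M → M < N → σ M * N < σ N * M

  -- The comparison of N with its competitor M = N v / u.
  competitor : ∀ {N} → SuperabundantN N → 0 < N → ∀ M u v → 0 < v → v < u → M * u ≡ N * v → σ M * u < σ N * v
  competitor {N} sa 0<N M u v 0<v v<u e = *-cancelʳ-< N (σ M * u) (σ N * v) (begin-strict
    σ M * u * N   ≡⟨ lem₁ (σ M) u N ⟩
    σ M * N * u   <⟨ *-monoˡ-< u {{>-nonZero (<-trans 0<v v<u)}} (sa M 0<M M<N) ⟩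
    σ N * M * u   ≡⟨ trans (*-assoc (σ N) M u) (cong (σ N *_) e) ⟩
    σ N * (N * v) ≡⟨ lem₂ (σ N) N v ⟩
    σ N * v * N   ∎)
    where
    open ≤-Reasoning
    lem₁ : ∀ s u n → s * u * n ≡ s * n * u
    lem₁ = solve-∀
    lem₂ : ∀ s n v → s * (n * v) ≡ s * v * n
    lem₂ = solve-∀
    0<M : 0 < M
    0<M = *-posʳ u (subst (0 <_) (trans (sym e) (*-comm M u)) (*-pos 0<N 0<v))
    M<N : M < N
    M<N = *-cancelʳ-< u M N (subst (_< N * u) (sym e) (*-monoʳ-< N {{>-nonZero 0<N}} v<u))

  module _ {N : ℕ} (sa : SuperabundantN N) (0<N : 0 < N) where

    -- Competitor N q^k / p.
    exponent-lower : ∀ {p q} → Prime p → Prime q → p ≢ q → p ∣ N → ∀ k → q ^ suc k < p →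
      ∀ a r → N ≡ q ^ a * r → ¬ q ∣ r → p * q ^ suc k + q ^ suc k < q ^ suc a * q ^ suc k + p
    exponent-lower {p} {zero} pp pq = ⊥-elim (<-irrefl refl (prime>0 pq))
    exponent-lower {p} {q@(suc q′)} pp pq p≢q p∣N k Q<p a r refl q∤r
      with euclidsLemma (q ^ a) r pp p∣N
    ... | inj₁ h = ⊥-elim (p≢q (prime∣^ pp pq a h))
    ... | inj₂ p∣r with strip pp r (*-posʳ (q ^ a) 0<N)
    ...   | zero , t , refl , p∤t = ⊥-elim (p∤t (subst (p ∣_) (*-identityˡ t) p∣r))
    ...   | suc b , t , refl , p∤t = begin-strict
        p * Q + Q                ≡⟨ cong (λ t → p * t + Q) (sym (geo-telescope q′ k)) ⟩
        p * (q′ * gk + 1) + Q    ≡⟨ lem₃ p q′ gk Q ⟩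
        q′ * (gk * p) + (p + Q)  <⟨ +-monoˡ-< (p + Q) (*-monoʳ-< q′ {{>-nonZero (s≤s⁻¹ (prime>1 pq))}} core) ⟩
        q′ * (G * Q) + (p + Q)   ≡⟨ lem₄ q′ G Q p ⟩
        (q′ * G + 1) * Q + p     ≡⟨ cong (λ t → t * Q + p) (geo-telescope q′ a) ⟩
        q ^ suc a * Q + p        ∎
      where
      open ≤-Reasoning
      Q  = q ^ suc k
      G  = geo q a
      gk = geo q k
      gb = geo p b
      M  = q ^ (a + suc k) * (p ^ b * t)
      0<t : 0 < t
      0<t = *-posʳ (p ^ suc b) (*-posʳ (q ^ a) 0<N)
      0<pᵇt : 0 < p ^ b * t
      0<pᵇt = *-pos (^-pos (prime>0 pp) b) 0<t
      M≡ : M * p ≡ q ^ a * (p ^ suc b * t) * Q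
      M≡ = trans (cong (λ s → s * (p ^ b * t) * p) (^-distribˡ-+-* q a (suc k))) (lem (q ^ a) Q (p ^ b) t p)
        where
        lem : ∀ x Q y t p → x * Q * (y * t) * p ≡ x * (p * y * t) * Q
        lem = solve-∀
      σM : σ M ≡ geo q (a + suc k) * (gb * σ t)
      σM = trans (σ-^* pq (a + suc k) 0<pᵇt λ h → q∤r (subst (q ∣_) (sym (*-assoc p (p ^ b) t)) (∣n⇒∣m*n p h)))
        (cong (geo q (a + suc k) *_) (σ-^* pp b 0<t p∤t))
      σN : σ N ≡ G * (geo p (suc b) * σ t)
      σN = trans (σ-^* pq a (*-posʳ (q ^ a) 0<N) q∤r) (cong (G *_) (σ-^* pp (suc b) 0<t p∤t))
      X = gb * σ t
      comparison : geo q (a + suc k) * p * X < (1 + p) * G * Q * X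
      comparison = begin-strict
        geo q (a + suc k) * p * X         ≡⟨ lem₁ (geo q (a + suc k)) p X ⟩
        geo q (a + suc k) * X * p         ≡⟨ cong (_* p) (sym σM) ⟩
        σ M * p                           <⟨ competitor sa 0<N M p Q (^-pos (prime>0 pq) (suc k)) Q<p M≡ ⟩
        σ N * Q                           ≡⟨ cong (_* Q) σN ⟩
        -- Removing one factor p divides σ by at most 1 + p, whatever the exponent of p, because 1 ≤
        -- `gb`; afterwards X cancels.
        G * ((1 + p * gb) * σ t) * Q      ≤⟨ *-monoˡ-≤ Q (*-monoʳ-≤ G (*-monoˡ-≤ (σ t) (+-monoˡ-≤ (p * gb) (geo>0 p b)))) ⟩
        G * ((gb + p * gb) * σ t) * Q     ≡⟨ lem₂ G p gb (σ t) Q ⟩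
        (1 + p) * G * Q * X               ∎
        where
        lem₁ : ∀ g p x → g * p * x ≡ g * x * p
        lem₁ = solve-∀
        lem₂ : ∀ G p g s Q → G * ((g + p * g) * s) * Q ≡ (1 + p) * G * Q * (g * s)
        lem₂ = solve-∀
      -- `geo-+` splits off Q G p, which cancels; the factor q′ = q - 1 applied to `core` then turns
      -- the geometric sums into powers.
      core : gk * p < G * Q
      core = +-cancelˡ-< (Q * G * p) (gk * p) (G * Q) (begin-strict
        Q * G * p + gk * p     ≡⟨ sym (*-distribʳ-+ p (Q * G) gk) ⟩
        (Q * G + gk) * p       ≡⟨ cong (_* p) (sym (geo-+ q a k)) ⟩
        geo q (a + suc k) * p  <⟨ *-cancelʳ-< X (geo q (a + suc k) * p) ((1 + p) * G * Q) comparison ⟩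
        (1 + p) * G * Q        ≡⟨ lem p G Q ⟩
        Q * G * p + G * Q      ∎)
        where
        lem : ∀ p G Q → (1 + p) * G * Q ≡ Q * G * p + G * Q
        lem = solve-∀
      lem₃ : ∀ p q g Q → p * (q * g + 1) + Q ≡ q * (g * p) + (p + Q)
      lem₃ = solve-∀
      lem₄ : ∀ q G Q p → q * (G * Q) + (p + Q) ≡ (q * G + 1) * Q + p
      lem₄ = solve-∀

    module _ {p′ : ℕ} (pp′ : Prime p′) (p′∤N : ¬ p′ ∣ N) where

      -- Competitor N p′ / q^k.
      exponent-upper : ∀ {q} → Prime q → ∀ k → p′ < q ^ suc k →
        ∀ c r → N ≡ q ^ (c + suc k) * r → ¬ q ∣ r → q ^ suc c ≤ p′
      exponent-upper {zero} pq = ⊥-elim (<-irrefl refl (prime>0 pq))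
      exponent-upper {q@(suc q′)} pq k p′<Q c r refl q∤r = s≤s⁻¹ (*-cancelʳ-< Q (q ^ suc c) (suc p′)
          (+-cancelʳ-< p′ (q ^ suc c * Q) (suc p′ * Q) (begin-strict
        q ^ suc c * Q + p′          ≡⟨ cong (λ t → t * Q + p′) (sym (geo-telescope q′ c)) ⟩
        (q′ * G + 1) * Q + p′       ≡⟨ lem₃ q′ G Q p′ ⟩
        q′ * (G * Q) + (Q + p′)     <⟨ +-monoˡ-< (Q + p′) (*-monoʳ-< q′ {{>-nonZero (s≤s⁻¹ (prime>1 pq))}} core) ⟩
        q′ * (gk * p′) + (Q + p′)   ≡⟨ lem₄ q′ gk Q p′ ⟩
        (q′ * gk + 1) * p′ + Q      ≡⟨ cong (λ t → t * p′ + Q) (geo-telescope q′ k) ⟩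
        Q * p′ + Q                  ≤⟨ m≤m+n (Q * p′ + Q) p′ ⟩
        Q * p′ + Q + p′             ≡⟨ lem₅ Q p′ ⟩
        suc p′ * Q + p′             ∎)))
        where
        open ≤-Reasoning
        Q  = q ^ suc k
        G  = geo q c
        gk = geo q k
        M  = q ^ c * (p′ ^ 1 * r)
        0<r : 0 < r
        0<r = *-posʳ (q ^ (c + suc k)) 0<N
        q∣N : q ∣ N
        q∣N = subst (λ s → q ∣ q ^ s * r) (sym (+-suc c k)) (∣m⇒∣m*n r (m∣m*n (q ^ (c + k))))
        q≢p′ : q ≢ p′
        q≢p′ refl = p′∤N q∣N
        p′∤r : ¬ p′ ∣ r
        p′∤r h = p′∤N (∣n⇒∣m*n (q ^ (c + suc k)) h)
        q∤p′r : ¬ q ∣ p′ ^ 1 * r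
        q∤p′r h with euclidsLemma (p′ ^ 1) r pq h
        ... | inj₁ d = q≢p′ (prime∣^ pq pp′ 1 d)
        ... | inj₂ d = q∤r d
        M≡ : M * Q ≡ q ^ (c + suc k) * r * p′
        M≡ = trans (lem (q ^ c) p′ r Q) (cong (λ s → s * r * p′) (sym (^-distribˡ-+-* q c (suc k))))
          where
          lem : ∀ x p r Q → x * (p * 1 * r) * Q ≡ x * Q * r * p
          lem = solve-∀
        σM : σ M ≡ G * (geo p′ 1 * σ r)
        σM = trans (σ-^* pq c (*-pos (^-pos (prime>0 pp′) 1) 0<r) q∤p′r) (cong (G *_) (σ-^* pp′ 1 0<r p′∤r))
        comparison : (1 + p′) * G * Q * σ r < (Q * G + gk) * p′ * σ r
        comparison = begin-strict
          (1 + p′) * G * Q * σ r          ≡⟨ lem₁ p′ G Q (σ r) ⟩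
          G * ((1 + p′ * 1) * σ r) * Q    ≡⟨ cong (_* Q) (sym σM) ⟩
          σ M * Q                         <⟨ competitor sa 0<N M Q p′ (prime>0 pp′) p′<Q M≡ ⟩
          σ N * p′                        ≡⟨ cong (_* p′) (trans (σ-^* pq (c + suc k) 0<r q∤r) (cong (_* σ r) (geo-+ q c k))) ⟩
          (Q * G + gk) * σ r * p′         ≡⟨ lem₂ (Q * G + gk) (σ r) p′ ⟩
          (Q * G + gk) * p′ * σ r         ∎
          where
          lem₁ : ∀ p G Q s → (1 + p) * G * Q * s ≡ G * ((1 + p * 1) * s) * Q
          lem₁ = solve-∀
          lem₂ : ∀ g s p → g * s * p ≡ g * p * s
          lem₂ = solve-∀
        core : G * Q < gk * p′
        core = +-cancelˡ-< (Q * G * p′) (G * Q) (gk * p′) (begin-strict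
          Q * G * p′ + G * Q     ≡⟨ lem p′ G Q ⟩
          (1 + p′) * G * Q       <⟨ *-cancelʳ-< (σ r) ((1 + p′) * G * Q) ((Q * G + gk) * p′) comparison ⟩
          (Q * G + gk) * p′      ≡⟨ *-distribʳ-+ p′ (Q * G) gk ⟩
          Q * G * p′ + gk * p′   ∎)
          where
          lem : ∀ p G Q → Q * G * p + G * Q ≡ (1 + p) * G * Q
          lem = solve-∀
        lem₃ : ∀ q G Q p → (q * G + 1) * Q + p ≡ q * (G * Q) + (Q + p)
        lem₃ = solve-∀
        lem₄ : ∀ q g Q p → q * (g * p) + (Q + p) ≡ (q * g + 1) * p + Q
        lem₄ = solve-∀
        lem₅ : ∀ Q p → Q * p + Q + p ≡ (1 + p) * Q + p
        lem₅ = solve-∀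

      -- Let q^k ≤ p′ < q^(k+1) and let A be the exponent of q in N. If A ≤ k, the power is at most
      -- p′; otherwise A = c + k + 1, and q^A = q^(c+1) q^k has both factors at most p′.
      primePower≤ : ∀ {q} a → Prime q → q ^ a ∣ N → q ^ a ≤ p′ * p′
      primePower≤ {q} a pq h with strip pq N 0<N
      ... | A , r , e , q∤r with ^∣^*⇒≤ pq a A q∤r (subst (q ^ a ∣_) e h) | A ≤? logFloor q p′
      ...   | a≤A | yes A≤ = ≤-trans (^-monoʳ-≤ q {{>-nonZero (prime>0 pq)}} (≤-trans a≤A A≤))
              (≤-trans (^logFloor≤ (prime>1 pq) p′ (prime>0 pp′)) (m≤m*n p′ p′ {{>-nonZero (prime>0 pp′)}}))
      ...   | a≤A | no A≰ = begin
          q ^ a                             ≤⟨ ^-monoʳ-≤ q {{>-nonZero (prime>0 pq)}} a≤A ⟩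
          q ^ A                             ≡⟨ cong (q ^_) (trans (sym A≡) (+-suc c k)) ⟩
          q ^ (suc c + k)                   ≡⟨ ^-distribˡ-+-* q (suc c) k ⟩
          q ^ suc c * q ^ k                 ≤⟨ *-mono-≤ (exponent-upper pq k (<^logFloor (prime>1 pq) p′) c r
                                                     (trans e (cong (λ t → q ^ t * r) (sym A≡))) q∤r)
                                                 (^logFloor≤ (prime>1 pq) p′ (prime>0 pp′)) ⟩
          p′ * p′                           ∎
        where
        open ≤-Reasoning
        k = logFloor q p′
        c = A ∸ suc k
        A≡ : c + suc k ≡ A
        A≡ = m∸n+n≡m (≰⇒> A≰)

      -- Competitor N p′ / (q₁ q₂).
      few-squares : ∀ z → 2 * p′ ≤ z * z → ∀ {q₁ q₂} → Prime q₁ → Prime q₂ → q₁ ≢ q₂ → z < q₁ → z < q₂ →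
        q₁ ^ 2 ∣ N → q₂ ^ 2 ∣ N → ⊥
      few-squares z z²≥ {q₁} {q₂} pq₁ pq₂ q₁≢q₂ z<q₁ z<q₂ d₁ d₂ with strip pq₁ N 0<N
      ... | A₁ , r , refl , q₁∤r with ^∣^*⇒≤ pq₁ 2 A₁ q₁∤r d₁
      ...   | s≤s (s≤s (z≤n {a})) with ^∣*⇒^∣ pq₂ (λ h → q₁≢q₂ (sym (prime∣^ pq₂ pq₁ A₁ h))) 2 r d₂ | strip pq₂ r (*-posʳ (q₁ ^ A₁) 0<N)
      ...     | d₂′ | A₂ , t , refl , q₂∤t with ^∣^*⇒≤ pq₂ 2 A₂ q₂∤t d₂′
      ...       | s≤s (s≤s (z≤n {b})) = <⇒≱ comparison (*-cancelˡ-≤ 2 bound)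
        where
        open ≤-Reasoning
        -- `1 + U` and `1 + V` are the factors of `σ N` at q₁ and q₂; removing one q from each
        -- leaves x = U / q₁ and y = V / q₂.
        x = geo q₁ (suc a)
        y = geo q₂ (suc b)
        U = q₁ * x
        V = q₂ * y
        M = q₁ ^ suc a * (q₂ ^ suc b * (p′ ^ 1 * t))
        0<t : 0 < t
        0<t = *-posʳ (q₂ ^ A₂) (*-posʳ (q₁ ^ A₁) 0<N)
        ≢p′ : ∀ {q} → q ^ 2 ∣ N → q ≢ p′
        ≢p′ d refl = p′∤N (∣-trans (m∣m*n (p′ ^ 1)) d)
        p′∤t : ¬ p′ ∣ t
        p′∤t h = p′∤N (∣n⇒∣m*n (q₁ ^ A₁) (∣n⇒∣m*n (q₂ ^ A₂) h))
        q₂∤p′t : ¬ q₂ ∣ p′ ^ 1 * t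
        q₂∤p′t h with euclidsLemma (p′ ^ 1) t pq₂ h
        ... | inj₁ d = ≢p′ d₂ (prime∣^ pq₂ pp′ 1 d)
        ... | inj₂ d = q₂∤t d
        q₁∤rest : ¬ q₁ ∣ q₂ ^ suc b * (p′ ^ 1 * t)
        q₁∤rest h with euclidsLemma (q₂ ^ suc b) (p′ ^ 1 * t) pq₁ h
        ... | inj₁ d = q₁≢q₂ (prime∣^ pq₁ pq₂ (suc b) d)
        ... | inj₂ h′ with euclidsLemma (p′ ^ 1) t pq₁ h′
        ...   | inj₁ d = ≢p′ d₁ (prime∣^ pq₁ pp′ 1 d)
        ...   | inj₂ d = q₁∤r (∣n⇒∣m*n (q₂ ^ A₂) d)
        0<p′t : 0 < p′ ^ 1 * t
        0<p′t = *-pos (^-pos (prime>0 pp′) 1) 0<t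
        σM : σ M ≡ x * (y * (geo p′ 1 * σ t))
        σM = trans (σ-^* pq₁ (suc a) (*-pos (^-pos (prime>0 pq₂) (suc b)) 0<p′t) q₁∤rest)
          (cong (x *_) (trans (σ-^* pq₂ (suc b) 0<p′t q₂∤p′t) (cong (y *_) (σ-^* pp′ 1 0<t p′∤t))))
        σN : σ N ≡ (1 + U) * ((1 + V) * σ t)
        σN = trans (σ-^* pq₁ A₁ (*-posʳ (q₁ ^ A₁) 0<N) q₁∤r) (cong ((1 + U) *_) (σ-^* pq₂ A₂ 0<t q₂∤t))
        M≡ : M * (q₁ * q₂) ≡ q₁ ^ A₁ * (q₂ ^ A₂ * t) * p′
        M≡ = lem q₁ (q₁ ^ suc a) q₂ (q₂ ^ suc b) p′ t
          where
          lem : ∀ q x r y p t → x * (y * (p * 1 * t)) * (q * r) ≡ q * x * (r * y * t) * p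
          lem = solve-∀
        z²<q² : ∀ {q₁ q₂} → z < q₁ → z < q₂ → z * z < q₁ * q₂
        z²<q² = *-mono-<
        p′<q₁q₂ : p′ < q₁ * q₂
        p′<q₁q₂ = ≤-<-trans (≤-trans (m≤m+n p′ (p′ + 0)) z²≥) (z²<q² z<q₁ z<q₂)
        comparison : U * V < (1 + (U + V)) * p′
        comparison = +-cancelˡ-< (U * V * p′) (U * V) ((1 + (U + V)) * p′) (*-cancelʳ-< (σ t) _ _ (begin-strict
          (U * V * p′ + U * V) * σ t                  ≡⟨ lem₁ q₁ x q₂ y p′ (σ t) ⟩
          x * (y * ((1 + p′ * 1) * σ t)) * (q₁ * q₂)  ≡⟨ cong (_* (q₁ * q₂)) (sym σM) ⟩
          σ M * (q₁ * q₂)                             <⟨ competitor sa 0<N M (q₁ * q₂) p′ (prime>0 pp′) p′<q₁q₂ M≡ ⟩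
          σ N * p′                                    ≡⟨ cong (_* p′) σN ⟩
          (1 + U) * ((1 + V) * σ t) * p′              ≡⟨ lem₂ U V (σ t) p′ ⟩
          (U * V * p′ + (1 + (U + V)) * p′) * σ t     ∎))
          where
          lem₁ : ∀ q x r y p s → (q * x * (r * y) * p + q * x * (r * y)) * s ≡ x * (y * ((1 + p * 1) * s)) * (q * r)
          lem₁ = solve-∀
          lem₂ : ∀ U V s p → (1 + U) * ((1 + V) * s) * p ≡ (U * V * p + (1 + (U + V)) * p) * s
          lem₂ = solve-∀
        -- The geometric sum is itself at least q, and q² > z² ≥ 2p′. With U and V this large, U V
        -- exceeds (1 + U + V) p′, against `comparison`.
        large : ∀ {q} a → z < q → 1 + 2 * p′ ≤ q * geo q (suc a)
        large {q} a z<q = ≤-trans (s≤s z²≥) (≤-trans (z²<q² z<q z<q)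
          (*-monoʳ-≤ q (≤-trans (m≤m*n q (geo q a) {{>-nonZero (geo>0 q a)}}) (n≤1+n _))))
        bound : 2 * ((1 + (U + V)) * p′) ≤ 2 * (U * V)
        bound = begin
          2 * ((1 + (U + V)) * p′)                    ≡⟨ lem₁ U V p′ ⟩
          2 * p′ + (2 * p′ * U + 2 * p′ * V)          ≤⟨ +-monoˡ-≤ _ (≤-trans (≤-trans (n≤1+n _) (large a z<q₁)) (m≤m+n U V)) ⟩
          U + V + (2 * p′ * U + 2 * p′ * V)           ≡⟨ lem₂ U V p′ ⟩
          (1 + 2 * p′) * U + (1 + 2 * p′) * V         ≤⟨ +-mono-≤ (*-monoˡ-≤ U (large b z<q₂)) (*-monoˡ-≤ V (large a z<q₁)) ⟩
          V * U + U * V                               ≡⟨ lem₃ U V ⟩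
          2 * (U * V)                                 ∎
          where
          lem₁ : ∀ U V p → 2 * ((1 + (U + V)) * p) ≡ 2 * p + (2 * p * U + 2 * p * V)
          lem₁ = solve-∀
          lem₂ : ∀ U V p → U + V + (2 * p * U + 2 * p * V) ≡ (1 + 2 * p) * U + (1 + 2 * p) * V
          lem₂ = solve-∀
          lem₃ : ∀ U V → V * U + U * V ≡ 2 * (U * V)
          lem₃ = solve-∀

  -- The largest prime factor and the size of N

  largestPrime∣ : ∀ y n → 1 < n → PrimesBelow y n → ∃ λ p → Prime p × p ∣ n × PrimesBelow p n
  largestPrime∣ zero n 1<n below = ⊥-elim (<-irrefl (sym (primesBelow-0 (<-trans z<s 1<n) below)) 1<n)
  largestPrime∣ (suc y) n 1<n below with prime? (suc y) | suc y ∣? n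
  ... | yes pr | yes d = suc y , pr , d , below
  ... | yes pr | no ∤n = largestPrime∣ y n 1<n (primesBelow-pred below λ _ → ∤n)
  ... | no ¬pr | _     = largestPrime∣ y n 1<n (primesBelow-pred below λ pr → ⊥-elim (¬pr pr))

  sqrtUp : ∀ x → 0 < x → ∃ λ z → 0 < z × x ≤ z * z × z * z ≤ 4 * x
  sqrtUp (suc zero) _ = 1 , z<s , ≤-refl , from-yes (1 ≤? 4)
  sqrtUp (suc x@(suc _)) _ with sqrtUp x z<s
  ... | z@(suc z′) , 0<z , x≤z² , z²≤4x with suc x ≤? z * z
  ...   | yes h = z , 0<z , h , ≤-trans z²≤4x (*-monoʳ-≤ 4 (n≤1+n x))
  ...   | no ¬h = suc z , z<s , ≤-trans (s≤s x≤z²) (subst (suc (z * z) ≤_) (lem₁ z) (m≤m+n (suc (z * z)) (2 * z)))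
        , ≤-trans (subst (suc z * suc z ≤_) (lem₂ z′) (m≤m+n (suc z * suc z) (3 * (z′ * z′) + 4 * z′)))
            (*-monoʳ-≤ 4 (≤-trans (s≤s⁻¹ (≰⇒> ¬h)) (n≤1+n x)))
    where
    lem₁ : ∀ z → 1 + z * z + 2 * z ≡ (1 + z) * (1 + z)
    lem₁ = solve-∀
    lem₂ : ∀ y → (2 + y) * (2 + y) + (3 * (y * y) + 4 * y) ≡ 4 * ((1 + y) * (1 + y))
    lem₂ = solve-∀

  -- The right side doubles, while (x + 1)^3 ≤ 2 x^3 for x ≥ 4. It is applied with 65 + k equal to v
  -- = 1 + ⌊log₂ p⌋, so that a large multiple of v^3 stays below p.
  cube-growth : ∀ d → d * (65 * 65 * 65) ≤ 2 ^ 64 → ∀ k → d * ((65 + k) * (65 + k) * (65 + k)) ≤ 2 ^ (k + 64)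
  cube-growth d base zero    = base
  cube-growth d base (suc k) = ≤-trans (*-monoʳ-≤ d cube) (≤-trans (≤-reflexive (lem d (x * x * x))) (*-monoʳ-≤ 2 (cube-growth d base k)))
    where
    x = 65 + k
    lem : ∀ c y → c * (2 * y) ≡ 2 * (c * y)
    lem = solve-∀
    lem′ : ∀ y → (5 + y) * (5 + y) * (5 + y) + (3 + 21 * y + 9 * (y * y) + y * y * y) ≡ 2 * ((4 + y) * (4 + y) * (4 + y))
    lem′ = solve-∀
    cube : (66 + k) * (66 + k) * (66 + k) ≤ 2 * (x * x * x)
    cube = ≤-trans (m≤m+n _ _) (≤-reflexive (lem′ (61 + k)))

  -- Stated for variables c and d, since a product such as 2 ^ 24 * n would be unfolded.
  root-small : ∀ c d → d * (65 * 65 * 65) ≤ 2 ^ 64 → c * c * 56 ≤ d → ∀ {p} → 0 < p → 64 ≤ logFloor 2 p →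
    ∀ z → z * z ≤ 4 * (2 * (4 * suc (logFloor 2 p) * p + 3)) → c * (suc (logFloor 2 p) * z) ≤ p
  root-small c d base c²≤d {p} 0<p 64≤e z z²≤ = bound
    where
    open ≤-Reasoning
    e = logFloor 2 p
    v = suc e
    growth : d * (v * v * v) ≤ p
    growth = ≤-trans (subst (λ t → d * (suc t * suc t * suc t) ≤ 2 ^ t) (m∸n+n≡m 64≤e)
        (subst (λ t → d * (t * t * t) ≤ 2 ^ (e ∸ 64 + 64)) (cong suc (+-comm 64 (e ∸ 64))) (cube-growth d base (e ∸ 64))))
      (^logFloor≤ ≤-refl p 0<p)
    square : c * (v * z) * (c * (v * z)) ≤ p * p
    square = begin
      c * (v * z) * (c * (v * z))           ≡⟨ lem₁ c v z ⟩
      c * c * (v * v) * (z * z)             ≤⟨ *-monoʳ-≤ (c * c * (v * v)) z²≤ ⟩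
      c * c * (v * v) * (4 * (2 * (4 * v * p + 3)))
        -- With 3 ≤ 3vp the last factor is at most 4 · 2 · (4 + 3) v p; this is the origin of 56.
        ≤⟨ *-monoʳ-≤ (c * c * (v * v)) (*-monoʳ-≤ 4 (*-monoʳ-≤ 2 (+-monoʳ-≤ (4 * v * p) (*-monoʳ-≤ 3 (*-pos {v} z<s 0<p))))) ⟩
      c * c * (v * v) * (4 * (2 * (4 * v * p + 3 * (v * p)))) ≡⟨ lem₂ (c * c) v p ⟩
      c * c * 56 * (v * v * v) * p          ≤⟨ *-monoˡ-≤ p (*-monoˡ-≤ (v * v * v) c²≤d) ⟩
      d * (v * v * v) * p                   ≤⟨ *-monoˡ-≤ p growth ⟩
      p * p                                 ∎
      where
      lem₁ : ∀ c v z → c * (v * z) * (c * (v * z)) ≡ c * c * (v * v) * (z * z)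
      lem₁ = solve-∀
      lem₂ : ∀ c v p → c * (v * v) * (4 * (2 * (4 * v * p + 3 * (v * p)))) ≡ c * 56 * (v * v * v) * p
      lem₂ = solve-∀
    bound : c * (v * z) ≤ p
    bound with c * (v * z) ≤? p
    ... | yes h = h
    ... | no ¬h = ⊥-elim (<⇒≱ (*-mono-< (≰⇒> ¬h) (≰⇒> ¬h)) square)

  4v≤2^v : ∀ k → 4 * (k + 4) ≤ 2 ^ (k + 4)
  4v≤2^v zero    = ≤-refl
  4v≤2^v (suc k) = ≤-trans (≤-trans (≤-reflexive (*-suc 4 (k + 4))) (+-monoˡ-≤ (4 * (k + 4)) (*-monoʳ-≤ 4 (≤-trans z<s (m≤n+m 4 k)))))
    (subst (_≤ 2 * 2 ^ (k + 4)) (cong (4 * (k + 4) +_) (+-identityʳ (4 * (k + 4)))) (*-monoʳ-≤ 2 (4v≤2^v k)))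

  4≤⇒4v≤2^v : ∀ {v} → 4 ≤ v → 4 * v ≤ 2 ^ v
  4≤⇒4v≤2^v {v} 4≤v = subst (λ t → 4 * t ≤ 2 ^ t) (m∸n+n≡m 4≤v) (4v≤2^v (v ∸ 4))

  ^-distribʳ-* : ∀ m n k → (m * n) ^ k ≡ m ^ k * n ^ k
  ^-distribʳ-* m n zero    = refl
  ^-distribʳ-* m n (suc k) = trans (cong (m * n *_) (^-distribʳ-* m n k)) (lem m n (m ^ k) (n ^ k))
    where
    lem : ∀ m n x y → m * n * (x * y) ≡ m * x * (n * y)
    lem = solve-∀

  -- Since (51/50)^50 ≥ 2, every 50 units of n absorb one factor 2; one factor is kept for
  -- strictness.
  2^50^<51^ : ∀ k n → 50 * suc k ≤ n → 2 ^ k * 50 ^ n < 51 ^ n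
  2^50^<51^ k n h = begin-strict
    2 ^ k * 50 ^ n                         <⟨ *-monoˡ-< (50 ^ n) {{m^n≢0 50 n}} (^-monoʳ-< 2 ≤-refl {k} ≤-refl) ⟩
    2 ^ suc k * 50 ^ n                     ≡⟨ cong (λ t → 2 ^ suc k * 50 ^ t) (sym split) ⟩
    2 ^ suc k * 50 ^ (50 * suc k + r)      ≡⟨ cong (2 ^ suc k *_) (trans (^-distribˡ-+-* 50 (50 * suc k) r) (cong (_* 50 ^ r) (sym (^-*-assoc 50 50 (suc k))))) ⟩
    2 ^ suc k * ((50 ^ 50) ^ suc k * 50 ^ r) ≡⟨ trans (sym (*-assoc (2 ^ suc k) _ _)) (cong (_* 50 ^ r) (sym (^-distribʳ-* 2 (50 ^ 50) (suc k)))) ⟩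
    (2 * 50 ^ 50) ^ suc k * 50 ^ r         ≤⟨ *-mono-≤ (^-monoˡ-≤ (suc k) (from-yes (2 * 50 ^ 50 ≤? 51 ^ 50))) (^-monoˡ-≤ r (n≤1+n 50)) ⟩
    (51 ^ 50) ^ suc k * 51 ^ r             ≡⟨ trans (cong (_* 51 ^ r) (^-*-assoc 51 50 (suc k))) (sym (^-distribˡ-+-* 51 (50 * suc k) r)) ⟩
    51 ^ (50 * suc k + r)                  ≡⟨ cong (51 ^_) split ⟩
    51 ^ n                                 ∎
    where
    open ≤-Reasoning
    r = n ∸ 50 * suc k
    split : 50 * suc k + r ≡ n
    split = m+[n∸m]≡n h

  -- The factor by which the q-component of N may exceed q: none unless q² divides N, and then at
  -- most a bound W valid for all prime powers dividing N.
  squareWeight : ℕ → ℕ → ℕ → ℕ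
  squareWeight N W q with q ^ 2 ∣? N
  ... | yes _ = W
  ... | no  _ = 1

  squareWeight≤ : ∀ N {W} → 0 < W → ∀ q → squareWeight N W q ≤ W
  squareWeight≤ N 0<W q with q ^ 2 ∣? N
  ... | yes _ = ≤-refl
  ... | no  _ = 0<W

  primePower≤weight : ∀ {N W q} → 0 < W → Prime q → ∀ a → q ^ a ≤ W → q ^ a ∣ N → q ^ a ≤ q * squareWeight N W q
  primePower≤weight {N} {W} {q} 0<W pq a ≤W d with q ^ 2 ∣? N
  ... | yes _ = ≤-trans ≤W (m≤n*m W q {{>-nonZero (prime>0 pq)}})
  primePower≤weight {N} {W} {q} 0<W pq zero          ≤W d | no _ = *-pos (prime>0 pq) z<s
  primePower≤weight {N} {W} {q} 0<W pq (suc zero)    ≤W d | no _ = ≤-refl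
  primePower≤weight {N} {W} {q} 0<W pq (suc (suc a)) ≤W d | no ∤N = ⊥-elim (∤N (∣-trans (^-∣-mono q (s≤s (s≤s (z≤n {a})))) d))

  -- Numbers up to z contribute at most W^z, and by `few` at most one prime beyond z has weight W.
  -- The invariant `Bound` records whether that prime has already occurred.
  ΠP-squareWeight : ∀ N {W} z → 0 < W →
    (∀ {q₁ q₂} → Prime q₁ → Prime q₂ → q₁ ≢ q₂ → z < q₁ → z < q₂ → q₁ ^ 2 ∣ N → q₂ ^ 2 ∣ N → ⊥) →
    ∀ y → ΠP (squareWeight N W) y ≤ W ^ suc z
  ΠP-squareWeight N {W} z 0<W few y = done (go y)
    where
    LargeSquare : ℕ → Set
    LargeSquare y = ∃ λ q → Prime q × z < q × q ≤ y × q ^ 2 ∣ N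
    Bound : ℕ → Set
    Bound y = ΠP (squareWeight N W) y ≤ W ^ z ⊎ (ΠP (squareWeight N W) y ≤ W ^ suc z × LargeSquare y)
    skip : ∀ {y} → Bound y → ∀ {t} → t ≡ 1 * ΠP (squareWeight N W) y →
      t ≤ W ^ z ⊎ (t ≤ W ^ suc z × LargeSquare (suc y))
    skip {y} (inj₁ h) refl = inj₁ (≤-trans (≤-reflexive (*-identityˡ _)) h)
    skip {y} (inj₂ (h , q , pq , z<q , q≤y , d)) refl =
      inj₂ (≤-trans (≤-reflexive (*-identityˡ _)) h , q , pq , z<q , m≤n⇒m≤1+n q≤y , d)
    go : ∀ y → Bound y
    go zero = inj₁ (^-pos 0<W z)
    go (suc y) with suc y ≤? z
    ... | yes y<z = inj₁ (≤-trans (ΠP≤^ (squareWeight N W) 0<W (λ {q} _ → squareWeight≤ N 0<W q) (suc y)) (^-monoʳ-≤ W {{>-nonZero 0<W}} y<z))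
    ... | no y≮z with prime? (suc y)
    ...   | no _ = skip (go y) refl
    ...   | yes pr with suc y ^ 2 ∣? N
    ...     | no _ = skip (go y) refl
    ...     | yes d with go y
    ...       | inj₁ h = inj₂ (*-monoʳ-≤ W h , suc y , pr , ≰⇒> y≮z , ≤-refl , d)
    ...       | inj₂ (_ , q , pq , z<q , q≤y , d′) = ⊥-elim (few pr pq (λ { refl → <-irrefl refl q≤y }) (≰⇒> y≮z) z<q d d′)
    done : Bound y → ΠP (squareWeight N W) y ≤ W ^ suc z
    done (inj₁ h)       = ≤-trans h (m≤n*m (W ^ z) W {{>-nonZero 0<W}})
    done (inj₂ (h , _)) = h

  module _ {N : ℕ} (sa : SuperabundantN N) (1<N : 1 < N) where

    0<N : 0 < N
    0<N = <-trans z<s 1<N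

    -- For a multiplier Q = q^(k+1) in [32, p), `exponent-lower` gives q^(a+1) > p + 1 - p/Q >
    -- 31p/32, so no power of q up to 31p/32 can exceed the q-component q^a of N.
    smallMultiple∣ : ∀ {p} → Prime p → p ∣ N → 2 ^ 25 ≤ p → ∀ m → 0 < m → 32 * m ≤ 31 * p → m ∣ N
    smallMultiple∣ {p} pp p∣N large m 0<m 32m≤31p = primePowers∣⇒∣ m m N 0<m (λ _ → ∣⇒≤′ 0<m) go
      where
      0<p = prime>0 pp
      go : ∀ {q} j → Prime q → q ^ j ∣ m → q ^ j ∣ N
      go zero pq _ = 1∣ N
      go {q} j@(suc j′) pq d with strip pq N 0<N
      ... | a , r , e , q∤r with j ≤? a
      ...   | yes j≤a = ∣-trans (^-∣-mono q j≤a) (subst (q ^ a ∣_) (sym e) (m∣m*n r))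
      ...   | no  j≰a = ⊥-elim contradictory
        where
        open ≤-Reasoning
        32qʲ≤31p : 32 * q ^ j ≤ 31 * p
        32qʲ≤31p = ≤-trans (*-monoʳ-≤ 32 (∣⇒≤′ 0<m d)) 32m≤31p
        q<p : q < p
        q<p = *-cancelˡ-< 32 q p (≤-<-trans (≤-trans (*-monoʳ-≤ 32 (m≤m*n q (q ^ j′) {{>-nonZero (^-pos (prime>0 pq) j′)}})) 32qʲ≤31p)
          (*-monoˡ-< p {{>-nonZero 0<p}} (n<1+n 31)))
        -- For q < 32 the fifth power serves: 2^5 = 32 from below and 31^5 < 2^25 ≤ p from above,
        -- whence the size required of p.
        multiplier : ∃ λ k → 32 ≤ q ^ suc k × q ^ suc k < p
        multiplier with 32 ≤? q
        ... | yes 32≤q = 0 , ≤-trans 32≤q (≤-reflexive (sym (*-identityʳ q))) , subst (_< p) (sym (*-identityʳ q)) q<p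
        ... | no  32≰q = 4 , ^-monoˡ-≤ 5 (prime>1 pq)
                       , ≤-<-trans (^-monoˡ-≤ 5 (s≤s⁻¹ (≰⇒> 32≰q))) (<-≤-trans (from-yes (31 ^ 5 <? 2 ^ 25)) large)
        contradictory : ⊥
        contradictory with multiplier
        ... | k , 32≤Q , Q<p = <-irrefl refl (begin-strict
            32 * p                          ≤⟨ *-monoˡ-≤ p 32≤Q ⟩
            Q * p                           ≤⟨ m≤m+n (Q * p) (32 * Q) ⟩
            Q * p + 32 * Q                  <⟨ +-cancelˡ-< (31 * p * Q) _ _ (begin-strict
              31 * p * Q + (Q * p + 32 * Q)   ≡⟨ lem₁ p Q ⟩
              32 * (p * Q + Q)                <⟨ *-monoʳ-< 32 (exponent-lower sa 0<N pp pq (λ { refl → <-irrefl refl q<p }) p∣N k Q<p a r e q∤r) ⟩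
              32 * (q ^ suc a * Q + p)        ≡⟨ lem₂ (q ^ suc a) Q p ⟩
              32 * q ^ suc a * Q + 32 * p     ≤⟨ +-monoˡ-≤ (32 * p) (*-monoˡ-≤ Q (≤-trans
                                                  (*-monoʳ-≤ 32 (^-monoʳ-≤ q {{>-nonZero (prime>0 pq)}} (≰⇒> j≰a))) 32qʲ≤31p)) ⟩
              31 * p * Q + 32 * p             ∎) ⟩
            32 * p                          ∎)
          where
          Q = q ^ suc k
          lem₁ : ∀ p Q → 31 * p * Q + (Q * p + 32 * Q) ≡ 32 * (p * Q + Q)
          lem₁ = solve-∀
          lem₂ : ∀ x Q p → 32 * (x * Q + p) ≡ 32 * x * Q + 32 * p
          lem₂ = solve-∀

    module _ {p : ℕ} (below : PrimesBelow p N) {v : ℕ} (4≤v : 4 ≤ v) (p<2^v : p < 2 ^ v) where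

      next = nextPrime v p (≤-trans z<s 4≤v) (4≤⇒4v≤2^v 4≤v) p<2^v
      p′ = proj₁ next
      pp′ = proj₁ (proj₂ next)
      p′≤ = proj₂ (proj₂ (proj₂ next))

      p′∤N : ¬ p′ ∣ N
      p′∤N d = <⇒≱ (proj₁ (proj₂ (proj₂ next))) (below pp′ d)

      W = p′ * p′

      0<W : 0 < W
      0<W = *-pos (prime>0 pp′) (prime>0 pp′)

      W≤ : W ≤ 2 ^ (4 * v)
      W≤ = begin
        p′ * p′                    ≤⟨ *-mono-≤ p′≤2^2v p′≤2^2v ⟩
        2 ^ (v + v) * 2 ^ (v + v)  ≡⟨ sym (^-distribˡ-+-* 2 (v + v) (v + v)) ⟩
        2 ^ (v + v + (v + v))      ≡⟨ cong (2 ^_) (lem v) ⟩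
        2 ^ (4 * v)                ∎
        where
        open ≤-Reasoning
        p′≤2^2v : p′ ≤ 2 ^ (v + v)
        p′≤2^2v = ≤-trans p′≤ (4vp+3≤2^2v v p (≤-trans z<s 4≤v) (4≤⇒4v≤2^v 4≤v) p<2^v)
        lem : ∀ v → v + v + (v + v) ≡ 4 * v
        lem = solve-∀

      W^≤ : ∀ k → W ^ k ≤ 2 ^ (4 * v * k)
      W^≤ k = ≤-trans (^-monoˡ-≤ k W≤) (≤-reflexive (^-*-assoc 2 (4 * v) k))

      -- It bounds N in terms of p alone, so that a large N forces a large p.
      crude-bound : N ≤ 2 ^ (4 * v * p)
      crude-bound = ≤-trans
        (≤-trans (≤ΠP (λ _ → W) p N 0<N below (λ a pq → primePower≤ sa 0<N pp′ p′∤N a pq))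
          (ΠP≤^ (λ _ → W) 0<W (λ _ → ≤-refl) p))
        (W^≤ p)

      -- Bounding each q-component by q times its square weight splits off the primorial; the
      -- weights multiply to at most W^(z+1).
      fine-bound : ∀ z → 2 * p′ ≤ z * z → N ≤ 4 ^ p * 2 ^ (4 * v * suc z)
      fine-bound z z²≥ = begin
        N                                    ≤⟨ ≤ΠP _ p N 0<N below (λ a pq d →
                                                   primePower≤weight 0<W pq a (primePower≤ sa 0<N pp′ p′∤N a pq d) d) ⟩
        ΠP (λ q → q * squareWeight N W q) p  ≡⟨ ΠP-* id (squareWeight N W) p ⟩
        ΠP id p * ΠP (squareWeight N W) p    ≤⟨ *-mono-≤ (primorial≤4^ p)
                                                  (≤-trans (ΠP-squareWeight N z 0<W (few-squares sa 0<N pp′ p′∤N z z²≥) p) (W^≤ (suc z))) ⟩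
        4 ^ p * 2 ^ (4 * v * suc z)          ∎
        where open ≤-Reasoning

    -- With z ≈ √(2p′), the error factor is exp (O(v^{3/2} √p)), where v ≈ log p.
    upper-bound : ∀ {p} → 0 < p → PrimesBelow p N → 64 ≤ logFloor 2 p → N * 50 ^ p < 4 ^ p * 51 ^ p
    upper-bound {p} 0<p below 64≤e = begin-strict
      N * 50 ^ p                             ≤⟨ *-monoˡ-≤ (50 ^ p) (fine-bound below 4≤v p<2^v z (≤-trans (*-monoʳ-≤ 2 (p′≤ below 4≤v p<2^v)) x≤z²)) ⟩
      4 ^ p * 2 ^ (4 * v * suc z) * 50 ^ p   ≡⟨ *-assoc (4 ^ p) (2 ^ (4 * v * suc z)) (50 ^ p) ⟩
      4 ^ p * (2 ^ (4 * v * suc z) * 50 ^ p) <⟨ *-monoʳ-< (4 ^ p) {{m^n≢0 4 p}} (2^50^<51^ (4 * v * suc z) p room) ⟩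
      4 ^ p * 51 ^ p                         ∎
      where
      open ≤-Reasoning
      e = logFloor 2 p
      v = suc e
      4≤v : 4 ≤ v
      4≤v = ≤-trans (from-yes (4 ≤? 64)) (m≤n⇒m≤1+n 64≤e)
      p<2^v : p < 2 ^ v
      p<2^v = <^logFloor ≤-refl p
      x = 2 * (4 * v * p + 3)
      root = sqrtUp x (≤-trans z<s (*-monoʳ-≤ 2 (m≤n+m 3 (4 * v * p))))
      z = proj₁ root
      0<z = proj₁ (proj₂ root)
      x≤z² = proj₁ (proj₂ (proj₂ root))
      z²≤ = proj₂ (proj₂ (proj₂ root))
      0<vz : 1 ≤ v * z
      0<vz = *-pos {v} z<s 0<z
      -- The constant collects 50 (1 + 4v (z + 1)) = 200vz + 200v + 50 ≤ (200 + 200 + 50) vz.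
      450vz≤p : 450 * (v * z) ≤ p
      450vz≤p = root-small 450 (2 ^ 24) (from-yes (2 ^ 24 * (65 * 65 * 65) ≤? 2 ^ 64)) (from-yes (450 * 450 * 56 ≤? 2 ^ 24))
        0<p 64≤e z z²≤
      room : 50 * suc (4 * v * suc z) ≤ p
      room = ≤-trans (begin
        50 * suc (4 * v * suc z)                         ≡⟨ lem 50 v z ⟩
        200 * (v * z) + (200 * v + 50)                   ≤⟨ +-monoʳ-≤ (200 * (v * z)) (+-mono-≤
                                                              (*-monoʳ-≤ 200 (m≤m*n v z {{>-nonZero 0<z}})) (*-monoʳ-≤ 50 0<vz)) ⟩
        200 * (v * z) + (200 * (v * z) + 50 * (v * z))   ≡⟨ lem′ 50 (v * z) ⟩
        450 * (v * z)                                    ∎) 450vz≤p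
        where
        lem : ∀ c v z → c * (1 + 4 * v * (1 + z)) ≡ 4 * c * (v * z) + (4 * c * v + c)
        lem = solve-∀
        lem′ : ∀ c y → 4 * c * y + (4 * c * y + c * y) ≡ 9 * c * y
        lem′ = solve-∀

  -- The threshold is `crude-bound` at p = 2^v₀ and v = v₀: a smaller largest prime factor would
  -- keep N at or below it.
  superabundant-structure : ∀ v₀ → 64 ≤ v₀ → ∀ {N} → 2 ^ (4 * v₀ * 2 ^ v₀) < N → SuperabundantN N →
    ∃ λ p → 2 ^ v₀ ≤ p × (∀ m → 0 < m → 32 * m ≤ 31 * p → m ∣ N) × N * 50 ^ p < 4 ^ p * 51 ^ p
  superabundant-structure v₀ 64≤v₀ {N} large sa with largestPrime∣ N N 1<N (λ _ → ∣⇒≤′ (<-trans z<s 1<N))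
    where
    1<N : 1 < N
    1<N = ≤-<-trans (^-pos z<s (4 * v₀ * 2 ^ v₀)) large
  ... | p , pp , p∣N , below = p , 2^v₀≤p
      , smallMultiple∣ sa 1<N pp p∣N (≤-trans (^-monoʳ-≤ 2 (≤-trans (from-yes (25 ≤? 64)) 64≤v₀)) 2^v₀≤p)
      , upper-bound sa 1<N (prime>0 pp) below (≤-trans 64≤v₀ (^≤⇒≤logFloor ≤-refl v₀ p 2^v₀≤p))
    where
    1<N : 1 < N
    1<N = ≤-<-trans (^-pos z<s (4 * v₀ * 2 ^ v₀)) large
    2^v₀≤p : 2 ^ v₀ ≤ p
    2^v₀≤p with 2 ^ v₀ ≤? p
    ... | yes h = h
    ... | no ¬h = ⊥-elim (<⇒≱ large (≤-trans
          (crude-bound sa 1<N below (≤-trans (from-yes (4 ≤? 64)) 64≤v₀) (≰⇒> ¬h))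
          (^-monoʳ-≤ 2 (*-monoʳ-≤ (4 * v₀) (<⇒≤ (≰⇒> ¬h))))))

  -- Here p = r + 32t and y = 31t, and the claim is A p ≤ B (y + 1). The surplus D = 31B - 32A per
  -- unit of t pays for the remainder r.
  linear-bound : ∀ A B D {r t} → A * 32 + D ≡ B * 31 → A * 31 ≤ B + D * t → r ≤ 31 → A * (r + t * 32) ≤ B * suc (31 * t)
  linear-bound A B D {r} {t} e h r≤31 = begin
    A * (r + t * 32)          ≡⟨ lem₁ A r t ⟩
    A * r + A * 32 * t        ≤⟨ +-monoˡ-≤ (A * 32 * t) (≤-trans (*-monoʳ-≤ A r≤31) h) ⟩
    B + D * t + A * 32 * t    ≡⟨ lem₂ A B D t ⟩
    B + (A * 32 + D) * t      ≡⟨ cong (λ s → B + s * t) e ⟩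
    B + B * 31 * t            ≡⟨ lem₃ B t ⟩
    B * suc (31 * t)          ∎
    where
    open ≤-Reasoning
    lem₁ : ∀ A r t → A * (r + t * 32) ≡ A * r + A * 32 * t
    lem₁ = solve-∀
    lem₂ : ∀ A B D t → B + D * t + A * 32 * t ≡ B + (A * 32 + D) * t
    lem₂ = solve-∀
    lem₃ : ∀ B t → B + B * 31 * t ≡ B * (1 + 31 * t)
    lem₃ = solve-∀

  -- As (21/20)^29 ≥ 4 · 51/50, N stays below (21/20)^(29p). The base 1 + 1/20 is the form in which
  -- powers are compared with Taylor sums: it means log N < 29p/20.
  N<⇒21^≰ : ∀ N p → N * 50 ^ p < 4 ^ p * 51 ^ p → ¬ 21 ^ (29 * p) ≤ 20 ^ (29 * p) * N
  N<⇒21^≰ N p h le = <-irrefl refl (begin-strict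
    21 ^ (29 * p) * 50 ^ p              ≤⟨ *-monoˡ-≤ (50 ^ p) le ⟩
    20 ^ (29 * p) * N * 50 ^ p          ≡⟨ *-assoc (20 ^ (29 * p)) N (50 ^ p) ⟩
    20 ^ (29 * p) * (N * 50 ^ p)        <⟨ *-monoʳ-< (20 ^ (29 * p)) {{m^n≢0 20 (29 * p)}} h ⟩
    20 ^ (29 * p) * (4 ^ p * 51 ^ p)    ≡⟨ cong₂ _*_ (sym (^-*-assoc 20 29 p)) (sym (^-distribʳ-* 4 51 p)) ⟩
    (20 ^ 29) ^ p * (4 * 51) ^ p        ≡⟨ sym (^-distribʳ-* (20 ^ 29) (4 * 51) p) ⟩
    (20 ^ 29 * (4 * 51)) ^ p            ≤⟨ ^-monoˡ-≤ p (from-yes (20 ^ 29 * (4 * 51) ≤? 21 ^ 29 * 50)) ⟩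
    (21 ^ 29 * 50) ^ p                  ≡⟨ ^-distribʳ-* (21 ^ 29) 50 p ⟩
    (21 ^ 29) ^ p * 50 ^ p              ≡⟨ cong (_* 50 ^ p) (^-*-assoc 21 29 p) ⟩
    21 ^ (29 * p) * 50 ^ p              ∎)
    where open ≤-Reasoning

  -- All that the analysis uses of superabundance. After division by 1000 the linear inequality
  -- reads 29p/20 ≤ (49/50)(31/20)(y + 1). The last one is negated because H_y ≤ log log N is
  -- refuted by deriving it.
  HasSmallDivisors : ℕ → Set
  HasSmallDivisors N = ∃ λ y → 3 ≤ y × (∀ m → 0 < m → m ≤ y → m ∣ N) ×
    ∃ λ p → 1450 * p ≤ 1519 * suc y × ¬ 21 ^ (29 * p) ≤ 20 ^ (29 * p) * N

  -- y = 31 ⌊p / 32⌋ for the largest prime factor p.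
  superabundant-divisors : ∀ v₀ → 64 ≤ v₀ → ∃ λ N₀ → ∀ {N} → N₀ ≤ N → SuperabundantN N → HasSmallDivisors N
  superabundant-divisors v₀ 64≤v₀ = suc (2 ^ (4 * v₀ * 2 ^ v₀)) , λ {N} large sa → divisors-of N (superabundant-structure v₀ 64≤v₀ large sa)
    where
    divisors-of : ∀ N → (∃ λ p → 2 ^ v₀ ≤ p × (∀ m → 0 < m → 32 * m ≤ 31 * p → m ∣ N) × N * 50 ^ p < 4 ^ p * 51 ^ p) → HasSmallDivisors N
    divisors-of N (p , 2^v₀≤p , all∣ , N<) = 31 * t
        , ≤-trans (from-yes (3 ≤? 31 * 64)) (*-monoʳ-≤ 31 64≤t)
        , (λ m 0<m m≤ → all∣ m 0<m (≤-trans (*-monoʳ-≤ 32 m≤) (≤-trans (≤-reflexive (lem t)) (*-monoʳ-≤ 31 (m/n*n≤m p 32)))))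
        , p
        , subst (λ s → 1450 * s ≤ 1519 * suc (31 * t)) (sym (m≡m%n+[m/n]*n p 32))
            (linear-bound 1450 1519 689 {p % 32} {t} refl
              (≤-trans (from-yes (1450 * 31 ≤? 1519 + 689 * 64)) (+-monoʳ-≤ 1519 (*-monoʳ-≤ 689 64≤t))) (s≤s⁻¹ (m%n<n p 32)))
        , N<⇒21^≰ N p N<
      where
      t = p / 32
      lem : ∀ t → 32 * (31 * t) ≡ 31 * (t * 32)
      lem = solve-∀
      64≤t : 64 ≤ t
      64≤t = subst (_≤ t) (m*n/n≡m 64 32) (/-monoˡ-≤ 32 (≤-trans (from-yes (64 * 32 ≤? 2 ^ 64)) (≤-trans (^-monoʳ-≤ 2 64≤v₀) 2^v₀≤p)))

  -- N₀ exceeds 2 ^ 2 ^ 72 and must never be evaluated.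
  abstract
    small-divisors : ∃ λ N₀ → ∀ {N} → N₀ ≤ N → SuperabundantN N → HasSmallDivisors N
    small-divisors = superabundant-divisors 64 ≤-refl

open import Defs
open import Data.Nat.Base as ℕ using (ℕ; zero; suc; z≤n; s≤s)
import Data.Nat.Properties as ℕ
open import Data.Rational.Base
open import Data.Rational.Properties
open import Data.Rational.Solver using (module +-*-Solver)
open import Data.Product.Base using (∃; _×_; _,_; proj₁; proj₂)
open import Data.Sum.Base using (_⊎_; inj₁; inj₂)
open import Data.Nat.Divisibility using (_∣_; _∣?_; ∣⇒≤; 0∣⇒≡0)
open import Data.List.Base using (List; []; _∷_; applyUpTo; filter; map)
open import Data.Empty using (⊥-elim)
open import Relation.Nullary using (¬_; Dec; yes; no)
open import Relation.Nullary.Decidable using (from-yes)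
open import Relation.Binary.PropositionalEquality
  using (_≡_; refl; sym; trans; cong; cong₂; subst; subst₂; module ≡-Reasoning)

open +-*-Solver using (solve; _:=_; _:+_; _:*_; _:-_; :-_; con)

open NumberTheory using (SuperabundantN; small-divisors)

-- Rational inequalities and Taylor sums of exp

≤-by : ∀ {p q} r → 0ℚ ≤ r → p + r ≡ q → p ≤ q
≤-by {p} r 0≤r e = subst (p ≤_) e (p≤p+q 0≤r)

<⇒≱ : ∀ {p q} → p < q → ¬ q ≤ p
<⇒≱ p<q q≤p = <-irrefl refl (<-≤-trans p<q q≤p)

0≤1 : 0ℚ ≤ 1ℚ
0≤1 = <⇒≤ 0<1

1/1+≥0 : ∀ n → 0ℚ ≤ 1/1+ n
1/1+≥0 n = <⇒≤ (1/1+>0 n)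

1/1+-inverse : ∀ n → fromℕ (suc n) * 1/1+ n ≡ 1ℚ
1/1+-inverse n = recip-inverseʳ (fromℕ-suc>0 n)

*-cancelˡ-≤′ : ∀ {p q r} → 0ℚ < r → r * p ≤ r * q → p ≤ q
*-cancelˡ-≤′ {r = r} 0<r = *-cancelˡ-≤-pos r {{positive 0<r}}

square-nonneg : ∀ p → 0ℚ ≤ p * p
square-nonneg p with ≤-total 0ℚ p
... | inj₁ 0≤p = *-nonneg 0≤p 0≤p
... | inj₂ p≤0 = subst (0ℚ ≤_) (solve 1 (λ p → (:- p) :* (:- p) := p :* p) refl p)
  (*-nonneg (neg-antimono-≤ p≤0) (neg-antimono-≤ p≤0))

expTerm≥0 : ∀ {b} → 0ℚ ≤ b → ∀ k → 0ℚ ≤ expTerm b k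
expTerm≥0 0≤b zero    = 0≤1
expTerm≥0 0≤b (suc k) = *-nonneg (*-nonneg (expTerm≥0 0≤b k) 0≤b) (1/1+≥0 k)

expTerm-mono : ∀ {a b} → 0ℚ ≤ a → a ≤ b → ∀ k → expTerm a k ≤ expTerm b k
expTerm-mono 0≤a a≤b zero    = ≤-refl
expTerm-mono 0≤a a≤b (suc k) = *-monoʳ (1/1+≥0 k) (*-mono-nn (expTerm≥0 0≤a k) (expTerm-mono 0≤a a≤b k) 0≤a a≤b)

expSum-mono : ∀ m {a b} → 0ℚ ≤ a → a ≤ b → expSum m a ≤ expSum m b
expSum-mono m 0≤a a≤b = ∑-mono (suc m) λ k _ → expTerm-mono 0≤a a≤b k

expSum-suc : ∀ m {b} → 0ℚ ≤ b → expSum m b ≤ expSum (suc m) b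
expSum-suc m 0≤b = p≤p+q (expTerm≥0 0≤b (suc m))

expSum-monoˡ : ∀ m j {b} → 0ℚ ≤ b → expSum m b ≤ expSum (m ℕ.+ j) b
expSum-monoˡ m zero    {b} 0≤b = ≤-reflexive (cong (λ t → expSum t b) (sym (ℕ.+-identityʳ m)))
expSum-monoˡ m (suc j) {b} 0≤b = ≤-trans (expSum-monoˡ m j 0≤b)
  (subst (λ t → expSum (m ℕ.+ j) b ≤ expSum t b) (sym (ℕ.+-suc m j)) (expSum-suc (m ℕ.+ j) 0≤b))

expSum≥1 : ∀ m {b} → 0ℚ ≤ b → 1ℚ ≤ expSum m b
expSum≥1 zero    0≤b = ≤-refl
expSum≥1 (suc m) 0≤b = ≤-trans (expSum≥1 m 0≤b) (expSum-suc m 0≤b)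

expSum≥0 : ∀ m {b} → 0ℚ ≤ b → 0ℚ ≤ expSum m b
expSum≥0 m 0≤b = ≤-trans 0≤1 (expSum≥1 m 0≤b)

expSum-0 : ∀ m → expSum m 0ℚ ≡ 1ℚ
expSum-0 zero    = refl
expSum-0 (suc m) = trans (cong₂ _+_ (expSum-0 m)
  (trans (cong (_* 1/1+ m) (*-zeroʳ (expTerm 0ℚ m))) (*-zeroˡ (1/1+ m)))) (+-identityʳ 1ℚ)

-- Bernoulli's inequality (b + h)^(k+1) ≥ b^(k+1) + (k+1) h b^k, divided by (k+1)!.
expTerm-tangent : ∀ {b h} → 0ℚ ≤ b → 0ℚ ≤ b + h → ∀ k →
  expTerm b (suc k) + h * expTerm b k ≤ expTerm (b + h) (suc k)
expTerm-tangent {b} {h} 0≤b 0≤b+h zero = ≤-reflexive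
  (solve 2 (λ b h → con 1ℚ :* b :* con 1ℚ :+ h :* con 1ℚ := con 1ℚ :* (b :+ h) :* con 1ℚ) refl b h)
expTerm-tangent {b} {h} 0≤b 0≤b+h (suc k) = ≤-trans
  -- Multiplying the induction hypothesis by (b + h) / (k + 2) leaves the quadratic surplus h² t r,
  -- nonnegative for either sign of h.
  (≤-by (h * h * t * r) (*-nonneg (*-nonneg (square-nonneg h) (expTerm≥0 0≤b k)) (1/1+≥0 (suc k))) eq)
  (*-monoʳ (1/1+≥0 (suc k)) (*-monoʳ 0≤b+h (expTerm-tangent 0≤b 0≤b+h k)))
  where
  t = expTerm b k
  s = 1/1+ k
  r = 1/1+ (suc k)
  n = fromℕ (suc k)
  rs : s ≡ r * (1ℚ + s)
  rs = sym (trans (cong (λ e → r * (e + s)) (sym (1/1+-inverse k)))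
    (trans (solve 3 (λ r n s → r :* (n :* s :+ s) := (con 1ℚ :+ n) :* r :* s) refl r n s)
    (trans (cong (λ e → e * r * s) (sym (fromℕ-suc (suc k))))
    (trans (cong (_* s) (1/1+-inverse (suc k))) (*-identityˡ s)))))
  eq : t * b * s * b * r + h * (t * b * s) + h * h * t * r ≡ (t * b * s + h * t) * (b + h) * r
  eq = trans (cong (λ e → t * b * s * b * r + h * (t * b * e) + h * h * t * r) rs)
    (solve 5 (λ t b s r h → t :* b :* s :* b :* r :+ h :* (t :* b :* (r :* (con 1ℚ :+ s))) :+ h :* h :* t :* r
      := (t :* b :* s :+ h :* t) :* (b :+ h) :* r) refl t b s r h)

expSum-tangent : ∀ {b h} → 0ℚ ≤ b → 0ℚ ≤ b + h → ∀ m →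
  expSum (suc m) b + h * expSum m b ≤ expSum (suc m) (b + h)
expSum-tangent {b} {h} 0≤b 0≤b+h zero = subst (_≤ expSum 1 (b + h))
  (solve 2 (λ x h → con 1ℚ :+ (x :+ h :* con 1ℚ) := con 1ℚ :+ x :+ h :* con 1ℚ) refl (expTerm b 1) h)
  (+-monoʳ-≤ 1ℚ (expTerm-tangent 0≤b 0≤b+h 0))
expSum-tangent {b} {h} 0≤b 0≤b+h (suc m) = subst (_≤ expSum (suc (suc m)) (b + h))
  (solve 5 (λ E e h x y → E :+ h :* e :+ (x :+ h :* y) := E :+ x :+ h :* (e :+ y)) refl
    (expSum (suc m) b) (expSum m b) h (expTerm b (suc (suc m))) (expTerm b (suc m)))
  (+-mono-≤ (expSum-tangent 0≤b 0≤b+h m) (expTerm-tangent 0≤b 0≤b+h (suc m)))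

expSum-up : ∀ m {b h} → 0ℚ ≤ b → 0ℚ ≤ h → (1ℚ + h) * expSum m b ≤ expSum (suc m) (b + h)
expSum-up m {b} {h} 0≤b 0≤h = ≤-trans
  (≤-trans (≤-reflexive (solve 2 (λ h e → (con 1ℚ :+ h) :* e := e :+ h :* e) refl h (expSum m b)))
    (+-monoˡ-≤ (h * expSum m b) (expSum-suc m 0≤b)))
  (expSum-tangent 0≤b (+-nonneg 0≤b 0≤h) m)

-- The tangent inequality at b = a + h with the negative increment -h. Its linear term has degree
-- one lower, which only helps since F_m(b) ≤ F_{m+1}(b).
expSum-down : ∀ m {a h} → 0ℚ ≤ a → 0ℚ ≤ h → (1ℚ - h) * expSum m (a + h) ≤ expSum m a
expSum-down zero {a} {h} 0≤a 0≤h = ≤-by h 0≤h (solve 1 (λ h → (con 1ℚ :- h) :* con 1ℚ :+ h := con 1ℚ) refl h)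
expSum-down (suc m) {a} {h} 0≤a 0≤h = ≤-trans
  (≤-by (h * (E - e)) (*-nonneg 0≤h (p≤q⇒0≤q-p (expSum-suc m 0≤b)))
    (solve 3 (λ h E e → (con 1ℚ :- h) :* E :+ h :* (E :- e) := E :+ (:- h) :* e) refl h E e))
  (subst (λ t → E + (- h) * e ≤ expSum (suc m) t) b-h
    (expSum-tangent 0≤b (subst (0ℚ ≤_) (sym b-h) 0≤a) m))
  where
  b = a + h
  E = expSum (suc m) b
  e = expSum m b
  0≤b : 0ℚ ≤ b
  0≤b = +-nonneg 0≤a 0≤h
  b-h : b + (- h) ≡ a
  b-h = solve 2 (λ a h → a :+ h :+ (:- h) := a) refl a h

-- Riemann sums of the logarithm

module LogSum (n : ℕ) {q : ℚ} (1≤q : 1ℚ ≤ q) where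

  N = suc n
  u = q - 1ℚ

  D : ℕ → ℚ
  D = denom N q

  t : ℕ → ℚ
  t = logTerm N q

  0≤u : 0ℚ ≤ u
  0≤u = p≤q⇒0≤q-p 1≤q

  D>0 : ∀ k → 0ℚ < D k
  D>0 k = <-≤-trans (fromℕ-suc>0 n) (p≤p+q (*-nonneg (fromℕ-nonneg k) 0≤u))

  t≥0 : ∀ k → 0ℚ ≤ t k
  t≥0 k = *-nonneg 0≤u (recip-nonneg (D>0 k))

  ∑t≥0 : ∀ (f : ℕ → ℕ) k → 0ℚ ≤ ∑ k (λ i → t (f i))
  ∑t≥0 f zero    = ≤-refl
  ∑t≥0 f (suc k) = +-nonneg (∑t≥0 f k) (t≥0 (f k))

  D-0 : D 0 ≡ fromℕ N
  D-0 = solve 2 (λ N u → N :+ con 0ℚ :* u := N) refl (fromℕ N) u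

  D-N : D N ≡ fromℕ N * q
  D-N = solve 2 (λ N q → N :+ N :* (q :- con 1ℚ) := N :* q) refl (fromℕ N) q

  D-suc : ∀ k → D (suc k) ≡ D k + u
  D-suc k = trans (cong (λ s → fromℕ N + s * u) (fromℕ-suc k))
    (solve 3 (λ N k u → N :+ (con 1ℚ :+ k) :* u := N :+ k :* u :+ u) refl (fromℕ N) (fromℕ k) u)

  Dt : ∀ k → D k * t k ≡ u
  Dt k = trans (solve 3 (λ D u r → D :* (u :* r) := u :* (D :* r)) refl (D k) u (recip (D k)))
    (trans (cong (u *_) (recip-inverseʳ (D>0 k))) (*-identityʳ u))

  D-left : ∀ k → D k * (1ℚ + t k) ≡ D (suc k)
  D-left k = trans (solve 2 (λ D t → D :* (con 1ℚ :+ t) := D :+ D :* t) refl (D k) (t k))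
    (trans (cong (D k +_) (Dt k)) (sym (D-suc k)))

  D-right : ∀ k → D (suc k) * (1ℚ - t (suc k)) ≡ D k
  D-right k = trans (solve 2 (λ D t → D :* (con 1ℚ :- t) := D :- D :* t) refl (D (suc k)) (t (suc k)))
    (trans (cong₂ _-_ (D-suc k) (Dt (suc k))) (solve 2 (λ D u → D :+ u :- u := D) refl (D k) u))

  -- `expSum-up` multiplied over the first j pieces; D j / N is the product of the factors 1 + t i,
  -- and each piece costs one degree.
  lower : ∀ m {g} → 0ℚ ≤ g → ∀ j → D j * expSum m g ≤ fromℕ N * expSum (m ℕ.+ j) (g + ∑ j t)
  lower m {g} 0≤g zero = ≤-reflexive (cong₂ _*_ D-0
    (cong₂ expSum (sym (ℕ.+-identityʳ m)) (sym (+-identityʳ g))))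
  lower m {g} 0≤g (suc j) = begin
    D (suc j) * expSum m g                                  ≡⟨ cong (_* expSum m g) (sym (D-left j)) ⟩
    D j * (1ℚ + t j) * expSum m g                           ≡⟨ solve 3 (λ D s E → D :* s :* E := s :* (D :* E)) refl (D j) (1ℚ + t j) (expSum m g) ⟩
    (1ℚ + t j) * (D j * expSum m g)                         ≤⟨ *-monoˡ (+-nonneg 0≤1 (t≥0 j)) (lower m 0≤g j) ⟩
    (1ℚ + t j) * (fromℕ N * expSum (m ℕ.+ j) a)             ≡⟨ solve 3 (λ s N E → s :* (N :* E) := N :* (s :* E)) refl (1ℚ + t j) (fromℕ N) (expSum (m ℕ.+ j) a) ⟩
    fromℕ N * ((1ℚ + t j) * expSum (m ℕ.+ j) a)             ≤⟨ *-monoˡ (fromℕ-nonneg N) (expSum-up (m ℕ.+ j) (+-nonneg 0≤g (∑t≥0 (λ i → i) j)) (t≥0 j)) ⟩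
    fromℕ N * expSum (suc (m ℕ.+ j)) (a + t j)              ≡⟨ cong (fromℕ N *_) (cong₂ expSum (sym (ℕ.+-suc m j)) (+-assoc g (∑ j t) (t j))) ⟩
    fromℕ N * expSum (m ℕ.+ suc j) (g + ∑ (suc j) t)        ∎
    where
    open ≤-Reasoning
    a = g + ∑ j t

  -- The right Riemann sum, whose terms fit `expSum-down` because 1 - t (i + 1) is exactly D i / D
  -- (i + 1).
  R : ℕ → ℚ
  R j = ∑ j (λ i → t (suc i))

  upper : ∀ m {g} → 0ℚ ≤ g → ∀ j → fromℕ N * expSum m (g + R j) ≤ D j * expSum m g
  upper m {g} 0≤g zero = ≤-reflexive (cong₂ _*_ (sym D-0) (cong (expSum m) (+-identityʳ g)))
  upper m {g} 0≤g (suc j) = *-cancelˡ-≤′ (D>0 j) (begin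
    D j * (fromℕ N * E′)                          ≡⟨ cong (_* (fromℕ N * E′)) (sym (D-right j)) ⟩
    D (suc j) * (1ℚ - t (suc j)) * (fromℕ N * E′) ≡⟨ solve 4 (λ D s N E → D :* s :* (N :* E) := D :* N :* (s :* E)) refl (D (suc j)) (1ℚ - t (suc j)) (fromℕ N) E′ ⟩
    D (suc j) * fromℕ N * ((1ℚ - t (suc j)) * E′) ≤⟨ *-monoˡ (*-nonneg (<⇒≤ (D>0 (suc j))) (fromℕ-nonneg N))
                                                      (subst (λ s → (1ℚ - t (suc j)) * expSum m s ≤ E) (+-assoc g (R j) (t (suc j)))
                                                        (expSum-down m (+-nonneg 0≤g (∑t≥0 suc j)) (t≥0 (suc j)))) ⟩
    D (suc j) * fromℕ N * E                       ≡⟨ *-assoc (D (suc j)) (fromℕ N) E ⟩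
    D (suc j) * (fromℕ N * E)                     ≤⟨ *-monoˡ (<⇒≤ (D>0 (suc j))) (upper m 0≤g j) ⟩
    D (suc j) * (D j * expSum m g)                ≡⟨ solve 3 (λ a b c → a :* (b :* c) := b :* (a :* c)) refl (D (suc j)) (D j) (expSum m g) ⟩
    D j * (D (suc j) * expSum m g)                ∎)
    where
    open ≤-Reasoning
    E′ = expSum m (g + R (suc j))
    E  = expSum m (g + R j)

  telescope : ∀ j → ∑ j t + t j ≡ t 0 + R j
  telescope zero    = +-comm 0ℚ (t 0)
  telescope (suc j) = trans (cong (_+ t (suc j)) (telescope j)) (+-assoc (t 0) (R j) (t (suc j)))

  logSum≥0 : 0ℚ ≤ logSum N q
  logSum≥0 = ∑t≥0 (λ i → i) N

  *expSum≤ : ∀ m {g} → 0ℚ ≤ g → q * expSum m g ≤ expSum (m ℕ.+ N) (g + logSum N q)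
  *expSum≤ m {g} 0≤g = *-cancelˡ-≤′ (fromℕ-suc>0 n) (subst (_≤ fromℕ N * expSum (m ℕ.+ N) (g + logSum N q))
    (trans (cong (_* expSum m g) D-N) (*-assoc (fromℕ N) q (expSum m g))) (lower m 0≤g N))

  -- The left and right Riemann sums differ by t 0 - t N.
  expSum≤* : ∀ m {g} → 0ℚ ≤ g → (1ℚ - u * 1/1+ n) * expSum m (g + logSum N q) ≤ q * expSum m g
  expSum≤* m {g} 0≤g = ≤-trans (*-monoʳ (expSum≥0 m (+-nonneg 0≤g logSum≥0)) (+-monoʳ-≤ 1ℚ (neg-antimono-≤ δ≤)))
    (≤-trans (subst (λ s → (1ℚ - δ) * expSum m s ≤ expSum m (g + R N)) arg (expSum-down m (+-nonneg 0≤g (∑t≥0 suc N)) 0≤δ))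
      right)
    where
    δ = t 0 - t N
    t-0 : t 0 ≡ u * 1/1+ n
    t-0 = cong (λ s → u * recip s) D-0
    δ≤ : δ ≤ u * 1/1+ n
    δ≤ = ≤-by (t N) (t≥0 N) (trans (solve 2 (λ a b → a :- b :+ b := a) refl (t 0) (t N)) t-0)
    0≤δ : 0ℚ ≤ δ
    0≤δ = p≤q⇒0≤q-p (*-monoˡ 0≤u (recip-anti (D>0 0) (+-monoʳ-≤ (fromℕ N) (*-monoʳ 0≤u (fromℕ-mono {0} {N} z≤n)))))
    arg : g + R N + δ ≡ g + logSum N q
    arg = trans (solve 4 (λ g R a b → g :+ R :+ (a :- b) := g :+ (a :+ R :- b)) refl g (R N) (t 0) (t N))
      (trans (cong (λ s → g + (s - t N)) (sym (telescope N)))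
        (solve 3 (λ g l b → g :+ (l :+ b :- b) := g :+ l) refl g (∑ N t) (t N)))
    right : expSum m (g + R N) ≤ q * expSum m g
    right = *-cancelˡ-≤′ (fromℕ-suc>0 n) (subst (fromℕ N * expSum m (g + R N) ≤_)
      (trans (cong (_* expSum m g) D-N) (*-assoc (fromℕ N) q (expSum m g))) (upper m 0≤g N))

-- Exponentials of harmonic numbers

harmonic≥0 : ∀ n → 0ℚ ≤ harmonic n
harmonic≥0 zero    = ≤-refl
harmonic≥0 (suc n) = +-nonneg (harmonic≥0 n) (1/1+≥0 n)

-- e^{H_n} / (n + 1) increases, since (n + 2)/(n + 1) = 1 + 1/(n + 1) ≤ e^{1/(n+1)}.
expSum-harmonic-lower : ∀ m d j →
  fromℕ (suc (d ℕ.+ j)) * expSum m (harmonic d) ≤ fromℕ (suc d) * expSum (m ℕ.+ j) (harmonic (d ℕ.+ j))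
expSum-harmonic-lower m d zero = ≤-reflexive (trans
  (cong₂ (λ s t → fromℕ (suc s) * expSum t (harmonic d)) (ℕ.+-identityʳ d) (sym (ℕ.+-identityʳ m)))
  (cong (λ s → fromℕ (suc d) * expSum (m ℕ.+ 0) (harmonic s)) (sym (ℕ.+-identityʳ d))))
expSum-harmonic-lower m d (suc j) = subst₂ (λ s t → fromℕ (suc s) * expSum m (harmonic d) ≤ fromℕ (suc d) * expSum t (harmonic s))
  (sym (ℕ.+-suc d j)) (sym (ℕ.+-suc m j)) (begin
    fromℕ (suc (suc K)) * E                         ≡⟨ cong (_* E) step ⟩
    (1ℚ + r) * fromℕ (suc K) * E                    ≡⟨ *-assoc (1ℚ + r) (fromℕ (suc K)) E ⟩
    (1ℚ + r) * (fromℕ (suc K) * E)                  ≤⟨ *-monoˡ (+-nonneg 0≤1 (1/1+≥0 K)) (expSum-harmonic-lower m d j) ⟩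
    (1ℚ + r) * (fromℕ (suc d) * E′)                 ≡⟨ solve 3 (λ s N E → s :* (N :* E) := N :* (s :* E)) refl (1ℚ + r) (fromℕ (suc d)) E′ ⟩
    fromℕ (suc d) * ((1ℚ + r) * E′)                 ≤⟨ *-monoˡ (fromℕ-nonneg (suc d)) (expSum-up (m ℕ.+ j) (harmonic≥0 K) (1/1+≥0 K)) ⟩
    fromℕ (suc d) * expSum (suc (m ℕ.+ j)) (harmonic (suc K)) ∎)
  where
  open ≤-Reasoning
  K = d ℕ.+ j
  r = 1/1+ K
  E = expSum m (harmonic d)
  E′ = expSum (m ℕ.+ j) (harmonic K)
  step : fromℕ (suc (suc K)) ≡ (1ℚ + r) * fromℕ (suc K)
  step = trans (fromℕ-suc (suc K)) (trans (cong (_+ fromℕ (suc K)) (sym (1/1+-inverse K)))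
    (solve 2 (λ n r → n :* r :+ n := (con 1ℚ :+ r) :* n) refl (fromℕ (suc K)) r))

expSum-harmonic-upper : ∀ m d j → 0 ℕ.< d →
  fromℕ d * expSum m (harmonic (d ℕ.+ j)) ≤ fromℕ (d ℕ.+ j) * expSum m (harmonic d)
expSum-harmonic-upper m d zero 0<d = ≤-reflexive (cong₂ _*_ (cong fromℕ (sym (ℕ.+-identityʳ d))) (cong (λ s → expSum m (harmonic s)) (ℕ.+-identityʳ d)))
expSum-harmonic-upper m d@(suc d′) (suc j) 0<d = subst (λ s → fromℕ d * expSum m (harmonic s) ≤ fromℕ s * expSum m (harmonic d))
  (sym (ℕ.+-suc d j)) (*-cancelˡ-≤′ (fromℕ-suc>0 (d′ ℕ.+ j)) (begin
    fromℕ K * (fromℕ d * E′)                   ≡⟨ cong (_* (fromℕ d * E′)) (sym step) ⟩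
    (1ℚ - r) * fromℕ (suc K) * (fromℕ d * E′)  ≡⟨ solve 4 (λ s K d E → s :* K :* (d :* E) := K :* (d :* (s :* E))) refl (1ℚ - r) (fromℕ (suc K)) (fromℕ d) E′ ⟩
    fromℕ (suc K) * (fromℕ d * ((1ℚ - r) * E′)) ≤⟨ *-monoˡ (fromℕ-nonneg (suc K)) (*-monoˡ (fromℕ-nonneg d) (expSum-down m (harmonic≥0 K) (1/1+≥0 K))) ⟩
    fromℕ (suc K) * (fromℕ d * expSum m (harmonic K)) ≤⟨ *-monoˡ (fromℕ-nonneg (suc K)) (expSum-harmonic-upper m d j 0<d) ⟩
    fromℕ (suc K) * (fromℕ K * E)              ≡⟨ solve 3 (λ a b c → a :* (b :* c) := b :* (a :* c)) refl (fromℕ (suc K)) (fromℕ K) E ⟩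
    fromℕ K * (fromℕ (suc K) * E)              ∎))
  where
  open ≤-Reasoning
  K = d ℕ.+ j
  r = 1/1+ K
  E = expSum m (harmonic d)
  E′ = expSum m (harmonic (suc K))
  step : (1ℚ - r) * fromℕ (suc K) ≡ fromℕ K
  step = trans (solve 2 (λ n r → (con 1ℚ :- r) :* n := n :- n :* r) refl (fromℕ (suc K)) r)
    (trans (cong₂ _-_ (fromℕ-suc K) (1/1+-inverse K)) (solve 1 (λ k → con 1ℚ :+ k :- con 1ℚ := k) refl (fromℕ K)))

-- This is (1 + h)^n ≤ e^{nh} for 1 + h = P/Q, with the denominators cleared.
expSum≥^ : ∀ n h → 0ℚ ≤ h → ∀ {P Q : ℕ} → fromℕ P ≡ fromℕ Q * (1ℚ + h) →
  fromℕ (P ℕ.^ n) ≤ fromℕ (Q ℕ.^ n) * expSum n (fromℕ n * h)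
expSum≥^ zero    h 0≤h e = ≤-refl
expSum≥^ (suc n) h 0≤h {P} {Q} e = begin
  fromℕ (P ℕ.* P ℕ.^ n)                              ≡⟨ fromℕ-* P (P ℕ.^ n) ⟩
  fromℕ P * fromℕ (P ℕ.^ n)                          ≤⟨ *-monoˡ (fromℕ-nonneg P) (expSum≥^ n h 0≤h e) ⟩
  fromℕ P * (fromℕ (Q ℕ.^ n) * E)                    ≡⟨ cong (_* (fromℕ (Q ℕ.^ n) * E)) e ⟩
  fromℕ Q * (1ℚ + h) * (fromℕ (Q ℕ.^ n) * E)         ≡⟨ solve 4 (λ Q s R E → Q :* s :* (R :* E) := Q :* R :* (s :* E)) refl (fromℕ Q) (1ℚ + h) (fromℕ (Q ℕ.^ n)) E ⟩
  fromℕ Q * fromℕ (Q ℕ.^ n) * ((1ℚ + h) * E)         ≤⟨ *-monoˡ (*-nonneg (fromℕ-nonneg Q) (fromℕ-nonneg (Q ℕ.^ n))) (expSum-up n (*-nonneg (fromℕ-nonneg n) 0≤h) 0≤h) ⟩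
  fromℕ Q * fromℕ (Q ℕ.^ n) * expSum (suc n) (fromℕ n * h + h) ≡⟨ cong₂ _*_ (sym (fromℕ-* Q (Q ℕ.^ n))) (cong (expSum (suc n))
      (trans (solve 2 (λ n h → n :* h :+ h := (con 1ℚ :+ n) :* h) refl (fromℕ n) h) (cong (_* h) (sym (fromℕ-suc n))))) ⟩
  fromℕ (Q ℕ.* Q ℕ.^ n) * expSum (suc n) (fromℕ (suc n) * h) ∎
  where
  open ≤-Reasoning
  E = expSum n (fromℕ n * h)

-- The product of the Taylor sums at g and -g

conv : (ℕ → ℚ) → (ℕ → ℚ) → ℕ → ℚ
conv f h zero    = f 0 * h 0
conv f h (suc k) = f 0 * h (suc k) + conv (λ i → f (suc i)) h k

-- The coefficients of the derivative of Σ f i x^i.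
∂ : (ℕ → ℚ) → ℕ → ℚ
∂ f i = fromℕ (suc i) * f (suc i)

conv-cong : ∀ k {f f′ h h′ : ℕ → ℚ} → (∀ i → f i ≡ f′ i) → (∀ i → h i ≡ h′ i) → conv f h k ≡ conv f′ h′ k
conv-cong zero    ef eh = cong₂ _*_ (ef 0) (eh 0)
conv-cong (suc k) ef eh = cong₂ _+_ (cong₂ _*_ (ef 0) (eh (suc k))) (conv-cong k (λ i → ef (suc i)) eh)

conv-+ˡ : ∀ k f g h → conv (λ i → f i + g i) h k ≡ conv f h k + conv g h k
conv-+ˡ zero    f g h = *-distribʳ-+ (h 0) (f 0) (g 0)
conv-+ˡ (suc k) f g h = trans (cong ((f 0 + g 0) * h (suc k) +_) (conv-+ˡ k (λ i → f (suc i)) (λ i → g (suc i)) h))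
  (solve 5 (λ a b x c d → (a :+ b) :* x :+ (c :+ d) := (a :* x :+ c) :+ (b :* x :+ d)) refl
    (f 0) (g 0) (h (suc k)) (conv (λ i → f (suc i)) h k) (conv (λ i → g (suc i)) h k))

conv-*ˡ : ∀ k c f h → conv (λ i → c * f i) h k ≡ c * conv f h k
conv-*ˡ zero    c f h = *-assoc c (f 0) (h 0)
conv-*ˡ (suc k) c f h = trans (cong (c * f 0 * h (suc k) +_) (conv-*ˡ k c (λ i → f (suc i)) h))
  (solve 4 (λ c a x y → c :* a :* x :+ c :* y := c :* (a :* x :+ y)) refl c (f 0) (h (suc k)) (conv (λ i → f (suc i)) h k))

conv-*ʳ : ∀ k c f h → conv f (λ i → c * h i) k ≡ c * conv f h k
conv-*ʳ zero    c f h = solve 3 (λ c a x → a :* (c :* x) := c :* (a :* x)) refl c (f 0) (h 0)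
conv-*ʳ (suc k) c f h = trans (cong (f 0 * (c * h (suc k)) +_) (conv-*ʳ k c (λ i → f (suc i)) h))
  (solve 4 (λ c a x y → a :* (c :* x) :+ c :* y := c :* (a :* x :+ y)) refl c (f 0) (h (suc k)) (conv (λ i → f (suc i)) h k))

-- Leibniz' rule.
conv-∂ : ∀ k f h → fromℕ (suc k) * conv f h (suc k) ≡ conv (∂ f) h k + conv f (∂ h) k
conv-∂ zero f h = solve 4 (λ a b c d → con 1ℚ :* (a :* d :+ b :* c) := con 1ℚ :* b :* c :+ a :* (con 1ℚ :* d)) refl
  (f 0) (f 1) (h 0) (h 1)
conv-∂ (suc k) f h = begin
  fromℕ (suc (suc k)) * (f 0 * y + X)
    ≡⟨ cong (λ s → s * (f 0 * y + X)) (fromℕ-suc (suc k)) ⟩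
  (1ℚ + n) * (f 0 * y + X)
    ≡⟨ solve 4 (λ n a y X → (con 1ℚ :+ n) :* (a :* y :+ X) := a :* ((con 1ℚ :+ n) :* y) :+ (X :+ n :* X)) refl n (f 0) y X ⟩
  f 0 * ((1ℚ + n) * y) + (X + n * X)
    ≡⟨ cong₂ (λ s t → f 0 * (s * y) + (X + t)) (sym (fromℕ-suc (suc k))) (conv-∂ k fs h) ⟩
  f 0 * ∂ h (suc k) + (X + (conv (∂ fs) h k + Z))
    ≡⟨ solve 6 (λ a b x V W Z → a :+ (b :* x :+ V :+ (W :+ Z)) := (con 1ℚ :* b :* x :+ (V :+ W)) :+ (a :+ Z)) refl
         (f 0 * ∂ h (suc k)) (f 1) (h (suc k)) (conv fss h k) (conv (∂ fs) h k) Z ⟩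
  ∂ f 0 * h (suc k) + (conv fss h k + conv (∂ fs) h k) + (f 0 * ∂ h (suc k) + Z)
    ≡⟨ cong (λ s → ∂ f 0 * h (suc k) + s + (f 0 * ∂ h (suc k) + Z))
         (trans (sym (conv-+ˡ k fss (∂ fs) h)) (conv-cong k (λ i → sym (∂-shift i)) (λ _ → refl))) ⟩
  conv (∂ f) h (suc k) + conv f (∂ h) (suc k) ∎
  where
  open ≡-Reasoning
  n = fromℕ (suc k)
  y = h (suc (suc k))
  fs fss : ℕ → ℚ
  fs i = f (suc i)
  fss i = f (suc (suc i))
  X = conv fs h (suc k)
  Z = conv fs (∂ h) k
  ∂-shift : ∀ i → ∂ f (suc i) ≡ fss i + ∂ fs i
  ∂-shift i = trans (cong (_* fss i) (fromℕ-suc (suc i)))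
    (solve 2 (λ n x → (con 1ℚ :+ n) :* x := x :+ n :* x) refl (fromℕ (suc i)) (fss i))

expTerm-∂ : ∀ a i → ∂ (expTerm a) i ≡ a * expTerm a i
expTerm-∂ a i = trans (solve 4 (λ n t a r → n :* (t :* a :* r) := a :* t :* (n :* r)) refl (fromℕ (suc i)) (expTerm a i) a (1/1+ i))
  (trans (cong (a * expTerm a i *_) (1/1+-inverse i)) (*-identityʳ (a * expTerm a i)))

-- The binomial theorem, from the differential equation of e^{ax} e^{bx}: by Leibniz' rule its
-- derivative is a + b times itself, which determines each coefficient from the one before.
conv-expTerm : ∀ a b k → conv (expTerm a) (expTerm b) k ≡ expTerm (a + b) k
conv-expTerm a b zero    = refl
conv-expTerm a b (suc k) = begin
  c′                                ≡⟨ sym (*-identityˡ c′) ⟩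
  1ℚ * c′                           ≡⟨ cong (_* c′) (sym (1/1+-inverse k)) ⟩
  n * r * c′                        ≡⟨ solve 3 (λ n r c → n :* r :* c := n :* c :* r) refl n r c′ ⟩
  n * c′ * r                        ≡⟨ cong (_* r) (conv-∂ k A B) ⟩
  (conv (∂ A) B k + conv A (∂ B) k) * r
    ≡⟨ cong (_* r) (cong₂ _+_ (trans (conv-cong k (expTerm-∂ a) (λ _ → refl)) (conv-*ˡ k a A B))
                              (trans (conv-cong k (λ _ → refl) (expTerm-∂ b)) (conv-*ʳ k b A B))) ⟩
  (a * c + b * c) * r               ≡⟨ solve 4 (λ a b c r → (a :* c :+ b :* c) :* r := c :* (a :+ b) :* r) refl a b c r ⟩
  c * (a + b) * r                   ≡⟨ cong (λ s → s * (a + b) * r) (conv-expTerm a b k) ⟩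
  expTerm (a + b) (suc k)           ∎
  where
  open ≡-Reasoning
  A = expTerm a
  B = expTerm b
  c = conv A B k
  c′ = conv A B (suc k)
  n = fromℕ (suc k)
  r = 1/1+ k

-- The sum of f i h j over i + j ≤ m.
triangle : (ℕ → ℚ) → (ℕ → ℚ) → ℕ → ℚ
triangle f h m = ∑ (suc m) (conv f h)

∑-front : ∀ n f → ∑ (suc n) f ≡ f 0 + ∑ n (λ i → f (suc i))
∑-front zero    f = +-comm 0ℚ (f 0)
∑-front (suc n) f = trans (cong (_+ f (suc n)) (∑-front n f)) (+-assoc (f 0) (∑ n (λ i → f (suc i))) (f (suc n)))

triangle-suc : ∀ f h m → triangle f h (suc m) ≡ f 0 * ∑ (suc (suc m)) h + triangle (λ i → f (suc i)) h m
triangle-suc f h zero = solve 4 (λ a b x y → con 0ℚ :+ a :* x :+ (a :* y :+ b :* x) := a :* (con 0ℚ :+ x :+ y) :+ (con 0ℚ :+ b :* x)) refl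
  (f 0) (f 1) (h 0) (h 1)
triangle-suc f h (suc m) = trans (cong (_+ conv f h (suc (suc m))) (triangle-suc f h m))
  (solve 5 (λ a S y V W → a :* S :+ V :+ (a :* y :+ W) := a :* (S :+ y) :+ (V :+ W)) refl
    (f 0) (∑ (suc (suc m)) h) (h (suc (suc m))) (triangle (λ i → f (suc i)) h m) (conv (λ i → f (suc i)) h (suc m)))

∑-tail : ∀ {h e : ℕ → ℚ} → (∀ i → ∣ h i ∣ ≤ e i) → ∀ m j →
  ∣ ∑ (m ℕ.+ j) h - ∑ m h ∣ ≤ ∑ (m ℕ.+ j) e - ∑ m e
∑-tail {h} {e} bound m j = subst₂ _≤_ (cong ∣_∣ (sym (rest h))) (sym (rest e)) (go j)
  where
  rest : ∀ f → ∑ (m ℕ.+ j) f - ∑ m f ≡ ∑ j (λ i → f (m ℕ.+ i))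
  rest f = trans (cong (_- ∑ m f) (∑-+ m j f)) (solve 2 (λ x y → x :+ y :- x := y) refl (∑ m f) (∑ j (λ i → f (m ℕ.+ i))))
  go : ∀ j → ∣ ∑ j (λ i → h (m ℕ.+ i)) ∣ ≤ ∑ j (λ i → e (m ℕ.+ i))
  go zero    = ≤-refl
  go (suc j) = ≤-trans (∣p+q∣≤∣p∣+∣q∣ (∑ j (λ i → h (m ℕ.+ i))) (h (m ℕ.+ j))) (+-mono-≤ (go j) (bound (m ℕ.+ j)))

∣*∣-mono : ∀ {p q r s} → ∣ p ∣ ≤ q → ∣ r ∣ ≤ s → ∣ p * r ∣ ≤ q * s
∣*∣-mono {p} {q} {r} {s} h₁ h₂ = subst (_≤ q * s) (sym (∣p*q∣≡∣p∣*∣q∣ p r)) (*-mono-nn (0≤∣p∣ p) h₁ (0≤∣p∣ r) h₂)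

-- n = m + j; the rectangle {i ≤ m} × {k ≤ n} exceeds the triangle i + k ≤ m by terms dominated by those of c and e.
rectangle-triangle : ∀ m j {f h c e : ℕ → ℚ} → (∀ i → ∣ f i ∣ ≤ c i) → (∀ i → ∣ h i ∣ ≤ e i) →
  ∣ ∑ (suc m) f * ∑ (suc (m ℕ.+ j)) h - triangle f h m ∣ ≤ ∑ (suc m) c * ∑ (suc (m ℕ.+ j)) e - triangle c e m
rectangle-triangle zero j {f} {h} {c} {e} bf bh = subst₂ _≤_
  (cong ∣_∣ (eq f h)) (eq c e) (∣*∣-mono (bf 0) (∑-tail bh 1 j))
  where
  eq : ∀ f h → f 0 * (∑ (suc j) h - ∑ 1 h) ≡ (0ℚ + f 0) * ∑ (suc j) h - (0ℚ + f 0 * h 0)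
  eq f h = solve 3 (λ a S x → a :* (S :- (con 0ℚ :+ x)) := (con 0ℚ :+ a) :* S :- (con 0ℚ :+ a :* x)) refl (f 0) (∑ (suc j) h) (h 0)
rectangle-triangle (suc m) j {f} {h} {c} {e} bf bh = subst₂ _≤_ (cong ∣_∣ (eq f h)) (eq c e)
  (≤-trans (∣p+q∣≤∣p∣+∣q∣ (f 0 * (∑ (suc (suc (m ℕ.+ j))) h - ∑ (suc (suc m)) h)) _)
    (+-mono-≤ (∣*∣-mono (bf 0) (∑-tail bh (suc (suc m)) j))
      (subst (λ n → ∣ ∑ (suc m) (λ i → f (suc i)) * ∑ (suc n) h - triangle (λ i → f (suc i)) h m ∣
          ≤ ∑ (suc m) (λ i → c (suc i)) * ∑ (suc n) e - triangle (λ i → c (suc i)) e m)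
        (ℕ.+-suc m j) (rectangle-triangle m (suc j) (λ i → bf (suc i)) bh))))
  where
  eq : ∀ f h → f 0 * (∑ (suc (suc (m ℕ.+ j))) h - ∑ (suc (suc m)) h)
      + (∑ (suc m) (λ i → f (suc i)) * ∑ (suc (suc (m ℕ.+ j))) h - triangle (λ i → f (suc i)) h m)
    ≡ ∑ (suc (suc m)) f * ∑ (suc (suc (m ℕ.+ j))) h - triangle f h (suc m)
  eq f h = trans (solve 5 (λ a S s P V → a :* (S :- s) :+ (P :* S :- V) := (a :+ P) :* S :- (a :* s :+ V)) refl
      (f 0) (∑ (suc (suc (m ℕ.+ j))) h) (∑ (suc (suc m)) h) (∑ (suc m) (λ i → f (suc i))) (triangle (λ i → f (suc i)) h m))
    (cong₂ (λ s t → s * ∑ (suc (suc (m ℕ.+ j))) h - t) (sym (∑-front (suc m) f)) (sym (triangle-suc f h m)))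

conv≥0 : ∀ k {c e : ℕ → ℚ} → (∀ i → 0ℚ ≤ c i) → (∀ i → 0ℚ ≤ e i) → 0ℚ ≤ conv c e k
conv≥0 zero    c≥0 e≥0 = *-nonneg (c≥0 0) (e≥0 0)
conv≥0 (suc k) c≥0 e≥0 = +-nonneg (*-nonneg (c≥0 0) (e≥0 (suc k))) (conv≥0 k (λ i → c≥0 (suc i)) e≥0)

∑≥0 : ∀ n {f : ℕ → ℚ} → (∀ i → 0ℚ ≤ f i) → 0ℚ ≤ ∑ n f
∑≥0 zero    h = ≤-refl
∑≥0 (suc n) h = +-nonneg (∑≥0 n h) (h n)

∑-extend : ∀ n j {f : ℕ → ℚ} → (∀ i → 0ℚ ≤ f i) → ∑ n f ≤ ∑ (n ℕ.+ j) f
∑-extend n j {f} h = subst (∑ n f ≤_) (sym (∑-+ n j f)) (p≤p+q (∑≥0 j λ i → h (n ℕ.+ i)))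

-- The terms are nonnegative, and i ≤ m, j ≤ n imply i + j ≤ m + n.
rectangle≤triangle : ∀ m n {c e : ℕ → ℚ} → (∀ i → 0ℚ ≤ c i) → (∀ i → 0ℚ ≤ e i) →
  ∑ (suc m) c * ∑ (suc n) e ≤ triangle c e (m ℕ.+ n)
rectangle≤triangle zero zero {c} {e} c≥0 e≥0 = ≤-reflexive
  (solve 2 (λ a x → (con 0ℚ :+ a) :* (con 0ℚ :+ x) := con 0ℚ :+ a :* x) refl (c 0) (e 0))
rectangle≤triangle zero (suc n) {c} {e} c≥0 e≥0 = subst₂ _≤_
  (cong (_* ∑ (suc (suc n)) e) (sym (+-identityˡ (c 0)))) (sym (triangle-suc c e n))
  (p≤p+q (∑≥0 (suc n) λ k → conv≥0 k (λ i → c≥0 (suc i)) e≥0))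
rectangle≤triangle (suc m) n {c} {e} c≥0 e≥0 = subst₂ _≤_
  (trans (sym (*-distribʳ-+ (∑ (suc n) e) (c 0) (∑ (suc m) (λ i → c (suc i))))) (cong (_* ∑ (suc n) e) (sym (∑-front (suc m) c))))
  (sym (triangle-suc c e (m ℕ.+ n)))
  (+-mono-≤ (*-monoˡ (c≥0 0) (subst (λ t → ∑ (suc n) e ≤ ∑ t e) (trans (ℕ.+-comm (suc n) (suc m)) (cong suc (ℕ.+-suc m n))) (∑-extend (suc n) (suc m) e≥0)))
    (rectangle≤triangle m n (λ i → c≥0 (suc i)) e≥0))

expTerm-bound : ∀ {q B} → ∣ q ∣ ≤ B → ∀ k → ∣ expTerm q k ∣ ≤ expTerm B k
expTerm-bound {q} h = ExpEstimates.term≤ (≤-trans (0≤∣p∣ q) h) h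

triangle-expTerm : ∀ a b m → triangle (expTerm a) (expTerm b) m ≡ expSum m (a + b)
triangle-expTerm a b m = ∑-cong (suc m) λ k _ → conv-expTerm a b k

-- The triangle part of F_m(g) F_m(-g) is F_m(g - g) = 1. The remaining terms are dominated by those
-- at B, hence by F_{2m}(2B) - F_m(2B), a piece of the tail of the series at 2B.
expSum-recip : ∀ {B} → 0ℚ ≤ B → ∃ λ C → 0ℚ ≤ C × ∃ λ K → ∀ m → K ℕ.≤ m → ∀ {g} → ∣ g ∣ ≤ B →
  ∣ expSum m g * expSum m (- g) - 1ℚ ∣ ≤ C * 1/1+ m
expSum-recip {B} 0≤B = C , 0≤C , a , λ m a≤m {g} g≤B → begin
    ∣ expSum m g * expSum m (- g) - 1ℚ ∣
      ≡⟨ cong ∣_∣ (cong₂ (λ s t → expSum m g * expSum s (- g) - t) (sym (ℕ.+-identityʳ m)) (sym (tri-1 g m))) ⟩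
    ∣ expSum m g * expSum (m ℕ.+ 0) (- g) - triangle (expTerm g) (expTerm (- g)) m ∣
      ≤⟨ rectangle-triangle m 0 (expTerm-bound g≤B) (expTerm-bound (subst (_≤ B) (sym (∣-p∣≡∣p∣ g)) g≤B)) ⟩
    expSum m B * expSum (m ℕ.+ 0) B - triangle (expTerm B) (expTerm B) m
      ≡⟨ cong₂ (λ s t → expSum m B * expSum s B - t) (ℕ.+-identityʳ m) (triangle-expTerm B B m) ⟩
    expSum m B * expSum m B - expSum m (B + B)
      ≤⟨ +-monoˡ-≤ (- expSum m (B + B)) (≤-trans (rectangle≤triangle m m (expTerm≥0 0≤B) (expTerm≥0 0≤B))
           (≤-reflexive (triangle-expTerm B B (m ℕ.+ m)))) ⟩
    expSum (m ℕ.+ m) (B + B) - expSum m (B + B)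
      ≤⟨ p≤∣p∣ _ ⟩
    ∣ expSum (m ℕ.+ m) (B + B) - expSum m (B + B) ∣
      ≤⟨ uniform-≤ a≤m (ℕ.m≤m+n m m) (≤-reflexive (0≤p⇒∣p∣≡p 0≤2B)) ⟩
    C * 1/1+ m ∎
  where
  open ≤-Reasoning
  0≤2B : 0ℚ ≤ B + B
  0≤2B = +-nonneg 0≤B 0≤B
  open ExpEstimates 0≤2B using (C; 0≤C; a; uniform-≤)
  tri-1 : ∀ g m → triangle (expTerm g) (expTerm (- g)) m ≡ 1ℚ
  tri-1 g m = trans (triangle-expTerm g (- g) m) (trans (cong (expSum m) (+-inverseʳ g)) (expSum-0 m))

-- Approximations of γ

-- G approximates γ by H_K - log K, with log K replaced by its Riemann sum l index.
module GammaApprox (k′ index : ℕ) (G : ℚ)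
  (G+l : G + logSum (suc index) (fromℕ (suc (suc k′))) ≡ harmonic (suc (suc k′)))
  (l-close : ∀ i → index ℕ.≤ i → logSum (suc index) (fromℕ (suc (suc k′))) ≤ logSum (suc i) (fromℕ (suc (suc k′))) + 1/1+ (suc k′))
  where

  k = suc k′
  K = suc k
  ρ = 1/1+ k

  l : ℕ → ℚ
  l i = logSum (suc i) (fromℕ K)

  riemann≤harmonic : ∀ n → Gamma.A index n ≤ harmonic n
  riemann≤harmonic zero = ≤-reflexive (cong (λ t → ∑ t (λ i → 1/1+ (index ℕ.+ i))) (ℕ.*-zeroʳ (suc index)))
  riemann≤harmonic (suc n) = subst (_≤ harmonic (suc n)) (sym (Gamma.A-suc index n))
    (+-mono-≤ (riemann≤harmonic n) (Gamma.Δ≤ index n))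

  l-index≤ : l index ≤ harmonic K
  -- The index passed to `l-close` has successor suc index * k, the number of pieces for which the
  -- Riemann sum is `Gamma.A` with mesh 1 / suc index, and that sum is at most H_k.
  l-index≤ = ≤-trans (l-close (k′ ℕ.+ index ℕ.* k) (ℕ.≤-trans (ℕ.m≤m*n index k) (ℕ.m≤n+m (index ℕ.* k) k′)))
    (+-monoˡ-≤ ρ (subst (_≤ harmonic k) (sym (Gamma.logSum≡A index k′)) (riemann≤harmonic k)))

  G≥0 : 0ℚ ≤ G
  G≥0 = subst (0ℚ ≤_) (trans (cong (_- l index) (sym G+l))
    (solve 2 (λ G a → G :+ a :- a := G) refl G (l index))) (p≤q⇒0≤q-p l-index≤)

  1≤K : 1ℚ ≤ fromℕ K
  1≤K = fromℕ-mono {1} {K} (s≤s z≤n)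

  -- d e^γ ≤ e^{H_d}
  γ-upper : ∀ d → 0 ℕ.< d → d ℕ.≤ K → ∀ m → fromℕ d * expSum m G ≤ expSum (m ℕ.+ suc index) (harmonic d)
  γ-upper d 0<d d≤K m = *-cancelˡ-≤′ (fromℕ-suc>0 k) (begin
    fromℕ K * (fromℕ d * expSum m G)        ≡⟨ solve 3 (λ a b c → a :* (b :* c) := b :* (a :* c)) refl (fromℕ K) (fromℕ d) (expSum m G) ⟩
    fromℕ d * (fromℕ K * expSum m G)        ≤⟨ *-monoˡ (fromℕ-nonneg d) (LogSum.*expSum≤ index 1≤K m G≥0) ⟩
    fromℕ d * expSum M (G + l index)        ≡⟨ cong (λ t → fromℕ d * expSum M t) (trans G+l (cong harmonic (sym (ℕ.m+[n∸m]≡n d≤K)))) ⟩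
    fromℕ d * expSum M (harmonic (d ℕ.+ (K ℕ.∸ d))) ≤⟨ expSum-harmonic-upper M d (K ℕ.∸ d) 0<d ⟩
    fromℕ (d ℕ.+ (K ℕ.∸ d)) * expSum M (harmonic d) ≡⟨ cong (λ t → fromℕ t * expSum M (harmonic d)) (ℕ.m+[n∸m]≡n d≤K) ⟩
    fromℕ K * expSum M (harmonic d)         ∎)
    where
    open ≤-Reasoning
    M = m ℕ.+ suc index

  ρ≤1 : 0ℚ ≤ 1ℚ - ρ
  ρ≤1 = p≤q⇒0≤q-p (1/1+-anti {0} {k} z≤n)

  -- e^{H_e} ≤ (e + 1) e^γ, up to the factor (1 - ρ)²
  γ-lower : ∀ e → e ℕ.≤ K → ∀ m →
    (1ℚ - ρ) * (1ℚ - ρ) * expSum m (harmonic e) ≤ fromℕ (suc e) * expSum (m ℕ.+ (K ℕ.∸ e)) G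
  γ-lower e e≤K m = *-cancelˡ-≤′ (fromℕ-suc>0 k) (begin
    fromℕ K * (s * s * E)               ≤⟨ *-monoʳ (*-nonneg s²≥0 (expSum≥0 m (harmonic≥0 e))) (fromℕ-mono (ℕ.n≤1+n K)) ⟩
    fromℕ (suc K) * (s * s * E)         ≡⟨ solve 3 (λ K s E → K :* (s :* E) := s :* (K :* E)) refl (fromℕ (suc K)) (s * s) E ⟩
    s * s * (fromℕ (suc K) * E)         ≤⟨ *-monoˡ s²≥0 (subst (λ t → fromℕ (suc t) * E ≤ fromℕ (suc e) * expSum M (harmonic t)) (ℕ.m+[n∸m]≡n e≤K)
                                             (expSum-harmonic-lower m e (K ℕ.∸ e))) ⟩
    s * s * (fromℕ (suc e) * F)         ≡⟨ solve 3 (λ s e F → s :* s :* (e :* F) := e :* (s :* (s :* F))) refl s (fromℕ (suc e)) F ⟩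
    fromℕ (suc e) * (s * (s * F))       ≤⟨ *-monoˡ (fromℕ-nonneg (suc e)) (≤-trans (*-monoˡ ρ≤1 step) (≤-trans
                                             (≤-reflexive (solve 3 (λ s K F → s :* (K :* F) := K :* (s :* F)) refl s (fromℕ K) (expSum M (G + ρ))))
                                             (*-monoˡ (fromℕ-nonneg K) (expSum-down M G≥0 (1/1+≥0 k))))) ⟩
    fromℕ (suc e) * (fromℕ K * expSum M G) ≡⟨ solve 3 (λ a b c → a :* (b :* c) := b :* (a :* c)) refl (fromℕ (suc e)) (fromℕ K) (expSum M G) ⟩
    fromℕ K * (fromℕ (suc e) * expSum M G) ∎)
    where
    open ≤-Reasoning
    M = m ℕ.+ (K ℕ.∸ e)
    s = 1ℚ - ρ
    E = expSum m (harmonic e)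
    F = expSum M (harmonic K)
    s²≥0 : 0ℚ ≤ s * s
    s²≥0 = *-nonneg ρ≤1 ρ≤1
    u≥0 : 0ℚ ≤ fromℕ K - 1ℚ
    u≥0 = p≤q⇒0≤q-p 1≤K
    -- `index` comes from a Cauchy modulus, and its partition may be too coarse. Passing to a finer
    -- sum `l i` costs ρ, and its own mesh error is at most ρ; these are the two factors 1 - ρ.
    small = vanishing u≥0 (1/1+>0 k)
    i = index ℕ.⊔ proj₁ small
    index≤i = ℕ.m≤m⊔n index (proj₁ small)
    Gρ≥0 : 0ℚ ≤ G + ρ
    Gρ≥0 = +-nonneg G≥0 (1/1+≥0 k)
    step : s * F ≤ fromℕ K * expSum M (G + ρ)
    step = begin
      s * F                                   ≤⟨ *-monoˡ ρ≤1 (expSum-mono M (harmonic≥0 K) (begin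
          harmonic K                            ≡⟨ sym G+l ⟩
          G + l index                           ≤⟨ +-monoʳ-≤ G (l-close i index≤i) ⟩
          G + (l i + ρ)                         ≡⟨ solve 3 (λ G l r → G :+ (l :+ r) := G :+ r :+ l) refl G (l i) ρ ⟩
          G + ρ + l i                           ∎)) ⟩
      s * expSum M (G + ρ + l i)              ≤⟨ *-monoʳ (expSum≥0 M (+-nonneg Gρ≥0 (LogSum.logSum≥0 i 1≤K)))
                                                   (+-monoʳ-≤ 1ℚ (neg-antimono-≤ (proj₂ small i (ℕ.m≤n⊔m index (proj₁ small))))) ⟩
      (1ℚ - (fromℕ K - 1ℚ) * 1/1+ i) * expSum M (G + ρ + l i) ≤⟨ LogSum.expSum≤* i 1≤K M Gρ≥0 ⟩
      fromℕ K * expSum M (G + ρ)              ∎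

-- Comparison of exp and log up to a tolerance

expSum≤⇐≤logSum : ∀ j {x S η} → 1ℚ ≤ x → 0ℚ ≤ S → 0ℚ ≤ η → η ≤ 1ℚ → (x - 1ℚ) * 1/1+ j ≤ η →
  S ≤ logSum (suc j) x + η → ∀ m → (1ℚ - η) * (1ℚ - η) * expSum m S ≤ x
expSum≤⇐≤logSum j {x} {S} {η} 1≤x 0≤S 0≤η η≤1 mesh S≤ m = begin
  -- One factor 1 - η absorbs the tolerance in `S≤`, the other the mesh error of the Riemann sum.
  s * s * expSum m S                ≡⟨ *-assoc s s (expSum m S) ⟩
  s * (s * expSum m S)              ≤⟨ *-monoˡ s≥0 (*-monoˡ s≥0 (expSum-mono m 0≤S S≤)) ⟩
  s * (s * expSum m (L + η))        ≤⟨ *-monoˡ s≥0 (expSum-down m L≥0 0≤η) ⟩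
  s * expSum m L                    ≤⟨ *-monoʳ (expSum≥0 m L≥0) (+-monoʳ-≤ 1ℚ (neg-antimono-≤ mesh)) ⟩
  (1ℚ - (x - 1ℚ) * 1/1+ j) * expSum m L ≡⟨ cong (λ t → (1ℚ - (x - 1ℚ) * 1/1+ j) * expSum m t) (sym (+-identityˡ L)) ⟩
  (1ℚ - (x - 1ℚ) * 1/1+ j) * expSum m (0ℚ + L) ≤⟨ LogSum.expSum≤* j 1≤x m ≤-refl ⟩
  x * expSum m 0ℚ                   ≡⟨ trans (cong (x *_) (expSum-0 m)) (*-identityʳ x) ⟩
  x                                 ∎
  where
  open ≤-Reasoning
  s = 1ℚ - η
  s≥0 : 0ℚ ≤ s
  s≥0 = p≤q⇒0≤q-p η≤1
  L = logSum (suc j) x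
  L≥0 : 0ℚ ≤ L
  L≥0 = LogSum.logSum≥0 j 1≤x

-- The left Riemann sum overestimates log x, so this direction carries no mesh error.
≤expSum-logSum : ∀ j {x} → 1ℚ ≤ x → x ≤ expSum (suc j) (logSum (suc j) x)
≤expSum-logSum j {x} 1≤x = subst₂ _≤_ (*-identityʳ x) (cong (expSum (suc j)) (+-identityˡ (logSum (suc j) x)))
  (LogSum.*expSum≤ j 1≤x 0 ≤-refl)

≤expSum⇐logSum≤ : ∀ j {x S η} → 1ℚ ≤ x → 0ℚ ≤ S → 0ℚ ≤ η → η ≤ 1ℚ →
  logSum (suc j) x ≤ S + η → (1ℚ - η) * x ≤ expSum (suc j) S
≤expSum⇐logSum≤ j {x} {S} {η} 1≤x 0≤S 0≤η η≤1 L≤ = ≤-trans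
  (*-monoˡ (p≤q⇒0≤q-p η≤1) (≤-trans (≤expSum-logSum j 1≤x) (expSum-mono (suc j) (LogSum.logSum≥0 j 1≤x) L≤)))
  (expSum-down (suc j) 0≤S 0≤η)

-- The relation _≤ᴿ_ between the real numbers approximated by x and y.
infix 4 _≲_
_≲_ : (ℕ → ℚ) → (ℕ → ℚ) → Set
x ≲ y = ∀ η → 0ℚ < η → ∃ λ J → ∀ j → J ℕ.≤ j → x j ≤ y j + η

half : ∀ {q} → 0ℚ < q → 0ℚ < q * ½
half 0<q = *-positive 0<q (positive⁻¹ ½)

halves-sum : ∀ q → q * ½ + q * ½ ≡ q
halves-sum q = trans (sym (*-distribˡ-+ q ½ ½)) (*-identityʳ q)

-- One rational comparison, of the approximation y_K with c + η/2, replaces a decision of `_≤ᴿ_`: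
-- were y_K larger, all later approximations would stay above c, giving c ≤ y.
≰⇒≲ : ∀ {c} (y : ℝ) → ¬ (fromℚ c ≤ᴿ y) → approx y ≲ (λ _ → c)
≰⇒≲ {c} y c≰y η 0<η with cauchy y (η * ½) (half 0<η)
... | K , H with approx y K ≤? c + η * ½
...   | yes h = K , λ j K≤j → ≤-trans (p-q≤r⇒p≤q+r {approx y j} {approx y K} (≤-trans (p≤∣p∣ _) (H j K K≤j ℕ.≤-refl)))
        (≤-trans (+-monoˡ-≤ (η * ½) h) (≤-reflexive (trans (+-assoc c (η * ½) (η * ½)) (cong (c +_) (halves-sum η)))))
...   | no ¬h = ⊥-elim (c≰y λ ε 0<ε → K , λ j K≤j → ≤-trans
        (≤-trans (≤-reflexive (solve 2 (λ c e → c := c :+ e :- e) refl c (η * ½)))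
          (p≤q+r⇒p-q≤r {c + η * ½} {η * ½} {approx y j} (≤-trans (<⇒≤ (≰⇒> ¬h))
            (≤-trans (p-q≤r⇒p≤q+r {approx y K} {approx y j} (≤-trans (p≤∣p∣ _) (H K j ℕ.≤-refl K≤j)))
              (≤-reflexive (+-comm (approx y j) (η * ½)))))))
        (p≤p+q (<⇒≤ 0<ε)))

≲-cancel : ∀ {N x y} → 0ℚ < N → (λ j → N * x j) ≲ (λ j → N * y j) → x ≲ y
≲-cancel {N} {x} {y} 0<N h η 0<η with h (N * η) (*-positive 0<N 0<η)
... | J , H = J , λ j J≤j → *-cancelˡ-≤′ 0<N (subst (N * x j ≤_) (sym (*-distribˡ-+ N (y j) η)) (H j J≤j))

-- Cofactor sums and superabundance over the naturals

cofactor : ℕ → ℕ → ℚ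
cofactor N e = fromℕ N * recip (fromℕ e)

cofactor≥0 : ∀ N e → 0ℚ ≤ cofactor N e
cofactor≥0 N zero    = *-nonneg (fromℕ-nonneg N) ≤-refl
cofactor≥0 N (suc e) = *-nonneg (fromℕ-nonneg N) (1/1+≥0 e)

sumℚ-filter-mono : ∀ {P Q : ℕ → Set} (P? : ∀ e → Dec (P e)) (Q? : ∀ e → Dec (Q e)) {f : ℕ → ℚ} →
  (∀ e → 0ℚ ≤ f e) → (∀ {e} → P e → Q e) → ∀ xs → sumℚ (map f (filter P? xs)) ≤ sumℚ (map f (filter Q? xs))
sumℚ-filter-mono P? Q? f≥0 P⇒Q [] = ≤-refl
sumℚ-filter-mono P? Q? {f} f≥0 P⇒Q (x ∷ xs) with P? x | Q? x
... | yes p | yes _ = +-monoʳ-≤ (f x) (sumℚ-filter-mono P? Q? f≥0 P⇒Q xs)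
... | yes p | no ¬q = ⊥-elim (¬q (P⇒Q p))
... | no _  | yes _ = ≤-trans (sumℚ-filter-mono P? Q? f≥0 P⇒Q xs) (q≤p+q (f≥0 x))
... | no _  | no _  = sumℚ-filter-mono P? Q? f≥0 P⇒Q xs

cofactorSum-mono : ∀ N {y d} → y ℕ.≤ d → cofactorSum N y ≤ cofactorSum N d
cofactorSum-mono N {y} {d} y≤d = sumℚ-filter-mono (ℕ._≤? y) (ℕ._≤? d) (cofactor≥0 N) (λ e≤y → ℕ.≤-trans e≤y y≤d) (divisors N)

sumℚ-filter-initial : ∀ {P Q : ℕ → Set} (P? : ∀ e → Dec (P e)) (Q? : ∀ e → Dec (Q e)) f g m n → m ℕ.≤ n →
  (∀ i → i ℕ.< m → P (g i) × Q (g i)) → (∀ i → m ℕ.≤ i → ¬ P (g i)) →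
  sumℚ (map f (filter P? (filter Q? (applyUpTo g n)))) ≡ ∑ m (λ i → f (g i))
sumℚ-filter-initial P? Q? f g zero zero m≤n all none = refl
sumℚ-filter-initial P? Q? f g zero (suc n) m≤n all none with Q? (g 0)
... | no _ = sumℚ-filter-initial P? Q? f (λ i → g (suc i)) zero n z≤n (λ _ ()) (λ i _ → none (suc i) z≤n)
... | yes _ with P? (g 0)
...   | yes p = ⊥-elim (none 0 z≤n p)
...   | no _  = sumℚ-filter-initial P? Q? f (λ i → g (suc i)) zero n z≤n (λ _ ()) (λ i _ → none (suc i) z≤n)
sumℚ-filter-initial P? Q? f g (suc m) (suc n) (s≤s m≤n) all none with Q? (g 0)
... | no ¬q = ⊥-elim (¬q (proj₂ (all 0 (s≤s z≤n))))
... | yes _ with P? (g 0)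
...   | no ¬p = ⊥-elim (¬p (proj₁ (all 0 (s≤s z≤n))))
...   | yes _ = trans (cong (f (g 0) +_) (sumℚ-filter-initial P? Q? f (λ i → g (suc i)) m n m≤n
          (λ i i<m → all (suc i) (s≤s i<m)) (λ i m≤i → none (suc i) (s≤s m≤i))))
        (sym (∑-front m (λ i → f (g i))))

cofactorSum≡harmonic : ∀ N d → d ℕ.≤ N → (∀ e → 0 ℕ.< e → e ℕ.≤ d → e ∣ N) → cofactorSum N d ≡ fromℕ N * harmonic d
cofactorSum≡harmonic N d d≤N all∣ = trans
  (sumℚ-filter-initial (ℕ._≤? d) (_∣? N) (cofactor N) suc d N d≤N
    (λ i i<d → i<d , all∣ (suc i) (s≤s z≤n) i<d) (λ i d≤i i<d → ℕ.<⇒≱ i<d d≤i))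
  (trans (∑-cong d (λ i _ → *-comm (fromℕ N) (1/1+ i)))
    (trans (sym (∑-*ʳ d 1/1+ (fromℕ N))) (*-comm (harmonic d) (fromℕ N))))

fromℕ-cancel-< : ∀ {m n} → fromℕ m < fromℕ n → m ℕ.< n
fromℕ-cancel-< {m} {n} h with n ℕ.≤? m
... | yes n≤m = ⊥-elim (<⇒≱ h (fromℕ-mono n≤m))
... | no  n≰m = ℕ.≰⇒> n≰m

fromℕ-cancel-≤ : ∀ {m n} → fromℕ m ≤ fromℕ n → m ℕ.≤ n
fromℕ-cancel-≤ {m} {n} h with m ℕ.≤? n
... | yes m≤n = m≤n
... | no  m≰n = ⊥-elim (<⇒≱ (<-≤-trans (p<1+p (fromℕ n)) (subst (_≤ fromℕ m) (fromℕ-suc n) (fromℕ-mono (ℕ.≰⇒> m≰n)))) h)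
  where
  p<1+p : ∀ p → p < 1ℚ + p
  p<1+p p = subst (_< 1ℚ + p) (+-identityˡ p) (+-monoˡ-< p 0<1)

fromℕ>0 : ∀ {n} → 0 ℕ.< n → 0ℚ < fromℕ n
fromℕ>0 {suc n} _ = fromℕ-suc>0 n

superabundant⇒ℕ : ∀ {N} → Superabundant N → SuperabundantN N
superabundant⇒ℕ {N} (0<N , sa) M 0<M M<N = fromℕ-cancel-< (subst₂ _<_
  (eq (fromℕ (σ M)) (recip (fromℕ M)) (fromℕ>0 0<M) (recip-inverseʳ (fromℕ>0 0<M)) (σ M) N refl)
  (trans (cong (abundancy N *_) (*-comm (fromℕ M) (fromℕ N))) (eq (fromℕ (σ N)) (recip (fromℕ N)) (fromℕ>0 0<N) (recip-inverseʳ (fromℕ>0 0<N)) (σ N) M refl))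
  (*-monoˡ-<-pos (fromℕ M * fromℕ N) {{positive (*-positive (fromℕ>0 0<M) (fromℕ>0 0<N))}} (sa M 0<M M<N)))
  where
  eq : ∀ s r {m : ℚ} → 0ℚ < m → m * r ≡ 1ℚ → ∀ S n → fromℕ S ≡ s → s * r * (m * fromℕ n) ≡ fromℕ (S ℕ.* n)
  eq s r {m} 0<m e S n refl = trans (solve 4 (λ s r m n → s :* r :* (m :* n) := s :* n :* (m :* r)) refl s r m (fromℕ n))
    (trans (cong (s * fromℕ n *_) e) (trans (*-identityʳ (s * fromℕ n)) (sym (fromℕ-* S n))))

-- Limits and large arguments of the logarithm

Eventually : (ℕ → Set) → Set
Eventually P = ∃ λ J → ∀ j → J ℕ.≤ j → P j

infixr 4 _∧_
_∧_ : ∀ {P Q} → Eventually P → Eventually Q → Eventually (λ j → P j × Q j)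
(J , p) ∧ (K , q) = J ℕ.⊔ K , λ j h → p j (ℕ.m⊔n≤o⇒m≤o J K h) , q j (ℕ.m⊔n≤o⇒n≤o J K h)

-- Otherwise c = a - b is positive, and for 2aη ≤ c/2 the left side is at least a - c/2 > b.
≤-limit : ∀ {a b} → 0ℚ ≤ a → (∀ η → 0ℚ < η → η ≤ 1ℚ → (1ℚ - η) * (1ℚ - η) * a ≤ b) → a ≤ b
≤-limit {a} {b} 0≤a h with a ≤? b
... | yes a≤b = a≤b
... | no  a≰b = ⊥-elim (<⇒≱ (half 0<c) (≤-trans (≤-by (η * η * a) (*-nonneg (square-nonneg η) 0≤a) eq) small))
  where
  c = a - b
  0<c : 0ℚ < c
  0<c = p<q⇒0<q-p (≰⇒> a≰b)
  van = vanishing (+-nonneg 0≤a 0≤a) (half 0<c)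
  J = proj₁ van
  η = 1/1+ J
  S = (1ℚ - η) * (1ℚ - η) * a
  small : (S - b) + ((a + a) * η - c * ½) ≤ 0ℚ
  small = ≤-trans (+-mono-≤ (p≤q+r⇒p-q≤r (≤-trans (h η (1/1+>0 J) (1/1+-anti {0} {J} z≤n)) (≤-reflexive (sym (+-identityʳ b)))))
      (p≤q+r⇒p-q≤r (≤-trans (proj₂ van J ℕ.≤-refl) (≤-reflexive (sym (+-identityʳ (c * ½))))))) (≤-reflexive (+-identityʳ 0ℚ))
  eq : c * ½ + η * η * a ≡ (S - b) + ((a + a) * η - c * ½)
  eq = trans (cong (_+ η * η * a) (trans (solve 1 (λ t → t := t :+ t :- t) refl (c * ½)) (cong (_- c * ½) (halves-sum c))))
    (solve 4 (λ a b e t → a :- b :- t :+ e :* e :* a := ((con 1ℚ :- e) :* (con 1ℚ :- e) :* a :- b) :+ ((a :+ a) :* e :- t)) refl a b η (c * ½))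

expSum-bounded : ∀ {B} → 0ℚ ≤ B → ∃ λ C → ∀ m → expSum m B ≤ C
expSum-bounded {B} 0≤B = L , λ m → ≤-trans (expSum-monoˡ m a 0≤B) (∑T≤L (ℕ.m≤n⇒m≤1+n (ℕ.m≤n+m a m)))
  where open ExpEstimates 0≤B

-- A Riemann sum at most B would give N ≤ F(B) ≤ C ≤ n. As C bounds the Taylor sums of every degree,
-- the resulting threshold for N is independent of the mesh.
logSum-large : ∀ {N n j B C} → 0ℚ ≤ B → expSum (suc j) B ≤ C → C ≤ fromℕ n → suc n ℕ.≤ N → B ≤ logSum (suc j) (fromℕ N)
logSum-large {N} {n} {j} {B} {C} 0≤B F≤C C≤n n<N = go (≤-total B L)
  where
  L = logSum (suc j) (fromℕ N)
  1≤N : 1ℚ ≤ fromℕ N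
  1≤N = fromℕ-mono {1} {N} (ℕ.≤-trans (s≤s z≤n) n<N)
  go : B ≤ L ⊎ L ≤ B → B ≤ L
  go (inj₁ B≤L) = B≤L
  go (inj₂ L≤B) = ⊥-elim (ℕ.<⇒≱ n<N (fromℕ-cancel-≤ {N} {n} (≤-trans (≤expSum-logSum j 1≤N)
    (≤-trans (expSum-mono (suc j) (LogSum.logSum≥0 j 1≤N) L≤B) (≤-trans F≤C C≤n)))))

logSum-unbounded : ∀ B → 0ℚ ≤ B → ∃ λ N₀ → ∀ N → N₀ ℕ.≤ N → ∀ j → B ≤ logSum (suc j) (fromℕ N)
logSum-unbounded B 0≤B = from-bound (expSum-bounded 0≤B)
  where
  from-bound : (∃ λ C → ∀ m → expSum m B ≤ C) → ∃ λ N₀ → ∀ N → N₀ ℕ.≤ N → ∀ j → B ≤ logSum (suc j) (fromℕ N)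
  from-bound (C , F≤C) = suc (proj₁ (archimedean C)) , λ N h j → logSum-large {N} {_} {j} 0≤B (F≤C (suc j)) (proj₂ (archimedean C)) h

expSum≤⇐≤log : ∀ {N S} → 0 ℕ.< N → 0ℚ ≤ S → Eventually (λ j → S ≤ logSum (suc j) (fromℕ N)) → ∀ m → expSum m S ≤ fromℕ N
expSum≤⇐≤log {N} {S} 0<N 0≤S (J , H) m = ≤-limit (expSum≥0 m 0≤S) λ η 0<η η≤1 →
  let K , mesh = vanishing (p≤q⇒0≤q-p 1≤N) 0<η
      j = J ℕ.⊔ K
  in expSum≤⇐≤logSum j 1≤N 0≤S (<⇒≤ 0<η) η≤1 (mesh j (ℕ.m≤n⊔m J K))
       (≤-trans (H j (ℕ.m≤m⊔n J K)) (p≤p+q (<⇒≤ 0<η))) m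
  where
  1≤N : 1ℚ ≤ fromℕ N
  1≤N = fromℕ-mono {1} {N} 0<N

-- The cutoff lies below y

expSum-harmonic≥ : ∀ {a b c : ℚ} M d {y} → 0ℚ ≤ b → a ≤ b * expSum M (harmonic d) → b * fromℕ (suc d) ≡ c → d ℕ.≤ y →
  ∃ λ m → a * fromℕ (suc y) ≤ c * expSum m (harmonic y)
expSum-harmonic≥ {a} {b} {c} M d {y} 0≤b a≤ bd≡c d≤y = M ℕ.+ i , (begin
  a * Y                                   ≤⟨ *-monoʳ (fromℕ-nonneg (suc y)) a≤ ⟩
  b * E * Y                               ≡⟨ solve 3 (λ c e Y → c :* e :* Y := c :* (Y :* e)) refl b E Y ⟩
  -- The bound at d propagates to y because e^{H_n} / (n + 1) increases.
  b * (Y * E)                             ≤⟨ *-monoˡ 0≤b (subst (λ t → fromℕ (suc t) * E ≤ fromℕ (suc d) * expSum (M ℕ.+ i) (harmonic t))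
                                               (ℕ.m+[n∸m]≡n d≤y) (expSum-harmonic-lower M d i)) ⟩
  b * (fromℕ (suc d) * F)                 ≡⟨ sym (*-assoc b (fromℕ (suc d)) F) ⟩
  b * fromℕ (suc d) * F                   ≡⟨ cong (_* F) bd≡c ⟩
  c * F                                   ∎)
  where
  open ≤-Reasoning
  i = y ℕ.∸ d
  Y = fromℕ (suc y)
  E = expSum M (harmonic d)
  F = expSum (M ℕ.+ i) (harmonic y)

-- e^{H_3} ≥ 31/5
expSum-harmonic≥31/20 : ∀ {y} → 3 ℕ.≤ y → ∃ λ m → fromℕ 31 * fromℕ (suc y) ≤ fromℕ 20 * expSum m (harmonic y)
-- H_3 = 11/6, where degree 8 already suffices for 31/5; and 20 = 5 · (3 + 1).
expSum-harmonic≥31/20 = expSum-harmonic≥ {fromℕ 31} {fromℕ 5} {fromℕ 20} 8 3 (fromℕ-nonneg 5)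
  (from-yes (fromℕ 31 ≤? fromℕ 5 * expSum 8 (harmonic 3))) refl

-- The scaling chain of `linear≤log` with its numerals abstracted; P, Q, F, x become p, y + 1,
-- F_m(H_y), log N.
scaled-≤ : ∀ {c b r t s P a Q h F x g : ℚ} → 0ℚ < c → c * b * r ≡ t → s ≡ b * P * r → t * P ≤ a * h * Q → 0ℚ ≤ a →
  h * Q ≤ g * F → 0ℚ ≤ F → ∀ {e} → a * g ≤ c * e → e * F ≤ x → s ≤ x
scaled-≤ {c} {b} {r} {t} {s} {P} {a} {Q} {h} {F} {x} {g} 0<c cbr s≡ tP≤ 0≤a hQ≤ 0≤F {e} ag≤ eF≤ = *-cancelˡ-≤′ 0<c (begin
  c * s             ≡⟨ cong (c *_) s≡ ⟩
  c * (b * P * r)   ≡⟨ solve 4 (λ c b P r → c :* (b :* P :* r) := c :* b :* r :* P) refl c b P r ⟩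
  c * b * r * P     ≡⟨ cong (_* P) cbr ⟩
  t * P             ≤⟨ tP≤ ⟩
  a * h * Q         ≡⟨ *-assoc a h Q ⟩
  a * (h * Q)       ≤⟨ *-monoˡ 0≤a hQ≤ ⟩
  a * (g * F)       ≡⟨ sym (*-assoc a g F) ⟩
  a * g * F         ≤⟨ *-monoʳ 0≤F ag≤ ⟩
  c * e * F         ≡⟨ *-assoc c e F ⟩
  c * (e * F)       ≤⟨ *-monoˡ (<⇒≤ 0<c) eF≤ ⟩
  c * x             ∎)
  where open ≤-Reasoning

fromℕ-*-mono : ∀ A B {m n} → A ℕ.* m ℕ.≤ B ℕ.* n → fromℕ A * fromℕ m ≤ fromℕ B * fromℕ n
fromℕ-*-mono A B {m} {n} h = subst₂ _≤_ (fromℕ-* A m) (fromℕ-* B n) (fromℕ-mono h)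

^≤⇐expSum≤ : ∀ {P Q N r} n → 0ℚ ≤ r → fromℕ P ≡ fromℕ Q * (1ℚ + r) → expSum n (fromℕ n * r) ≤ fromℕ N → P ℕ.^ n ℕ.≤ Q ℕ.^ n ℕ.* N
^≤⇐expSum≤ {P} {Q} {N} {r} n 0≤r e h = fromℕ-cancel-≤ {P ℕ.^ n} {Q ℕ.^ n ℕ.* N} (begin
  fromℕ (P ℕ.^ n)                              ≤⟨ expSum≥^ n r 0≤r {P} {Q} e ⟩
  fromℕ (Q ℕ.^ n) * expSum n (fromℕ n * r)     ≤⟨ *-monoˡ (fromℕ-nonneg (Q ℕ.^ n)) h ⟩
  fromℕ (Q ℕ.^ n) * fromℕ N                    ≡⟨ sym (fromℕ-* (Q ℕ.^ n) N) ⟩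
  fromℕ (Q ℕ.^ n ℕ.* N)                        ∎)
  where open ≤-Reasoning

module _ {N : ℕ} (0<N : 0 ℕ.< N) (x : ℕ → ℚ) (x≡ : ∀ j → x j ≡ logSum (suc j) (fromℕ N))
  (1≤x : ∀ j → 1ℚ ≤ x j) (mesh : ∀ η → 0ℚ < η → Eventually (λ j → (x j - 1ℚ) * 1/1+ j ≤ η)) where

  loglog : ℕ → ℚ
  loglog j = logSum (suc j) (x j)

  expSum≤x : ∀ {S} → 0ℚ ≤ S → (λ _ → S) ≲ loglog → ∀ η → 0ℚ < η → η ≤ 1ℚ →
    Eventually λ j → ∀ m → (1ℚ - η) * (1ℚ - η) * expSum m S ≤ x j
  expSum≤x 0≤S S≲ η 0<η η≤1 = let J , H = S≲ η 0<η ∧ mesh η 0<η in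
    J , λ j J≤j → expSum≤⇐≤logSum j (1≤x j) 0≤S (<⇒≤ 0<η) η≤1 (proj₂ (H j J≤j)) (proj₁ (H j J≤j))

  x≤expSum : ∀ {S} → 0ℚ ≤ S → loglog ≲ (λ _ → S) → ∀ η → 0ℚ < η → η ≤ 1ℚ →
    Eventually λ j → (1ℚ - η) * x j ≤ expSum (suc j) S
  x≤expSum 0≤S ≲S η 0<η η≤1 = let J , H = ≲S η 0<η in J , λ j J≤j → ≤expSum⇐logSum≤ j (1≤x j) 0≤S (<⇒≤ 0<η) η≤1 (H j J≤j)

  -- If H_y ≤ log log N, then log N ≥ (99/100)² e^{H_y} ≥ (49/50)(31/20)(y + 1) ≥ 29p/20. The
  -- tolerance 1/100 is chosen for (99/100)² ≥ 49/50.
  linear≤log : ∀ y p → 3 ℕ.≤ y → 1450 ℕ.* p ℕ.≤ 1519 ℕ.* suc y → (λ _ → harmonic y) ≲ loglog →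
    Eventually (λ j → fromℕ (29 ℕ.* p) * 1/1+ 19 ≤ logSum (suc j) (fromℕ N))
  linear≤log y p 3≤y p≤ H≲ = proj₁ log-large , λ j J≤j → subst (fromℕ (29 ℕ.* p) * 1/1+ 19 ≤_) (x≡ j)
      (scaled-≤ {fromℕ 1000} {fromℕ 29} {1/1+ 19} {fromℕ 1450} {fromℕ (29 ℕ.* p) * 1/1+ 19} {fromℕ p} {fromℕ 49} {fromℕ (suc y)} {fromℕ 31} {F} {x j} {fromℕ 20}
        (fromℕ-suc>0 999) cbr (cong (_* 1/1+ 19) (fromℕ-* 29 p)) tP≤ (fromℕ-nonneg 49) (proj₂ H-large) (expSum≥0 m (harmonic≥0 y))
        {(1ℚ - 1/1+ 99) * (1ℚ - 1/1+ 99)} ag≤ (proj₂ log-large j J≤j m))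
    where
    H-large = expSum-harmonic≥31/20 3≤y
    m = proj₁ H-large
    F = expSum m (harmonic y)
    log-large = expSum≤x (harmonic≥0 y) H≲ (1/1+ 99) (1/1+>0 99) (1/1+-anti {0} {99} z≤n)
    cbr : fromℕ 1000 * fromℕ 29 * 1/1+ 19 ≡ fromℕ 1450
    cbr = refl
    ag≤ : fromℕ 49 * fromℕ 20 ≤ fromℕ 1000 * ((1ℚ - 1/1+ 99) * (1ℚ - 1/1+ 99))
    ag≤ = from-yes (fromℕ 49 * fromℕ 20 ≤? fromℕ 1000 * ((1ℚ - 1/1+ 99) * (1ℚ - 1/1+ 99)))
    1519≡ : fromℕ 1519 ≡ fromℕ 49 * fromℕ 31
    1519≡ = refl
    tP≤ : fromℕ 1450 * fromℕ p ≤ fromℕ 49 * fromℕ 31 * fromℕ (suc y)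
    tP≤ = ≤-trans (fromℕ-*-mono 1450 1519 {p} {suc y} p≤) (≤-reflexive (cong (_* fromℕ (suc y)) 1519≡))

  -- Otherwise N ≥ e^{29p/20} ≥ (1 + 1/20)^(29p), which the last hypothesis excludes.
  harmonic-≴loglog : ∀ y p → 3 ℕ.≤ y → 1450 ℕ.* p ℕ.≤ 1519 ℕ.* suc y →
    ¬ 21 ℕ.^ (29 ℕ.* p) ℕ.≤ 20 ℕ.^ (29 ℕ.* p) ℕ.* N → ¬ (λ _ → harmonic y) ≲ loglog
  harmonic-≴loglog y p 3≤y p≤ ¬21^ H≲ = ¬21^ (^≤⇐expSum≤ {21} {20} {N} {1/1+ 19} (29 ℕ.* p) (1/1+≥0 19) refl
    (expSum≤⇐≤log 0<N (*-nonneg (fromℕ-nonneg (29 ℕ.* p)) (1/1+≥0 19)) (linear≤log y p 3≤y p≤ H≲) (29 ℕ.* p)))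

-- From harmonic bounds to the limit

-- Here x, F, u stand for log N, e^γ, e^{-γ}.
squeeze : ∀ {δ x D F u} → 0ℚ < δ → fromℕ 4 * δ ≤ 1ℚ → 0ℚ < x → 0ℚ ≤ D → 1ℚ ≤ F →
  (1ℚ - δ) * (D * F) ≤ x → (1ℚ - δ) * x ≤ (D + fromℕ 2) * (F + δ) → ∣ F * u - 1ℚ ∣ ≤ δ → fromℕ 2 ≤ δ * x →
  ∣ D * recip x - u ∣ ≤ fromℕ 10 * δ
squeeze {δ} {x} {D} {F} {u} 0<δ 4δ≤1 0<x 0≤D 1≤F h₁ h₂ h₃ h₄ = ∣p∣≤
  (p≤q+r⇒p-q≤r q≤) (subst (_≤ fromℕ 10 * δ) (solve 2 (λ u q → u :- q := :- (q :- u)) refl u q) (p≤q+r⇒p-q≤r u≤))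
  where
  open ≤-Reasoning
  q = D * recip x
  s = 1ℚ - δ
  0≤δ : 0ℚ ≤ δ
  0≤δ = <⇒≤ 0<δ
  0≤q : 0ℚ ≤ q
  0≤q = *-nonneg 0≤D (recip-nonneg 0<x)
  0≤F : 0ℚ ≤ F
  0≤F = ≤-trans 0≤1 1≤F
  D≡ : D ≡ q * x
  D≡ = sym (trans (solve 3 (λ D r x → D :* r :* x := D :* (x :* r)) refl D (recip x) x)
    (trans (cong (D *_) (recip-inverseʳ 0<x)) (*-identityʳ D)))
  w = F * u
  0≤1-4δ : 0ℚ ≤ 1ℚ - fromℕ 4 * δ
  0≤1-4δ = p≤q⇒0≤q-p 4δ≤1
  δ≤s : δ ≤ s
  δ≤s = ≤-by (1ℚ - fromℕ 4 * δ + (δ + δ)) (+-nonneg 0≤1-4δ (+-nonneg 0≤δ 0≤δ))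
    (solve 1 (λ d → d :+ (con 1ℚ :- con (fromℕ 4) :* d :+ (d :+ d)) := con 1ℚ :- d) refl δ)
  0<s : 0ℚ < s
  0<s = <-≤-trans 0<δ δ≤s
  0≤s : 0ℚ ≤ s
  0≤s = <⇒≤ 0<s
  1≤2s : 1ℚ ≤ s + s
  1≤2s = ≤-by (1ℚ - fromℕ 4 * δ + (δ + δ)) (+-nonneg 0≤1-4δ (+-nonneg 0≤δ 0≤δ))
    (solve 1 (λ d → con 1ℚ :+ (con 1ℚ :- con (fromℕ 4) :* d :+ (d :+ d)) := con 1ℚ :- d :+ (con 1ℚ :- d)) refl δ)
  s≤w : s ≤ w
  s≤w = ≤-by (δ - (1ℚ - w)) (p≤q⇒0≤q-p (≤-trans (p≤∣p∣ (1ℚ - w)) (subst (_≤ δ) (∣p-q∣≡∣q-p∣ w 1ℚ) h₃)))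
    (solve 2 (λ d w → con 1ℚ :- d :+ (d :- (con 1ℚ :- w)) := w) refl δ w)
  w≤1+δ : w ≤ 1ℚ + δ
  w≤1+δ = p-q≤r⇒p≤q+r {w} {1ℚ} (≤-trans (p≤∣p∣ (w - 1ℚ)) h₃)
  0≤u : 0ℚ ≤ u
  0≤u = sign (≤-total 0ℚ u)
    where
    sign : 0ℚ ≤ u ⊎ u ≤ 0ℚ → 0ℚ ≤ u
    sign (inj₁ 0≤u) = 0≤u
    sign (inj₂ u≤0) = ⊥-elim (<⇒≱ 0<s (≤-trans s≤w (subst (w ≤_) (*-zeroʳ F) (*-monoˡ 0≤F u≤0))))
  u≤1+δ : u ≤ 1ℚ + δ
  u≤1+δ = ≤-trans (subst (_≤ w) (*-identityˡ u) (*-monoʳ 0≤u 1≤F)) w≤1+δ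
  sqF≤1 : s * (q * F) ≤ 1ℚ
  sqF≤1 = *-cancelˡ-≤′ 0<x (begin
    x * (s * (q * F))     ≡⟨ solve 4 (λ x s q F → x :* (s :* (q :* F)) := s :* (q :* x :* F)) refl x s q F ⟩
    s * (q * x * F)       ≡⟨ cong (λ t → s * (t * F)) (sym D≡) ⟩
    s * (D * F)           ≤⟨ h₁ ⟩
    x                     ≡⟨ sym (*-identityʳ x) ⟩
    x * 1ℚ                ∎)
  sq≤1 : s * q ≤ 1ℚ
  sq≤1 = ≤-trans (*-monoˡ 0≤s (subst (_≤ q * F) (*-identityʳ q) (*-monoˡ 0≤q 1≤F))) sqF≤1
  q≤2 : q ≤ 1ℚ + 1ℚ
  q≤2 = begin
    q                     ≡⟨ sym (*-identityˡ q) ⟩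
    1ℚ * q                ≤⟨ *-monoʳ 0≤q 1≤2s ⟩
    (s + s) * q           ≡⟨ *-distribʳ-+ q s s ⟩
    s * q + s * q         ≤⟨ +-mono-≤ sq≤1 sq≤1 ⟩
    1ℚ + 1ℚ               ∎
  ssq≤u : s * (s * q) ≤ u
  ssq≤u = begin
    s * (s * q)           ≤⟨ *-monoʳ (*-nonneg 0≤s 0≤q) s≤w ⟩
    w * (s * q)           ≡⟨ solve 4 (λ F u s q → F :* u :* (s :* q) := s :* (q :* F) :* u) refl F u s q ⟩
    s * (q * F) * u       ≤⟨ *-monoʳ 0≤u sqF≤1 ⟩
    1ℚ * u                ≡⟨ *-identityˡ u ⟩
    u                     ∎
  su≤ : s * u ≤ (q + δ) * (w + δ * u)
  -- After division by x the shift of D by 2 costs at most δ, by `h₄`.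
  su≤ = begin
    s * u                     ≤⟨ *-monoʳ 0≤u (*-cancelˡ-≤′ 0<x s≤) ⟩
    (q + δ) * (F + δ) * u     ≡⟨ solve 4 (λ q d F u → (q :+ d) :* (F :+ d) :* u := (q :+ d) :* (F :* u :+ d :* u)) refl q δ F u ⟩
    (q + δ) * (w + δ * u)     ∎
    where
    s≤ : x * s ≤ x * ((q + δ) * (F + δ))
    s≤ = begin
      x * s                             ≡⟨ *-comm x s ⟩
      s * x                             ≤⟨ h₂ ⟩
      (D + fromℕ 2) * (F + δ)           ≤⟨ *-monoʳ (+-nonneg 0≤F 0≤δ) (+-mono-≤ (≤-reflexive D≡) h₄) ⟩
      (q * x + δ * x) * (F + δ)         ≡⟨ solve 4 (λ q x d F → (q :* x :+ d :* x) :* (F :+ d) := x :* ((q :+ d) :* (F :+ d))) refl q x δ F ⟩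
      x * ((q + δ) * (F + δ))           ∎
  0≤1-δ : 0ℚ ≤ 1ℚ - δ
  0≤1-δ = 0≤s
  0≤2-q : 0ℚ ≤ 1ℚ + 1ℚ - q
  0≤2-q = p≤q⇒0≤q-p q≤2
  q≤ : q ≤ u + fromℕ 10 * δ
  -- From (1 - δ)² q ≤ u and q ≤ 2 follows q - u ≤ 2δq ≤ 4δ; the other 6δ are slack.
  q≤ = ≤-by (u - s * (s * q) + (δ * δ * q + ((δ + δ) * (1ℚ + 1ℚ - q) + fromℕ 6 * δ)))
    (+-nonneg (p≤q⇒0≤q-p ssq≤u) (+-nonneg (*-nonneg (*-nonneg 0≤δ 0≤δ) 0≤q)
      (+-nonneg (*-nonneg (+-nonneg 0≤δ 0≤δ) 0≤2-q) (*-nonneg (fromℕ-nonneg 6) 0≤δ))))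
    (solve 3 (λ q u d → q :+ (u :- (con 1ℚ :- d) :* ((con 1ℚ :- d) :* q)
        :+ (d :* d :* q :+ ((d :+ d) :* (con 1ℚ :+ con 1ℚ :- q) :+ con (fromℕ 6) :* d)))
      := u :+ con (fromℕ 10) :* d) refl q u δ)
  u≤ : u ≤ q + fromℕ 10 * δ
  -- Expand `su≤` with w ≤ 1 + δ, u ≤ 1 + δ and q ≤ 2; each product is the nonnegative slack of one
  -- of these bounds, and 4δ ≤ 1 takes care of the higher powers of δ.
  u≤ = ≤-by ((q + δ) * (w + δ * u) - s * u + ((q + δ) * ((1ℚ + δ - w) + δ * (1ℚ + δ - u)) + (δ * (1ℚ + δ - u)
        + ((δ + δ + δ * δ) * (1ℚ + 1ℚ - q) + (δ * (1ℚ - fromℕ 4 * δ) + ((δ + δ + δ * δ) * (1ℚ - δ) + δ))))))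
    (+-nonneg (p≤q⇒0≤q-p su≤) (+-nonneg (*-nonneg (+-nonneg 0≤q 0≤δ) (+-nonneg (p≤q⇒0≤q-p w≤1+δ) δ[1+δ-u]≥0)) (+-nonneg δ[1+δ-u]≥0
      (+-nonneg (*-nonneg 2δ+δ²≥0 0≤2-q) (+-nonneg (*-nonneg 0≤δ 0≤1-4δ) (+-nonneg (*-nonneg 2δ+δ²≥0 0≤1-δ) 0≤δ))))))
    (solve 4 (λ q u d w → u :+ ((q :+ d) :* (w :+ d :* u) :- (con 1ℚ :- d) :* u :+ ((q :+ d) :* ((con 1ℚ :+ d :- w) :+ d :* (con 1ℚ :+ d :- u)) :+ (d :* (con 1ℚ :+ d :- u)
        :+ ((d :+ d :+ d :* d) :* (con 1ℚ :+ con 1ℚ :- q) :+ (d :* (con 1ℚ :- con (fromℕ 4) :* d) :+ ((d :+ d :+ d :* d) :* (con 1ℚ :- d) :+ d))))))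
      := q :+ con (fromℕ 10) :* d) refl q u δ w)
    where
    δ[1+δ-u]≥0 : 0ℚ ≤ δ * (1ℚ + δ - u)
    δ[1+δ-u]≥0 = *-nonneg 0≤δ (p≤q⇒0≤q-p u≤1+δ)
    2δ+δ²≥0 : 0ℚ ≤ δ + δ + δ * δ
    2δ+δ²≥0 = +-nonneg (+-nonneg 0≤δ 0≤δ) (*-nonneg 0≤δ 0≤δ)

-- G is an approximation of γ and x one of log N, both of index k.
close-at-index : ∀ {δ η x G d} k′ (index : ℕ)
  (G+l : G + logSum (suc index) (fromℕ (suc (suc k′))) ≡ harmonic (suc (suc k′)))
  (l-close : ∀ i → index ℕ.≤ i → logSum (suc index) (fromℕ (suc (suc k′))) ≤ logSum (suc i) (fromℕ (suc (suc k′))) + 1/1+ (suc k′)) →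
  let k = suc k′ in
  0ℚ < δ → fromℕ 4 * δ ≤ 1ℚ → δ ≡ fromℕ 4 * η → 0ℚ < x → fromℕ 2 ≤ δ * x → 1/1+ k ≤ η → 0 ℕ.< d → suc d ℕ.≤ suc k →
  (∀ m → (1ℚ - η) * (1ℚ - η) * expSum m (harmonic d) ≤ x) →
  (1ℚ - η) * x ≤ expSum (suc k) (harmonic (suc d)) →
  (∀ j → expSum (k ℕ.+ j) G ≤ expSum k G + δ) →
  ∣ expSum k G * expSum k (- G) - 1ℚ ∣ ≤ δ →
  ∣ fromℕ d * recip x - expSum k (- G) ∣ ≤ fromℕ 10 * δ
close-at-index {δ} {η} {x} {G} {d} k′ index G+l l-close 0<δ 4δ≤1 δ≡ 0<x 2≤δx ρ≤η 0<d d<K hU hL hF hR =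
  squeeze 0<δ 4δ≤1 0<x (fromℕ-nonneg d) (expSum≥1 k G≥0) lower upper hR 2≤δx
  where
  open ≤-Reasoning
  open GammaApprox k′ index G G+l l-close using (k; K; ρ; G≥0; γ-upper; γ-lower)
  D = fromℕ d
  F = expSum k G
  s = 1ℚ - η
  0≤η : 0ℚ ≤ η
  0≤η = ≤-trans (1/1+≥0 k) ρ≤η
  η≤δ : η ≤ δ
  η≤δ = ≤-by (fromℕ 3 * η) (*-nonneg (fromℕ-nonneg 3) 0≤η)
    (trans (solve 1 (λ e → e :+ con (fromℕ 3) :* e := con (fromℕ 4) :* e) refl η) (sym δ≡))
  δ≤1 : δ ≤ 1ℚ
  δ≤1 = ≤-trans (≤-by (fromℕ 3 * δ) (*-nonneg (fromℕ-nonneg 3) (<⇒≤ 0<δ)) (solve 1 (λ e → e :+ con (fromℕ 3) :* e := con (fromℕ 4) :* e) refl δ)) 4δ≤1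
  0≤s : 0ℚ ≤ s
  0≤s = p≤q⇒0≤q-p (≤-trans η≤δ δ≤1)
  -- Up to three factors 1 - η accumulate, and 1 - 4η is below their product.
  s²≥ : 1ℚ - δ ≤ s * s
  s²≥ = ≤-by (η + η + η * η) (+-nonneg (+-nonneg 0≤η 0≤η) (*-nonneg 0≤η 0≤η))
    (trans (cong (λ t → 1ℚ - t + (η + η + η * η)) δ≡)
      (solve 1 (λ e → con 1ℚ :- con (fromℕ 4) :* e :+ (e :+ e :+ e :* e) := (con 1ℚ :- e) :* (con 1ℚ :- e)) refl η))
  s³≥ : 1ℚ - δ ≤ s * s * s
  s³≥ = ≤-by (η + η * η + (η + η) * η * s + η * η * η) (+-nonneg (+-nonneg (+-nonneg 0≤η (*-nonneg 0≤η 0≤η))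
      (*-nonneg (*-nonneg (+-nonneg 0≤η 0≤η) 0≤η) 0≤s)) (*-nonneg (*-nonneg 0≤η 0≤η) 0≤η))
    (trans (cong (λ t → 1ℚ - t + (η + η * η + (η + η) * η * s + η * η * η)) δ≡)
      (solve 1 (λ e → con 1ℚ :- con (fromℕ 4) :* e :+ (e :+ e :* e :+ (e :+ e) :* e :* (con 1ℚ :- e) :+ e :* e :* e)
        := (con 1ℚ :- e) :* (con 1ℚ :- e) :* (con 1ℚ :- e)) refl η))
  lower : (1ℚ - δ) * (D * F) ≤ x
  lower = begin
    (1ℚ - δ) * (D * F)                            ≤⟨ *-monoʳ (*-nonneg (fromℕ-nonneg d) (expSum≥0 k G≥0)) s²≥ ⟩
    s * s * (D * F)                               ≤⟨ *-monoˡ (*-nonneg 0≤s 0≤s) (γ-upper d 0<d (ℕ.≤-trans (ℕ.n≤1+n d) d<K) k) ⟩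
    s * s * expSum (k ℕ.+ suc index) (harmonic d) ≤⟨ hU (k ℕ.+ suc index) ⟩
    x                                             ∎
  E = expSum (suc k) (harmonic (suc d))
  E≥0 : 0ℚ ≤ E
  E≥0 = expSum≥0 (suc k) (harmonic≥0 (suc d))
  ss≤ : s * s ≤ (1ℚ - ρ) * (1ℚ - ρ)
  ss≤ = *-mono-nn 0≤s s≤ 0≤s s≤
    where
    s≤ : s ≤ 1ℚ - ρ
    s≤ = +-monoʳ-≤ 1ℚ (neg-antimono-≤ ρ≤η)
  2+d : fromℕ (suc (suc d)) ≡ D + fromℕ 2
  2+d = trans (cong fromℕ (ℕ.+-comm 2 d)) (fromℕ-+ d 2)
  upper : (1ℚ - δ) * x ≤ (D + fromℕ 2) * (F + δ)
  upper = begin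
    (1ℚ - δ) * x                  ≤⟨ *-monoʳ (<⇒≤ 0<x) s³≥ ⟩
    s * s * s * x                 ≡⟨ *-assoc (s * s) s x ⟩
    s * s * (s * x)               ≤⟨ *-monoˡ (*-nonneg 0≤s 0≤s) hL ⟩
    s * s * E                     ≤⟨ *-monoʳ E≥0 ss≤ ⟩
    (1ℚ - ρ) * (1ℚ - ρ) * E       ≤⟨ γ-lower (suc d) d<K (suc k) ⟩
    fromℕ (suc (suc d)) * expSum (suc k ℕ.+ (K ℕ.∸ suc d)) G
                                  ≡⟨ cong₂ (λ a b → a * expSum b G) 2+d (sym (ℕ.+-suc k (K ℕ.∸ suc d))) ⟩
    (D + fromℕ 2) * expSum (k ℕ.+ suc (K ℕ.∸ suc d)) G
                                  ≤⟨ *-monoˡ (+-nonneg (fromℕ-nonneg d) (fromℕ-nonneg 2)) (hF (suc (K ℕ.∸ suc d))) ⟩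
    (D + fromℕ 2) * (F + δ)       ∎

-- The k-th approximation of γ is taken at the Cauchy modulus that `lim` picks. Of that modulus only
-- its one-sided closeness to later Riemann sums is recorded.
GammaData : ℕ → ℚ → Set
GammaData k G = ∃ λ index → G + logSum (suc index) (fromℕ (suc k)) ≡ harmonic (suc k) ×
  (∀ i → index ℕ.≤ i → logSum (suc index) (fromℕ (suc k)) ≤ logSum (suc i) (fromℕ (suc k)) + 1/1+ k)

difference⇒sum : ∀ {G H l} → G ≡ H - l → G + l ≡ H
difference⇒sum {G} {H} {l} e = trans (cong (_+ l) e) (solve 2 (λ H l → H :- l :+ l := H) refl H l)

close⇒≤ : ∀ {H a b r} → ∣ (H - b) - (H - a) ∣ ≤ r → a ≤ b + r
close⇒≤ {H} {a} {b} {r} h = p-q≤r⇒p≤q+r (≤-trans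
  (≤-reflexive (solve 3 (λ H a b → a :- b := (H :- b) :- (H :- a)) refl H a b)) (≤-trans (p≤∣p∣ _) h))

γ-data : ∀ k → GammaData k (approx γ k)
γ-data k = proj₁ modulus , difference⇒sum {approx γ k} {harmonic (suc k)} {logSum (suc (proj₁ modulus)) (fromℕ (suc k))} refl
  , λ i h → close⇒≤ {harmonic (suc k)} {logSum (suc (proj₁ modulus)) (fromℕ (suc k))} {logSum (suc i) (fromℕ (suc k))}
      (proj₂ modulus i (proj₁ modulus) h ℕ.≤-refl)
  where
  modulus = cauchy (fromℚ (harmonic (suc k)) -ᴿ logℕ (suc k)) (1/1+ k) (1/1+>0 k)

expSum-stable : ∀ {B δ} → 0ℚ ≤ B → 0ℚ < δ → Eventually λ k → ∀ j {g} → ∣ g ∣ ≤ B → expSum (k ℕ.+ j) g ≤ expSum k g + δ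
expSum-stable {B} {δ} 0≤B 0<δ = a ℕ.⊔ proj₁ small , λ k h j {g} g≤B → p-q≤r⇒p≤q+r (≤-trans (p≤∣p∣ _)
    (≤-trans (uniform-≤ (ℕ.m⊔n≤o⇒m≤o a (proj₁ small) h) (ℕ.m≤m+n k j) g≤B) (proj₂ small k (ℕ.m⊔n≤o⇒n≤o a (proj₁ small) h))))
  where
  open ExpEstimates 0≤B using (a; C; 0≤C; uniform-≤)
  small = vanishing 0≤C 0<δ

expSum-recip-near : ∀ {B δ} → 0ℚ ≤ B → 0ℚ < δ → Eventually λ k → ∀ {g} → ∣ g ∣ ≤ B → ∣ expSum k g * expSum k (- g) - 1ℚ ∣ ≤ δ
expSum-recip-near {B} {δ} 0≤B 0<δ =
  let C , 0≤C , K , H = expSum-recip 0≤B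
      J , small = vanishing 0≤C 0<δ
  in K ℕ.⊔ J , λ k h g≤B → ≤-trans (H k (ℕ.m⊔n≤o⇒m≤o K J h) g≤B) (small k (ℕ.m⊔n≤o⇒n≤o K J h))

module _ (g : ℕ → ℚ) (g-data : ∀ k → GammaData k (g k)) {B : ℚ} (0≤B : 0ℚ ≤ B) (g≤B : Eventually λ k → ∣ g k ∣ ≤ B) where

  eventually-close : ∀ {δ η d} (x : ℕ → ℚ) → 0ℚ < δ → fromℕ 4 * δ ≤ 1ℚ → δ ≡ fromℕ 4 * η → 0ℚ < η →
    (∀ j → 0ℚ < x j) → (∀ j → fromℕ 2 ≤ δ * x j) → 0 ℕ.< d →
    Eventually (λ j → ∀ m → (1ℚ - η) * (1ℚ - η) * expSum m (harmonic d) ≤ x j) →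
    Eventually (λ j → (1ℚ - η) * x j ≤ expSum (suc j) (harmonic (suc d))) →
    Eventually (λ k → ∣ fromℕ d * recip (x k) - expSum k (- g k) ∣ ≤ fromℕ 10 * δ)
  -- The extra `suc` makes the index positive, as `close-at-index` expects.
  eventually-close {δ} {η} {d} x 0<δ 4δ≤1 δ≡ 0<η 0<x 2≤δx 0<d hU hL = suc (proj₁ all) , at
    where
    mesh : Eventually (λ k → 1/1+ k ≤ η)
    mesh = proj₁ (1/1+-small 0<η) , λ k h → ≤-trans (1/1+-anti h) (proj₂ (1/1+-small 0<η))
    large : Eventually (λ k → suc d ℕ.≤ suc k)
    large = d , λ k d≤k → s≤s d≤k
    all = hU ∧ hL ∧ mesh ∧ large ∧ g≤B ∧ expSum-stable 0≤B 0<δ ∧ expSum-recip-near 0≤B 0<δ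
    at : ∀ k → suc (proj₁ all) ℕ.≤ k → ∣ fromℕ d * recip (x k) - expSum k (- g k) ∣ ≤ fromℕ 10 * δ
    at k@(suc k′) h =
      let hUₖ , hLₖ , ρ≤η , d<K , gₖ≤B , stable , near = proj₂ all k (ℕ.≤-trans (ℕ.n≤1+n _) h)
          index , G+l , l-close = g-data k
      in close-at-index k′ index G+l l-close 0<δ 4δ≤1 δ≡ (0<x k) (2≤δx k) ρ≤η 0<d d<K hUₖ hLₖ (λ j → stable j gₖ≤B) (near gₖ≤B)

-- By admissibility and maximality of d, H_d ≤ log log N ≤ H_{d+1}.
cutoff-bounds : ∀ {N d y} (x : ℕ → ℚ) → 0 ℕ.< N → (∀ m → 0 ℕ.< m → m ℕ.≤ y → m ∣ N) → 0 ℕ.< y →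
  ¬ (λ _ → harmonic y) ≲ (λ j → logSum (suc j) (x j)) → d ∣ N →
  (λ _ → cofactorSum N d) ≲ (λ j → fromℕ N * logSum (suc j) (x j)) →
  (suc d ∣ N → (λ j → fromℕ N * logSum (suc j) (x j)) ≲ (λ _ → cofactorSum N (suc d))) →
  0 ℕ.< d × (λ _ → harmonic d) ≲ (λ j → logSum (suc j) (x j)) × (λ j → logSum (suc j) (x j)) ≲ (λ _ → harmonic (suc d))
cutoff-bounds {N} {d} {y} x 0<N all∣ 0<y y≴ d∣N below above = 0<d d d∣N , H-d≲ , ≲H-1+d
  where
  l : ℕ → ℚ
  l j = logSum (suc j) (x j)
  0<Nℚ : 0ℚ < fromℕ N
  0<Nℚ = fromℕ>0 0<N
  0<d : ∀ d → d ∣ N → 0 ℕ.< d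
  0<d zero    0∣N = ⊥-elim (ℕ.<-irrefl (sym (0∣⇒≡0 0∣N)) 0<N)
  0<d (suc _) _   = s≤s z≤n
  y≤N : y ℕ.≤ N
  y≤N = ∣⇒≤ {{ℕ.>-nonZero 0<N}} (all∣ y 0<y ℕ.≤-refl)
  sum≡ : ∀ e → e ℕ.≤ y → cofactorSum N e ≡ fromℕ N * harmonic e
  sum≡ e e≤y = cofactorSum≡harmonic N e (ℕ.≤-trans e≤y y≤N) (λ m 0<m m≤e → all∣ m 0<m (ℕ.≤-trans m≤e e≤y))
  d<y : d ℕ.< y
  -- Otherwise monotonicity of `cofactorSum` carries the bound at d down to y, where the sum is N
  -- H_y.
  d<y = ℕ.≰⇒> λ y≤d → y≴ (≲-cancel {fromℕ N} {λ _ → harmonic y} {l} 0<Nℚ λ η 0<η → let J , H = below η 0<η in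
    J , λ j J≤j → ≤-trans (≤-reflexive (sym (sum≡ y ℕ.≤-refl))) (≤-trans (cofactorSum-mono N y≤d) (H j J≤j)))
  H-d≲ : (λ _ → harmonic d) ≲ l
  H-d≲ = ≲-cancel {fromℕ N} {λ _ → harmonic d} {l} 0<Nℚ λ η 0<η → let J , H = below η 0<η in
    J , λ j J≤j → ≤-trans (≤-reflexive (sym (sum≡ d (ℕ.<⇒≤ d<y)))) (H j J≤j)
  ≲H-1+d : l ≲ (λ _ → harmonic (suc d))
  ≲H-1+d = ≲-cancel {fromℕ N} {l} {λ _ → harmonic (suc d)} 0<Nℚ λ η 0<η →
    let J , H = above (all∣ (suc d) (s≤s z≤n) d<y) η 0<η in
    J , λ j J≤j → ≤-trans (H j J≤j) (≤-reflexive (cong (_+ η) (sum≡ (suc d) d<y)))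

log-mesh : ∀ (x : ℝ) η → 0ℚ < η → Eventually (λ j → (approx x j - 1ℚ) * 1/1+ j ≤ η)
log-mesh x η 0<η =
  let B , 0≤B , K , H = bounded x
      J , small = vanishing 0≤B 0<η
  in K ℕ.⊔ J , λ j h → ≤-trans
       (*-monoʳ (1/1+≥0 j) (≤-trans (≤-by {approx x j - 1ℚ} {approx x j} 1ℚ 0≤1 (solve 1 (λ p → p :- con 1ℚ :+ con 1ℚ := p) refl (approx x j)))
         (≤-trans (p≤∣p∣ (approx x j)) (H j (ℕ.m⊔n≤o⇒m≤o K J h)))))
       (small j (ℕ.m⊔n≤o⇒n≤o K J h))

logℕ-approx : ∀ N → 0 ℕ.< N → ∀ j → approx (logℕ N) j ≡ logSum (suc j) (fromℕ N)
logℕ-approx (suc N) _ j = refl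

-- δ = 4η is the tolerance of squeeze; n is chosen so that 10δ ≤ ε / 2.
module Tolerance {ε : ℚ} (0<ε : 0ℚ < ε) where

  small = vanishing {fromℕ 10} (fromℕ-nonneg 10) (half 0<ε)
  -- The summand 3 secures 4δ ≤ 1.
  n = 3 ℕ.+ proj₁ small
  δ = 1/1+ n
  η = δ * 1/1+ 3
  -- This is 2/δ, the size demanded of log N so that the shift by 2 becomes negligible.
  X = fromℕ 2 * fromℕ (suc n)

  0<δ : 0ℚ < δ
  0<δ = 1/1+>0 n

  10δ≤ : fromℕ 10 * δ ≤ ε * ½
  10δ≤ = proj₂ small n (ℕ.m≤n+m (proj₁ small) 3)

  4δ≤1 : fromℕ 4 * δ ≤ 1ℚ
  4δ≤1 = ≤-trans (*-monoˡ (fromℕ-nonneg 4) (1/1+-anti {3} {n} (ℕ.m≤m+n 3 (proj₁ small)))) (≤-reflexive (1/1+-inverse 3))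

  δ≡4η : δ ≡ fromℕ 4 * η
  δ≡4η = sym (trans (solve 3 (λ f d r → f :* (d :* r) := d :* (f :* r)) refl (fromℕ 4) δ (1/1+ 3))
    (trans (cong (δ *_) (1/1+-inverse 3)) (*-identityʳ δ)))

  0<η : 0ℚ < η
  0<η = *-positive 0<δ (1/1+>0 3)

  η≤1 : η ≤ 1ℚ
  η≤1 = ≤-trans (*-mono-nn (<⇒≤ 0<δ) (1/1+-anti {0} {n} z≤n) (1/1+≥0 3) (1/1+-anti {0} {3} z≤n)) ≤-refl

  δX : δ * X ≡ fromℕ 2
  δX = trans (solve 3 (λ d t n → d :* (t :* n) := t :* (n :* d)) refl δ (fromℕ 2) (fromℕ (suc n)))
    (trans (cong (fromℕ 2 *_) (1/1+-inverse n)) (*-identityʳ (fromℕ 2)))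

  1≤X : 1ℚ ≤ X
  1≤X = ≤-trans (*-mono-nn 0≤1 (fromℕ-mono {1} {2} (s≤s z≤n)) 0≤1 (fromℕ-mono {1} {suc n} (s≤s z≤n))) ≤-refl

proposition9 : ∀ (ε : ℚ) → 0ℚ < ε →
    ∃ λ (N₀ : ℕ) → ∀ (N : ℕ) → .{{_ : ℕ.NonTrivial N}} → N₀ ℕ.≤ N → Superabundant N →
    ∀ (d : ℕ) → IsFirstCutoff N d →
    ∣ fromℕᴿ d *ᴿ recipᴿ (logℕ N) (logℕ>0 N) -ᴿ exp (-ᴿ γ) ∣ᴿ <ᴿ fromℚ ε
proposition9 ε 0<ε = proj₁ small-divisors ℕ.⊔ proj₁ log-large , λ N N₀≤N sa d cutoff →
  let open Tolerance 0<ε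
      N₁ = proj₁ small-divisors
      N₂ = proj₁ log-large
      0<N = proj₁ sa
      x = approx (logℕ N)
      x≡ = logℕ-approx N 0<N
      X≤x : ∀ j → X ≤ x j
      X≤x j = subst (X ≤_) (sym (x≡ j)) (proj₂ log-large N (ℕ.m⊔n≤o⇒n≤o N₁ N₂ N₀≤N) j)
      1≤x : ∀ j → 1ℚ ≤ x j
      1≤x j = ≤-trans 1≤X (X≤x j)
      0<x : ∀ j → 0ℚ < x j
      0<x j = <-≤-trans 0<1 (1≤x j)
      y , 3≤y , all∣ , p , p≤ , ¬21^≤ = proj₂ small-divisors (ℕ.m⊔n≤o⇒m≤o N₁ N₂ N₀≤N) (superabundant⇒ℕ sa)
      (d∣N , adm) , maximal = cutoff
      0<d , H≲ , ≲H = cutoff-bounds x 0<N all∣ (ℕ.≤-trans (s≤s z≤n) 3≤y)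
        (harmonic-≴loglog 0<N x x≡ 1≤x (log-mesh (logℕ N)) y p 3≤y p≤ ¬21^≤) d∣N adm
        -- Maximality of d refutes the admissibility of d + 1, and `≰⇒≲` turns the refutation into
        -- an upper bound for log log N.
        (λ 1+d∣N → ≰⇒≲ (fromℕᴿ N *ᴿ loglogℕ N) λ adm′ → ℕ.<-irrefl refl (maximal (suc d) (1+d∣N , adm′)))
      K , H = eventually-close (approx γ) γ-data (proj₁ (proj₂ (bounded γ))) (proj₂ (proj₂ (bounded γ))) x
        0<δ 4δ≤1 δ≡4η 0<η 0<x (λ j → ≤-trans (≤-reflexive (sym δX)) (*-monoˡ (<⇒≤ 0<δ) (X≤x j))) 0<d
        (expSum≤x 0<N x x≡ 1≤x (log-mesh (logℕ N)) (harmonic≥0 d) H≲ η 0<η η≤1)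
        (x≤expSum 0<N x x≡ 1≤x (log-mesh (logℕ N)) (harmonic≥0 (suc d)) ≲H η 0<η η≤1)
  -- `_<ᴿ_` asks for a fixed gap: 10δ takes one half of ε, and the other half is the gap.
  in ε * ½ , half 0<ε , K , λ j K≤j → ≤-trans (+-monoˡ-≤ (ε * ½) (≤-trans (H j K≤j) 10δ≤)) (≤-reflexive (halves-sum ε))
  where
  log-large = logSum-unbounded (Tolerance.X 0<ε) (≤-trans 0≤1 (Tolerance.1≤X 0<ε))
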